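{- Fix an integer $\ell \geq 2$ and a real $\rho > 0$. There exist constants $N = N(\ell,\rho)$ and $K = K(\ell,\rho)$ such that the following hold for all integers $\kappa_1,\ldots,\kappa_\ell \geq \rho n$ summing to $n \geq N$ (with $\kappa_i$ positive). (1) If $f\colon \mathcal{U}_\kappa \to \mathbb{R}$ is a degree 1 function and $\mathbb{E}[\operatorname{dist}(f,\{0,1\})^2] = \epsilon$, then there exists a Boolean function $g\colon \mathcal{U}_\kappa \to \{0,1\}$, depending on a single coordinate, such that $\mathbb{E}[(f-g)^2] \leq \epsilon + K\epsilon^2$. (2) If $F\colon \mathcal{U}_\kappa \to \{0,1\}$ satisfies $\|F^{>1}\|^2 = \epsilon$, then there exists a Boolean function $g\colon \mathcal{U}_\kappa \to \{0,1\}$, depending on a single coordinate, such that $\Pr[F \neq g] \leq 4\epsilon + K\epsilon^2$.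
   Context: For positive integers $\kappa_1,\ldots,\kappa_\ell$ summing to $n$, the multislice $\mathcal{U}_\kappa$ is the set of all $u \in [\ell]^n$ in which exactly $\kappa_i$ coordinates equal $i$, for every $i \in [\ell]$. It carries the uniform probability measure; $\mathbb{E}$ and $\Pr$ are with respect to it, and $\|f\| = \sqrt{\mathbb{E}[f^2]}$. For a real $x$ and a finite set $S$, $\operatorname{dist}(x,S) = \min_{y\in S}|x-y|$. For $j \in [n]$, $i \in [\ell]$ let $x_{ji}\colon \mathcal{U}_\kappa \to \{0,1\}$ be $x_{ji}(u) = 1$ if $u_j = i$ and $0$ otherwise. A function on $\mathcal{U}_\kappa$ is a degree 1 function if it can be written as a polynomial of degree at most 1 in the variables $x_{ji}$. Equivalently, it is a linear combination of functions each depending on a single coordinate (constants included); equivalently, it lies in $V^{(n)} \oplus V^{(n-1,1)}$, where $V^\lambda$ denotes the isotypic component, corresponding to the partition $\lambda$ of $n$, of the permutation representation of $S_n$ on $\mathbb{R}^{\mathcal{U}_\kappa}$ ($S_n$ acting by permuting coordinates). For $F\colon \mathcal{U}_\kappa \to \mathbb{R}$, $F^{\le 1}$ is the orthogonal projection of $F$ to $V^{(n)} \oplus V^{(n-1,1)}$ (the space of degree 1 functions) and $F^{>1} = F - F^{\leq 1}$. A function depends on a single coordinate if there is $j \in [n]$ such that its value at $u$ is determined by $u_j$; constant functions are included. -}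

module Defs where

open import Data.Bool.Base using (Bool; if_then_else_)
open import Data.Fin.Base using (Fin)
import Data.Fin.Properties as Fin
open import Data.Integer.Base using (+_)
open import Data.List.Base as List using (List; []; _∷_)
open import Data.List.NonEmpty as List⁺ using (List⁺; _∷_)
open import Data.Maybe.Base as Maybe using (Maybe)
open import Data.Nat.Base as ℕ using (ℕ; zero; suc)
import Data.Nat.Properties as ℕ
open import Data.Product using (_×_; _,_; proj₁; proj₂; Σ-syntax; ∃-syntax)
open import Data.Rational.Base as ℚ using (ℚ; 0ℚ; 1ℚ; ½; Positive)
import Data.Rational.Properties as ℚ
open import Data.Rational.Solver using (module +-*-Solver)
open import Data.Sum.Base using (inj₁; inj₂)
open import Data.Vec.Base as Vec using (Vec; []; _∷_; lookup)
open import Level using (0ℓ)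
open import Relation.Binary.PropositionalEquality
open import Relation.Nullary.Decidable using (Dec; does; dec⇒maybe)
open import Relation.Unary using (Pred; Decidable)

-- ℝ is the setoid of Cauchy sequences of rationals under _≃_; the operations
-- are pointwise.

infix  8 ∣_∣ _²
infixl 7 _*_ _⊓_
infixl 6 _+_ _-_
infix  4 _≃_ _≤_ _<_

IsCauchy : (ℕ → ℚ) → Set
IsCauchy x = ∀ ε → .{{Positive ε}} →
  ∃[ N ] ∀ m n → N ℕ.≤ m → N ℕ.≤ n → ℚ.∣ x m ℚ.- x n ∣ ℚ.≤ ε

record ℝ : Set where
  constructor mkℝ
  field
    seq    : ℕ → ℚ
    cauchy : IsCauchy seq

open ℝ public

_≃_ : ℝ → ℝ → Set
x ≃ y = ∀ ε → .{{Positive ε}} →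
  ∃[ N ] ∀ n → N ℕ.≤ n → ℚ.∣ seq x n ℚ.- seq y n ∣ ℚ.≤ ε

_≤_ : ℝ → ℝ → Set
x ≤ y = ∀ ε → .{{Positive ε}} →
  ∃[ N ] ∀ n → N ℕ.≤ n → seq x n ℚ.≤ seq y n ℚ.+ ε

_<_ : ℝ → ℝ → Set
x < y = Σ[ ε ∈ ℚ ] Positive ε ×
  (∃[ N ] ∀ n → N ℕ.≤ n → seq x n ℚ.+ ε ℚ.≤ seq y n)

private
  open ℚ.≤-Reasoning

  half-pos : ∀ ε → .{{Positive ε}} → Positive (½ ℚ.* ε)
  half-pos ε = ℚ.pos*pos⇒pos ½ ε

  halves : ∀ ε → ½ ℚ.* ε ℚ.+ ½ ℚ.* ε ≡ ε
  halves ε = trans (sym (ℚ.*-distribʳ-+ ε ½ ½)) (ℚ.*-identityˡ ε)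

  ≤∣∣ : ∀ p → p ℚ.≤ ℚ.∣ p ∣
  ≤∣∣ p with ℚ.≤-total 0ℚ p
  ... | inj₁ 0≤p = ℚ.≤-reflexive (sym (ℚ.0≤p⇒∣p∣≡p 0≤p))
  ... | inj₂ p≤0 = ℚ.≤-trans p≤0 (ℚ.nonNegative⁻¹ ℚ.∣ p ∣ {{ℚ.∣-∣-nonNeg p}})

  ∣-∣-comm : ∀ p q → ℚ.∣ p ℚ.- q ∣ ≡ ℚ.∣ q ℚ.- p ∣
  ∣-∣-comm p q = trans (sym (ℚ.∣-p∣≡∣p∣ (p ℚ.- q))) (cong ℚ.∣_∣ (lemma p q))
    where
    open +-*-Solver
    lemma : ∀ p q → ℚ.- (p ℚ.- q) ≡ q ℚ.- p
    lemma = solve 2 (λ p q → :- (p :- q) := q :- p) refl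

  near⇒≤ : ∀ p q {ε} → ℚ.∣ p ℚ.- q ∣ ℚ.≤ ε → p ℚ.≤ q ℚ.+ ε
  near⇒≤ p q {ε} h = begin
    p                 ≡⟨ lemma p q ⟩
    q ℚ.+ (p ℚ.- q)   ≤⟨ ℚ.+-monoʳ-≤ q (ℚ.≤-trans (≤∣∣ (p ℚ.- q)) h) ⟩
    q ℚ.+ ε           ∎
    where
    open +-*-Solver
    lemma : ∀ p q → p ≡ q ℚ.+ (p ℚ.- q)
    lemma = solve 2 (λ p q → p := q :+ (p :- q)) refl

  ≤⇒-≤ : ∀ {p q ε} → p ℚ.≤ q ℚ.+ ε → p ℚ.- q ℚ.≤ ε
  ≤⇒-≤ {p} {q} {ε} h = begin
    p ℚ.- q           ≤⟨ ℚ.+-monoˡ-≤ (ℚ.- q) h ⟩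
    (q ℚ.+ ε) ℚ.- q   ≡⟨ lemma q ε ⟩
    ε                 ∎
    where
    open +-*-Solver
    lemma : ∀ q ε → (q ℚ.+ ε) ℚ.- q ≡ ε
    lemma = solve 2 (λ q ε → (q :+ ε) :- q := ε) refl

  ≤⇒near : ∀ {p q ε} → p ℚ.≤ q ℚ.+ ε → q ℚ.≤ p ℚ.+ ε → ℚ.∣ p ℚ.- q ∣ ℚ.≤ ε
  ≤⇒near {p} {q} {ε} h₁ h₂ with ℚ.≤-total 0ℚ (p ℚ.- q)
  ... | inj₁ 0≤d = ℚ.≤-trans (ℚ.≤-reflexive (ℚ.0≤p⇒∣p∣≡p 0≤d)) (≤⇒-≤ h₁)
  ... | inj₂ d≤0 = begin
    ℚ.∣ p ℚ.- q ∣   ≡⟨ ∣-∣-comm p q ⟩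
    ℚ.∣ q ℚ.- p ∣   ≡⟨ ℚ.0≤p⇒∣p∣≡p (subst (0ℚ ℚ.≤_) (lemma p q) (ℚ.neg-antimono-≤ d≤0)) ⟩
    q ℚ.- p         ≤⟨ ≤⇒-≤ h₂ ⟩
    ε               ∎
    where
    open +-*-Solver
    lemma : ∀ p q → ℚ.- (p ℚ.- q) ≡ q ℚ.- p
    lemma = solve 2 (λ p q → :- (p :- q) := q :- p) refl

  bounded : ∀ x → IsCauchy x →
            Σ[ B ∈ ℚ ] Positive B × (∃[ N ] ∀ n → N ℕ.≤ n → ℚ.∣ x n ∣ ℚ.≤ B)
  bounded x cx with cx 1ℚ
  ... | N , h = ℚ.∣ x N ∣ ℚ.+ 1ℚ
              , ℚ.nonNeg+pos⇒pos ℚ.∣ x N ∣ {{ℚ.∣-∣-nonNeg (x N)}} 1ℚ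
              , N , bound
    where
    lemma : ∀ p q → p ≡ q ℚ.+ (p ℚ.- q)
    lemma = solve 2 (λ p q → p := q :+ (p :- q)) refl
      where open +-*-Solver
    bound : ∀ n → N ℕ.≤ n → ℚ.∣ x n ∣ ℚ.≤ ℚ.∣ x N ∣ ℚ.+ 1ℚ
    bound n N≤n = begin
      ℚ.∣ x n ∣                           ≡⟨ cong ℚ.∣_∣ (lemma (x n) (x N)) ⟩
      ℚ.∣ x N ℚ.+ (x n ℚ.- x N) ∣         ≤⟨ ℚ.∣p+q∣≤∣p∣+∣q∣ (x N) (x n ℚ.- x N) ⟩
      ℚ.∣ x N ∣ ℚ.+ ℚ.∣ x n ℚ.- x N ∣     ≤⟨ ℚ.+-monoʳ-≤ ℚ.∣ x N ∣ (h n N N≤n ℕ.≤-refl) ⟩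
      ℚ.∣ x N ∣ ℚ.+ 1ℚ                    ∎

  -- δ with B * δ ≡ ½ * ε
  share : ∀ ε → .{{Positive ε}} → ∀ B → Positive B →
          Σ[ δ ∈ ℚ ] Positive δ × (B ℚ.* δ ≡ ½ ℚ.* ε)
  share ε B B>0 = B⁻¹ ℚ.* (½ ℚ.* ε)
    , ℚ.pos*pos⇒pos B⁻¹ {{ℚ.1/pos⇒pos B}} (½ ℚ.* ε) {{half-pos ε}}
    , trans (sym (ℚ.*-assoc B B⁻¹ (½ ℚ.* ε)))
            (trans (cong (ℚ._* (½ ℚ.* ε)) (ℚ.*-inverseʳ B)) (ℚ.*-identityˡ (½ ℚ.* ε)))
    where
    instance
      _ = B>0
      B≢0 = ℚ.pos⇒nonZero B
    B⁻¹ : ℚ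
    B⁻¹ = ℚ.1/ B

  abstract
    const-cauchy : ∀ q → IsCauchy (λ _ → q)
    const-cauchy q ε = 0 , λ _ _ _ _ →
      subst (ℚ._≤ ε) (sym (cong ℚ.∣_∣ (ℚ.+-inverseʳ q))) (ℚ.<⇒≤ (ℚ.positive⁻¹ ε))

    +-cauchy : ∀ x y → IsCauchy x → IsCauchy y → IsCauchy (λ n → x n ℚ.+ y n)
    +-cauchy x y cx cy ε
      with cx (½ ℚ.* ε) {{half-pos ε}} | cy (½ ℚ.* ε) {{half-pos ε}}
    ... | N₁ , h₁ | N₂ , h₂ = N₁ ℕ.⊔ N₂ , λ m n N≤m N≤n → begin
      ℚ.∣ (x m ℚ.+ y m) ℚ.- (x n ℚ.+ y n) ∣
        ≡⟨ cong ℚ.∣_∣ (lemma (x m) (y m) (x n) (y n)) ⟩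
      ℚ.∣ (x m ℚ.- x n) ℚ.+ (y m ℚ.- y n) ∣
        ≤⟨ ℚ.∣p+q∣≤∣p∣+∣q∣ (x m ℚ.- x n) (y m ℚ.- y n) ⟩
      ℚ.∣ x m ℚ.- x n ∣ ℚ.+ ℚ.∣ y m ℚ.- y n ∣
        ≤⟨ ℚ.+-mono-≤ (h₁ m n (ℕ.m⊔n≤o⇒m≤o N₁ N₂ N≤m) (ℕ.m⊔n≤o⇒m≤o N₁ N₂ N≤n))
                      (h₂ m n (ℕ.m⊔n≤o⇒n≤o N₁ N₂ N≤m) (ℕ.m⊔n≤o⇒n≤o N₁ N₂ N≤n)) ⟩
      ½ ℚ.* ε ℚ.+ ½ ℚ.* ε
        ≡⟨ halves ε ⟩
      ε ∎
      where
      open +-*-Solver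
      lemma : ∀ a b c d → (a ℚ.+ b) ℚ.- (c ℚ.+ d) ≡ (a ℚ.- c) ℚ.+ (b ℚ.- d)
      lemma = solve 4 (λ a b c d → (a :+ b) :- (c :+ d) := (a :- c) :+ (b :- d)) refl

    neg-cauchy : ∀ x → IsCauchy x → IsCauchy (λ n → ℚ.- x n)
    neg-cauchy x cx ε with cx ε
    ... | N , h = N , λ m n N≤m N≤n →
      subst (ℚ._≤ ε) (cong ℚ.∣_∣ (lemma (x m) (x n))) (h n m N≤n N≤m)
      where
      open +-*-Solver
      lemma : ∀ a b → b ℚ.- a ≡ (ℚ.- a) ℚ.- (ℚ.- b)
      lemma = solve 2 (λ a b → b :- a := (:- a) :- (:- b)) refl

    ∣*∣-mono : ∀ p q {A δ} → Positive A → ℚ.∣ p ∣ ℚ.≤ A → ℚ.∣ q ∣ ℚ.≤ δ →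
               ℚ.∣ p ℚ.* q ∣ ℚ.≤ A ℚ.* δ
    ∣*∣-mono p q {A} {δ} A>0 p≤A q≤δ = begin
      ℚ.∣ p ℚ.* q ∣           ≡⟨ ℚ.∣p*q∣≡∣p∣*∣q∣ p q ⟩
      ℚ.∣ p ∣ ℚ.* ℚ.∣ q ∣     ≤⟨ ℚ.*-monoʳ-≤-nonNeg ℚ.∣ q ∣ {{ℚ.∣-∣-nonNeg q}} p≤A ⟩
      A ℚ.* ℚ.∣ q ∣           ≤⟨ ℚ.*-monoˡ-≤-nonNeg A {{ℚ.pos⇒nonNeg A {{A>0}}}} q≤δ ⟩
      A ℚ.* δ                 ∎

    *-near : ∀ {A B δ₁ δ₂ ε} a b c d → Positive A → Positive B →
             A ℚ.* δ₁ ≡ ½ ℚ.* ε → B ℚ.* δ₂ ≡ ½ ℚ.* ε →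
             ℚ.∣ a ∣ ℚ.≤ A → ℚ.∣ d ∣ ℚ.≤ B →
             ℚ.∣ b ℚ.- d ∣ ℚ.≤ δ₁ → ℚ.∣ a ℚ.- c ∣ ℚ.≤ δ₂ →
             ℚ.∣ a ℚ.* b ℚ.- c ℚ.* d ∣ ℚ.≤ ε
    *-near {A} {B} {δ₁} {δ₂} {ε} a b c d A>0 B>0 e₁ e₂ a≤A d≤B bd ac = begin
      ℚ.∣ a ℚ.* b ℚ.- c ℚ.* d ∣
        ≡⟨ cong ℚ.∣_∣ (lemma a b c d) ⟩
      ℚ.∣ a ℚ.* (b ℚ.- d) ℚ.+ d ℚ.* (a ℚ.- c) ∣
        ≤⟨ ℚ.∣p+q∣≤∣p∣+∣q∣ (a ℚ.* (b ℚ.- d)) (d ℚ.* (a ℚ.- c)) ⟩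
      ℚ.∣ a ℚ.* (b ℚ.- d) ∣ ℚ.+ ℚ.∣ d ℚ.* (a ℚ.- c) ∣
        ≤⟨ ℚ.+-mono-≤ (∣*∣-mono a (b ℚ.- d) A>0 a≤A bd) (∣*∣-mono d (a ℚ.- c) B>0 d≤B ac) ⟩
      A ℚ.* δ₁ ℚ.+ B ℚ.* δ₂
        ≡⟨ cong₂ ℚ._+_ e₁ e₂ ⟩
      ½ ℚ.* ε ℚ.+ ½ ℚ.* ε
        ≡⟨ halves ε ⟩
      ε ∎
      where
      lemma : ∀ a b c d → a ℚ.* b ℚ.- c ℚ.* d ≡ a ℚ.* (b ℚ.- d) ℚ.+ d ℚ.* (a ℚ.- c)
      lemma = solve 4 (λ a b c d → a :* b :- c :* d := a :* (b :- d) :+ d :* (a :- c)) refl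
        where open +-*-Solver

    *-cauchy : ∀ x y → IsCauchy x → IsCauchy y → IsCauchy (λ n → x n ℚ.* y n)
    *-cauchy x y cx cy ε =
      let A , A>0 , M₁ , k₁ = bounded x cx
          B , B>0 , M₂ , k₂ = bounded y cy
          δ₁ , δ₁>0 , e₁    = share ε A A>0
          δ₂ , δ₂>0 , e₂    = share ε B B>0
          N₁ , h₁           = cy δ₁ {{δ₁>0}}
          N₂ , h₂           = cx δ₂ {{δ₂>0}}
          M                 = M₁ ℕ.⊔ M₂
          N                 = N₁ ℕ.⊔ N₂
      in M ℕ.⊔ N , λ m n b c →
      let b₁ = ℕ.m⊔n≤o⇒m≤o M N b ; b₂ = ℕ.m⊔n≤o⇒n≤o M N b
          c₁ = ℕ.m⊔n≤o⇒m≤o M N c ; c₂ = ℕ.m⊔n≤o⇒n≤o M N c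
      in *-near (x m) (y m) (x n) (y n) A>0 B>0 e₁ e₂
           (k₁ m (ℕ.m⊔n≤o⇒m≤o M₁ M₂ b₁))
           (k₂ n (ℕ.m⊔n≤o⇒n≤o M₁ M₂ c₁))
           (h₁ m n (ℕ.m⊔n≤o⇒m≤o N₁ N₂ b₂) (ℕ.m⊔n≤o⇒m≤o N₁ N₂ c₂))
           (h₂ m n (ℕ.m⊔n≤o⇒n≤o N₁ N₂ b₂) (ℕ.m⊔n≤o⇒n≤o N₁ N₂ c₂))

    ∣∣-cauchy : ∀ x → IsCauchy x → IsCauchy (λ n → ℚ.∣ x n ∣)
    ∣∣-cauchy x cx ε with cx ε
    ... | N , h = N , λ m n N≤m N≤n →
      ≤⇒near (half (x m) (x n) (h m n N≤m N≤n)) (half (x n) (x m) (h n m N≤n N≤m))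
      where
      lemma : ∀ p q → p ≡ q ℚ.+ (p ℚ.- q)
      lemma = solve 2 (λ p q → p := q :+ (p :- q)) refl
        where open +-*-Solver
      half : ∀ p q → ℚ.∣ p ℚ.- q ∣ ℚ.≤ ε → ℚ.∣ p ∣ ℚ.≤ ℚ.∣ q ∣ ℚ.+ ε
      half p q d = begin
        ℚ.∣ p ∣                       ≡⟨ cong ℚ.∣_∣ (lemma p q) ⟩
        ℚ.∣ q ℚ.+ (p ℚ.- q) ∣         ≤⟨ ℚ.∣p+q∣≤∣p∣+∣q∣ q (p ℚ.- q) ⟩
        ℚ.∣ q ∣ ℚ.+ ℚ.∣ p ℚ.- q ∣     ≤⟨ ℚ.+-monoʳ-≤ ℚ.∣ q ∣ d ⟩
        ℚ.∣ q ∣ ℚ.+ ε                 ∎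

    ⊓-cauchy : ∀ x y → IsCauchy x → IsCauchy y → IsCauchy (λ n → x n ℚ.⊓ y n)
    ⊓-cauchy x y cx cy ε with cx ε | cy ε
    ... | N₁ , h₁ | N₂ , h₂ = N₁ ℕ.⊔ N₂ , λ m n N≤m N≤n →
      let a₁ = ℕ.m⊔n≤o⇒m≤o N₁ N₂ N≤m ; a₂ = ℕ.m⊔n≤o⇒n≤o N₁ N₂ N≤m
          b₁ = ℕ.m⊔n≤o⇒m≤o N₁ N₂ N≤n ; b₂ = ℕ.m⊔n≤o⇒n≤o N₁ N₂ N≤n
      in ≤⇒near (half (x m) (y m) (x n) (y n) (h₁ m n a₁ b₁) (h₂ m n a₂ b₂))
                (half (x n) (y n) (x m) (y m) (h₁ n m b₁ a₁) (h₂ n m b₂ a₂))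
      where
      half : ∀ a b c d → ℚ.∣ a ℚ.- c ∣ ℚ.≤ ε → ℚ.∣ b ℚ.- d ∣ ℚ.≤ ε →
             a ℚ.⊓ b ℚ.≤ (c ℚ.⊓ d) ℚ.+ ε
      half a b c d ac bd = begin
        a ℚ.⊓ b                   ≤⟨ ℚ.⊓-mono-≤ (near⇒≤ a c ac) (near⇒≤ b d bd) ⟩
        (c ℚ.+ ε) ℚ.⊓ (d ℚ.+ ε)   ≡⟨ sym (ℚ.mono-≤-distrib-⊓ (ℚ.+-monoˡ-≤ ε) c d) ⟩
        (c ℚ.⊓ d) ℚ.+ ε           ∎

fromℚ : ℚ → ℝ
fromℚ q = mkℝ (λ _ → q) (const-cauchy q)

fromℕ : ℕ → ℝ
fromℕ n = fromℚ (+ n ℚ./ 1)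

0ℝ 1ℝ : ℝ
0ℝ = fromℚ 0ℚ
1ℝ = fromℚ 1ℚ

_+_ _-_ _*_ _⊓_ : ℝ → ℝ → ℝ
x + y = mkℝ (λ n → seq x n ℚ.+ seq y n) (+-cauchy (seq x) (seq y) (cauchy x) (cauchy y))
x - y = mkℝ (λ n → seq x n ℚ.- seq y n)
  (+-cauchy (seq x) (λ n → ℚ.- seq y n) (cauchy x) (neg-cauchy (seq y) (cauchy y)))
x * y = mkℝ (λ n → seq x n ℚ.* seq y n) (*-cauchy (seq x) (seq y) (cauchy x) (cauchy y))
x ⊓ y = mkℝ (λ n → seq x n ℚ.⊓ seq y n) (⊓-cauchy (seq x) (seq y) (cauchy x) (cauchy y))

∣_∣ _² : ℝ → ℝ
∣ x ∣ = mkℝ (λ n → ℚ.∣ seq x n ∣) (∣∣-cauchy (seq x) (cauchy x))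
x ² = x * x

∑ : {A : Set} → List A → (A → ℝ) → ℝ
∑ xs f = List.foldr _+_ 0ℝ (List.map f xs)

dist : ℝ → List⁺ ℝ → ℝ
dist x S = List⁺.foldr₁ _⊓_ (List⁺.map (λ y → ∣ x - y ∣) S)

⟦_⟧ : Bool → ℝ
⟦ b ⟧ = if b then 1ℝ else 0ℝ

private variable
  n ℓ : ℕ
  κ : Vec ℕ ℓ

HasProfile : Vec ℕ ℓ → Vec (Fin ℓ) n → Set
HasProfile κ u = ∀ i → Vec.count (Fin._≟ i) u ≡ lookup κ i

hasProfile? : (κ : Vec ℕ ℓ) → Decidable (HasProfile {n = n} κ)
hasProfile? κ u = Fin.all? (λ i → Vec.count (Fin._≟ i) u ℕ.≟ lookup κ i)

-- The proof field is irrelevant, so a point is determined by its word.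
record Multislice (n : ℕ) (κ : Vec ℕ ℓ) : Set where
  constructor point
  field
    word     : Vec (Fin ℓ) n
    .profile : HasProfile κ word

open Multislice public

words : (n ℓ : ℕ) → List (Vec (Fin ℓ) n)
words zero    ℓ = [] ∷ []
words (suc n) ℓ = List.cartesianProductWith _∷_ (List.allFin ℓ) (words n ℓ)

points : (n : ℕ) (κ : Vec ℕ ℓ) → List (Multislice n κ)
points {ℓ} n κ = List.mapMaybe
  (λ u → Maybe.map (λ p → point u p) (dec⇒maybe (hasProfile? κ u))) (words n ℓ)

-- The zero clause is only reached for an empty multislice, which does not
-- occur when the entries of κ sum to n.
reciprocal : ℕ → ℚ
reciprocal zero    = 0ℚ
reciprocal (suc m) = + 1 ℚ./ suc m

𝔼 : (Multislice n κ → ℝ) → ℝ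
𝔼 {n} {κ = κ} f = fromℚ (reciprocal (List.length (points n κ))) * ∑ (points n κ) f

Pr : {P : Pred (Multislice n κ) 0ℓ} → Decidable P → ℝ
Pr P? = 𝔼 (λ u → ⟦ does (P? u) ⟧)

⟨_,_⟩ : (f g : Multislice n κ → ℝ) → ℝ
⟨ f , g ⟩ = 𝔼 (λ u → f u * g u)

-- The square of the norm ‖f‖ = √𝔼[f²].
‖_‖² : (Multislice n κ → ℝ) → ℝ
‖ f ‖² = 𝔼 (λ u → f u ²)

x[_,_] : Fin n → Fin ℓ → {κ : Vec ℕ ℓ} → Multislice n κ → ℝ
x[ j , i ] u = ⟦ does (lookup (word u) j Fin.≟ i) ⟧

IsDegree1 : (Multislice n κ → ℝ) → Set
IsDegree1 {n} {ℓ} f = Σ[ c ∈ ℝ ] Σ[ a ∈ (Fin n → Fin ℓ → ℝ) ] ∀ u →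
  f u ≃ c + ∑ (List.allFin n) λ j → ∑ (List.allFin ℓ) λ i → a j i * x[ j , i ] u

-- P = F^{≤1}: the orthogonal projection of F to the degree 1 functions, given
-- by its defining property, which determines P up to _≃_.
IsDegree1Projection : (F P : Multislice n κ → ℝ) → Set
IsDegree1Projection F P =
  IsDegree1 P × (∀ h → IsDegree1 h → ⟨ (λ u → F u - P u) , h ⟩ ≃ 0ℝ)

DependsOnSingleCoordinate : (Multislice n κ → Bool) → Set
DependsOnSingleCoordinate {n} g =
  Σ[ j ∈ Fin n ] ∀ u v → lookup (word u) j ≡ lookup (word v) j → g u ≡ g v

{-# OPTIONS --safe #-}

-- Write f = c + Σ_j φ_j(u_j) and α_jk = f − f∘(j k), a function of (u_j, u_k) only.
--
-- Moments. h = f − E f is an eigenvector of the transposition walk: Σ_jk α_jk = 2n h.  As all letters are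
-- frequent, α_jk² ≤ R·E[α_jk²] pointwise, so integration by parts over the walk gives hypercontractivity:
-- E h⁴ ≤ 3R (E h²)² and E h⁶ ≤ 15R² (E h²)³.
--
-- Bootstrapping. If t = f − g for a Boolean g depending on one coordinate, then t² ≤ dist(f,{0,1})² + 4t⁴
-- pointwise, hence E t² ≤ ε + O((E t²)²).  So a bound E t² ≤ m₀ with a small constant m₀ already implies
-- E t² ≤ ε + O(ε²).
--
-- Finding g. The mixed second difference of f² − f along disjoint transpositions is 2αα′, hence
-- E[α²α′²] = 2E[(f² − f)αα′].  Summed over all disjoint pairs the right side is at most a small multiple of n²,
-- since f² − f is small when f is nearly Boolean.  The weights e_jk = E[α_jk²] therefore concentrate on a star,
-- with centre j₀ say, and averaging over the transpositions that fix j₀ shows that f is close to a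
-- function of u_j₀, which is rounded to g.
--
-- Reals. The operations on ℝ are pointwise on sequences, so all of this takes place over ℚ.

module Submission where

open import Data.Bool.Base using (true; false; if_then_else_)
open import Data.Fin.Base using (zero; suc; fromℕ<)
open import Data.Fin.Permutation.Components using (transpose)
import Data.Fin.Properties as Fin
import Data.Integer.Base as ℤ
open import Data.Integer.Base using () renaming (+_ to pos)
import Data.Integer.Properties as ℤ
import Data.List.Base as List
import Data.List.Properties as List
open import Data.List.Base using (List)
open import Data.List.Membership.Propositional using (_∈_)
open import Data.List.Membership.Propositional.Properties using (∈-allFin; ∈-map⁺; ∈-map⁻; ∈-filter⁺; ∈-cartesianProductWith⁺)
open import Data.List.Membership.Propositional.Properties.WithK using (unique∧set⇒bag)
open import Data.List.Relation.Binary.BagAndSetEquality using (∼bag⇒↭)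
open import Data.List.Relation.Binary.Permutation.Propositional as Perm using (_↭_)
import Data.List.Relation.Unary.All as All
import Data.List.Relation.Unary.AllPairs as AllPairs
open import Data.List.Relation.Unary.Any using (here; there)
open import Data.List.Relation.Unary.Unique.Propositional using (Unique)
import Data.List.Relation.Unary.Unique.Propositional.Properties as Unique
import Data.Maybe.Base as Maybe
open import Data.Nat.Base using (zero; suc; z≤n; s≤s)
import Data.Nat.Properties as ℕ
open import Data.Product using (_,_; proj₁; proj₂; ∃-syntax)
import Data.Rational.Base as ℚ
open import Data.Rational.Base using (ℚ; 0ℚ; 1ℚ; ½; Positive; NonZero; nonNegative; positive)
import Data.Rational.Properties as ℚ
open import Data.Rational.Solver using (module +-*-Solver)
import Data.Rational.Unnormalised.Base as ℚᵘ
import Data.Rational.Unnormalised.Properties as ℚᵘ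
open import Data.Sum.Base using (_⊎_; inj₁; inj₂)
open import Data.Vec.Base as Vec using (tabulate; []; _∷_)
import Data.Vec.Properties as Vec
open import Function.Base using (_∘_; id)
open import Function.Bundles using (mk⇔)
open import Relation.Binary.PropositionalEquality hiding (_≡_)
open import Relation.Nullary.Decidable using (Dec; does; yes; no; recompute; dec⇒maybe)
open import Relation.Nullary.Negation using (contradiction)

open import Data.Bool using (Bool; _≟_)
open import Data.Fin using (Fin)
open import Data.List.NonEmpty using (_∷_)
open import Data.List using ([]; _∷_)
open import Data.Nat as ℕ using (ℕ)
open import Data.Product using (_×_; Σ-syntax)
open import Data.Vec using (Vec; lookup; sum)
open import Relation.Binary.PropositionalEquality using (_≡_)
open import Relation.Nullary.Decidable using (¬?)

open +-*-Solver using (solve; _:=_; _:+_; _:*_; _:-_; :-_; con)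

-- Choosing `g` means deciding which star is light and which way to round, and the order on ℝ cannot
-- be decided. Both decisions are therefore made for one rational approximation of f, and the choice
-- must be shown to stay valid for every later approximation. The question whether ε is small is
-- settled in the same way. For large ε the constant 0 is good enough: its error is at most 2ε + 2,
-- which K ε² absorbs.
--
-- The coefficient 1 of ε cannot come from rounding, which loses constant factors; rounding only
-- supplies the smallness from which the bootstrap starts.
--
-- The dependence between the coordinates of a slice is handled by one device: a given position
-- carries a given letter with weight at least r, whatever a few other coordinates do. This yields
-- the pointwise bound on α² and also the near independence of disjoint transpositions, E[α²α′²] ≥
-- r² E[α²] E[α′²], without which the energy would say nothing about products of the weights e.
--
-- Square roots are avoided throughout: Cauchy-Schwarz is replaced by the inequality 2xy ≤ λ₁x² +
-- λ₂y² with λ₁λ₂ = 1.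

module Rational where

  open import Data.Rational.Base using (_+_; _*_; _-_; -_; _≤_; _<_; _/_; 1/_; _⊓_; ∣_∣)
  open import Defs using (HasProfile; hasProfile?; Multislice; point; word; words; points; reciprocal)

  -- Order and arithmetic in ℚ

  infix 9 #_
  #_ : ℕ → ℚ
  # n = pos n / 1

  infixl 6 _⊕_
  infixl 7 _⊗_ _⊗⁺_

  _⊕_ : ∀ {x y} → 0ℚ ≤ x → 0ℚ ≤ y → 0ℚ ≤ x + y
  _⊕_ = ℚ.+-mono-≤

  _⊗_ : ∀ {x y} → 0ℚ ≤ x → 0ℚ ≤ y → 0ℚ ≤ x * y
  _⊗_ {x} {y} p q = subst (_≤ x * y) (ℚ.*-zeroʳ x) (ℚ.*-monoˡ-≤-nonNeg x {{nonNegative p}} q)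

  _⊗⁺_ : ∀ {x y} → 0ℚ < x → 0ℚ < y → 0ℚ < x * y
  _⊗⁺_ {x} {y} p q = ℚ.positive⁻¹ (x * y) {{ℚ.pos*pos⇒pos x {{positive p}} y {{positive q}}}}

  sq : ∀ x → 0ℚ ≤ x * x
  sq x with ℚ.≤-total 0ℚ x
  ... | inj₁ p = p ⊗ p
  ... | inj₂ p = subst (0ℚ ≤_) (lemma x) (ℚ.neg-antimono-≤ p ⊗ ℚ.neg-antimono-≤ p)
    where
    lemma = solve 1 (λ x → (:- x) :* (:- x) := x :* x) refl

  gap : ∀ {x y} → x ≤ y → 0ℚ ≤ y - x
  gap {x} {y} p = subst (_≤ y - x) (ℚ.+-inverseʳ x) (ℚ.+-monoˡ-≤ (- x) p)

  -- Inequalities are proved by certificates: `y - x` is rewritten as an expression that `_⊕_`,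
  -- `_⊗_`, `sq` and `gap` show to be nonnegative, and the ring solver checks the identity.
  by : ∀ {x y z} → 0ℚ ≤ z → y - x ≡ z → x ≤ y
  by {x} {y} {z} p e = subst₂ _≤_ (ℚ.+-identityʳ x) (trans (cong (λ z → x + z) (sym e)) (lemma x y)) (ℚ.+-monoʳ-≤ x p)
    where
    lemma = solve 2 (λ x y → x :+ (y :- x) := y) refl

  cancel : ∀ {x y z} → 0ℚ < z → z * x ≤ z * y → x ≤ y
  cancel {z = z} p = ℚ.*-cancelˡ-≤-pos z {{positive p}}

  scale : ∀ {x y z} → 0ℚ ≤ z → x ≤ y → z * x ≤ z * y
  scale {z = z} p = ℚ.*-monoˡ-≤-nonNeg z {{nonNegative p}}

  ⊓-pos : ∀ {x y} → 0ℚ < x → 0ℚ < y → 0ℚ < x ⊓ y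
  ⊓-pos {x} {y} p q with ℚ.⊓-sel x y
  ... | inj₁ e = subst (0ℚ <_) (sym e) p
  ... | inj₂ e = subst (0ℚ <_) (sym e) q

  inverse : ∀ {x} → 0ℚ < x → Σ[ y ∈ ℚ ] 0ℚ < y × x * y ≡ 1ℚ
  inverse {x} p = 1/ x , ℚ.positive⁻¹ (1/ x) {{ℚ.1/pos⇒pos x}} , ℚ.*-inverseʳ x
    where
    instance
      x-pos : Positive x
      x-pos = positive p
      x-nonZero : NonZero x
      x-nonZero = ℚ.pos⇒nonZero x

  #-nonneg : ∀ n → 0ℚ ≤ # n
  #-nonneg n = ℚ.nonNegative⁻¹ (# n) {{ℚ.normalize-nonNeg n 1}}

  #-pos : ∀ n → 0ℚ < # (suc n)
  #-pos n = ℚ.positive⁻¹ (# (suc n)) {{ℚ.normalize-pos (suc n) 1}}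

  #-+ : ∀ m n → # (m ℕ.+ n) ≡ # m + # n
  #-+ m n = ℚ.toℚᵘ-injective (ℚᵘ.≃-trans (ℚ.toℚᵘ-fromℚᵘ (ℚᵘ.mkℚᵘ (pos (m ℕ.+ n)) 0)) (ℚᵘ.≃-trans
    (ℚᵘ.*≡* (cong (ℤ._* pos 1) (trans (ℤ.pos-+ m n) (sym (cong₂ ℤ._+_ (ℤ.*-identityʳ (pos m)) (ℤ.*-identityʳ (pos n)))))))
    (ℚᵘ.≃-sym (ℚᵘ.≃-trans (ℚ.toℚᵘ-homo-+ (# m) (# n))
       (ℚᵘ.+-cong (ℚ.toℚᵘ-fromℚᵘ (ℚᵘ.mkℚᵘ (pos m) 0)) (ℚ.toℚᵘ-fromℚᵘ (ℚᵘ.mkℚᵘ (pos n) 0)))))))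

  #-mono : ∀ {m n} → m ℕ.≤ n → # m ≤ # n
  #-mono {m} {n} m≤n = by (#-nonneg (n ℕ.∸ m))
    (trans (cong (_- # m) (trans (cong #_ (sym (ℕ.m+[n∸m]≡n m≤n))) (#-+ m (n ℕ.∸ m)))) (lemma (# m) (# (n ℕ.∸ m))))
    where
    lemma = solve 2 (λ a b → (a :+ b) :- a := b) refl

  ²-mono : ∀ {x y} → x ≤ y → - y ≤ x → x * x ≤ y * y
  ²-mono {x} {y} p q = by (gap p ⊗ gap q) (lemma x y)
    where
    lemma = solve 2 (λ x y → y :* y :- x :* x := (y :- x) :* (x :- (:- y))) refl

  bit : Bool → ℚ
  bit b = if b then 1ℚ else 0ℚ

  0≤bit : ∀ b → 0ℚ ≤ bit b
  0≤bit true  = #-nonneg 1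
  0≤bit false = #-nonneg 0

  bit≤1 : ∀ b → bit b ≤ 1ℚ
  bit≤1 true  = ℚ.≤-refl
  bit≤1 false = #-nonneg 1

  -- Positive linear functionals and finite sums

  record PositiveLinear {A : Set} (L : (A → ℚ) → ℚ) : Set where
    field
      mono : ∀ {f g} → (∀ x → f x ≤ g x) → L f ≤ L g
      +-hom : ∀ f g → L (λ x → f x + g x) ≡ L f + L g
      *-hom : ∀ c f → L (λ x → c * f x) ≡ c * L f

    -- Monotonicity in both directions takes the place of function extensionality.
    congr : ∀ {f g} → (∀ x → f x ≡ g x) → L f ≡ L g
    congr e = ℚ.≤-antisym (mono (λ x → ℚ.≤-reflexive (e x))) (mono (λ x → ℚ.≤-reflexive (sym (e x))))

    *-homʳ : ∀ c f → L (λ x → f x * c) ≡ L f * c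
    *-homʳ c f = trans (congr (λ x → ℚ.*-comm (f x) c)) (trans (*-hom c f) (ℚ.*-comm c (L f)))

    0-hom : L (λ _ → 0ℚ) ≡ 0ℚ
    0-hom = trans (*-hom 0ℚ (λ _ → 0ℚ)) (ℚ.*-zeroˡ (L (λ _ → 0ℚ)))

    minus : ∀ f g → L (λ x → f x - g x) ≡ L f - L g
    minus f g = begin
      L (λ x → f x - g x)                ≡⟨ congr (λ x → lemma (f x) (g x)) ⟩
      L (λ x → f x + (- 1ℚ) * g x)       ≡⟨ +-hom f (λ x → (- 1ℚ) * g x) ⟩
      L f + L (λ x → (- 1ℚ) * g x)       ≡⟨ cong (λ z → L f + z) (*-hom (- 1ℚ) g) ⟩
      L f + (- 1ℚ) * L g                 ≡⟨ lemma (L f) (L g) ⟨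
      L f - L g                          ∎
      where
      open ≡-Reasoning
      lemma = solve 2 (λ x y → x :- y := x :+ (:- con 1ℚ) :* y) refl

    nonneg : ∀ {f} → (∀ x → 0ℚ ≤ f x) → 0ℚ ≤ L f
    nonneg {f} p = subst (_≤ L f) 0-hom (mono p)

    combine : ∀ a b f g → L (λ x → a * f x + b * g x) ≡ a * L f + b * L g
    combine a b f g = trans (+-hom (λ x → a * f x) (λ x → b * g x)) (cong₂ _+_ (*-hom a f) (*-hom b g))

  abstract
    sumOver : ∀ {A : Set} → List A → (A → ℚ) → ℚ
    sumOver []       f = 0ℚ
    sumOver (x ∷ xs) f = f x + sumOver xs f

    sum-[] : ∀ {A : Set} (f : A → ℚ) → sumOver [] f ≡ 0ℚ
    sum-[] f = refl

    sum-∷ : ∀ {A : Set} x xs (f : A → ℚ) → sumOver (x ∷ xs) f ≡ f x + sumOver xs f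
    sum-∷ x xs f = refl

    sum-positiveLinear : ∀ {A : Set} (xs : List A) → PositiveLinear (sumOver xs)
    sum-positiveLinear {A} xs = record { mono = mono xs ; +-hom = +-hom xs ; *-hom = *-hom xs }
      where
      mono : ∀ (xs : List A) {f g} → (∀ x → f x ≤ g x) → sumOver xs f ≤ sumOver xs g
      mono []       p = ℚ.≤-refl
      mono (x ∷ xs) p = ℚ.+-mono-≤ (p x) (mono xs p)
      +-hom : ∀ (xs : List A) f g → sumOver xs (λ x → f x + g x) ≡ sumOver xs f + sumOver xs g
      +-hom []       f g = refl
      +-hom (x ∷ xs) f g = trans (cong (λ s → f x + g x + s) (+-hom xs f g)) (lemma (f x) (g x) (sumOver xs f) (sumOver xs g))
        where
        lemma : ∀ a b c d → (a + b) + (c + d) ≡ (a + c) + (b + d)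
        lemma = solve 4 (λ a b c d → (a :+ b) :+ (c :+ d) := (a :+ c) :+ (b :+ d)) refl
      *-hom : ∀ (xs : List A) c f → sumOver xs (λ x → c * f x) ≡ c * sumOver xs f
      *-hom []       c f = sym (ℚ.*-zeroʳ c)
      *-hom (x ∷ xs) c f = trans (cong (λ s → c * f x + s) (*-hom xs c f)) (sym (ℚ.*-distribˡ-+ c (f x) (sumOver xs f)))

    sum-↭ : ∀ {A : Set} {xs ys : List A} → xs ↭ ys → ∀ f → sumOver xs f ≡ sumOver ys f
    sum-↭ Perm.refl             f = refl
    sum-↭ (Perm.prep x p)       f = cong (λ s → f x + s) (sum-↭ p f)
    sum-↭ (Perm.swap {ys = ys} x y p) f =
      trans (cong (λ s → f x + (f y + s)) (sum-↭ p f)) (lemma (f x) (f y) (sumOver ys f))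
      where
      lemma : ∀ a b c → a + (b + c) ≡ b + (a + c)
      lemma = solve 3 (λ a b c → a :+ (b :+ c) := b :+ (a :+ c)) refl
    sum-↭ (Perm.trans p q)      f = trans (sum-↭ p f) (sum-↭ q f)

    sum-map : ∀ {A B : Set} (h : A → B) xs f → sumOver (List.map h xs) f ≡ sumOver xs (f ∘ h)
    sum-map h []       f = refl
    sum-map h (x ∷ xs) f = cong (λ s → f (h x) + s) (sum-map h xs f)

    sum-const : ∀ {A : Set} (xs : List A) c → sumOver xs (λ _ → c) ≡ # List.length xs * c
    sum-const []       c = sym (ℚ.*-zeroˡ c)
    sum-const (x ∷ xs) c = trans (cong (λ s → c + s) (sum-const xs c))
      (trans (lemma c (# List.length xs)) (cong (λ s → s * c) (sym (#-+ 1 (List.length xs)))))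
      where
      lemma : ∀ c k → c + k * c ≡ (# 1 + k) * c
      lemma = solve 2 (λ c k → c :+ k :* c := (con (# 1) :+ k) :* c) refl

    -- Both a finite sum and a mean can play `L`, so this one exchange serves double sums and means
    -- of sums alike.
    functional-sum : ∀ {A B : Set} {L : (B → ℚ) → ℚ} → PositiveLinear L → ∀ xs (F : A → B → ℚ) →
                     L (λ b → sumOver xs (λ x → F x b)) ≡ sumOver xs (λ x → L (F x))
    functional-sum         lin []       F = PositiveLinear.0-hom lin
    functional-sum {L = L} lin (x ∷ xs) F =
      trans (PositiveLinear.+-hom lin (F x) (λ b → sumOver xs (λ x → F x b))) (cong (λ s → L (F x) + s) (functional-sum lin xs F))

    ∑ : ∀ {n} → (Fin n → ℚ) → ℚ
    ∑ {n} f = sumOver (List.allFin n) f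

    ∑-allFin : ∀ n (f : Fin n → ℚ) → ∑ f ≡ sumOver (List.allFin n) f
    ∑-allFin n f = refl

    ∑-positiveLinear : ∀ n → PositiveLinear (∑ {n})
    ∑-positiveLinear n = sum-positiveLinear (List.allFin n)

    ∑-suc : ∀ {n} (f : Fin (suc n) → ℚ) → ∑ f ≡ f zero + ∑ (λ i → f (suc i))
    ∑-suc {n} f = cong (λ s → f zero + s)
      (trans (cong (λ xs → sumOver xs f) (sym (List.map-tabulate id suc))) (sum-map suc (List.allFin n) f))

    ∑-const : ∀ {n} c → ∑ {n} (λ _ → c) ≡ # n * c
    ∑-const {n} c = trans (sum-const (List.allFin n) c) (cong (λ k → # k * c) (List.length-tabulate {n = n} id))

    functional-∑ : ∀ {B : Set} {n} {L : (B → ℚ) → ℚ} → PositiveLinear L → ∀ (F : Fin n → B → ℚ) →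
                   L (λ b → ∑ (λ i → F i b)) ≡ ∑ (λ i → L (F i))
    functional-∑ {n = n} lin F = functional-sum lin (List.allFin n) F

  module ∑ {n} = PositiveLinear (∑-positiveLinear n)

  ∑-comm : ∀ {m n} (F : Fin m → Fin n → ℚ) → ∑ (λ i → ∑ (F i)) ≡ ∑ (λ j → ∑ (λ i → F i j))
  ∑-comm {m} {n} F = functional-∑ (∑-positiveLinear m) (λ j i → F i j)

  -- The Kronecker delta

  abstract
    δ : ∀ {n} → Fin n → Fin n → ℚ
    δ i j = bit (does (i Fin.≟ j))

    δ-does : ∀ {n} (i j : Fin n) → δ i j ≡ bit (does (i Fin.≟ j))
    δ-does i j = refl

    0≤δ : ∀ {n} (i j : Fin n) → 0ℚ ≤ δ i j
    0≤δ i j = 0≤bit (does (i Fin.≟ j))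

    δ≤1 : ∀ {n} (i j : Fin n) → δ i j ≤ 1ℚ
    δ≤1 i j = bit≤1 (does (i Fin.≟ j))

    δ-refl : ∀ {n} (i : Fin n) → δ i i ≡ 1ℚ
    δ-refl i with i Fin.≟ i
    ... | yes _   = refl
    ... | no  i≢i = contradiction refl i≢i

    δ-≢ : ∀ {n} {i j : Fin n} → i ≢ j → δ i j ≡ 0ℚ
    δ-≢ {i = i} {j} i≢j with i Fin.≟ j
    ... | yes i≡j = contradiction i≡j i≢j
    ... | no  _   = refl

    δ-suc : ∀ {n} (i j : Fin n) → δ (suc i) (suc j) ≡ δ i j
    δ-suc i j = refl

  δ-sym : ∀ {n} (i j : Fin n) → δ i j ≡ δ j i
  δ-sym i j with i Fin.≟ j
  ... | yes refl = refl
  ... | no  i≢j  = trans (δ-≢ i≢j) (sym (δ-≢ (i≢j ∘ sym)))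

  ∑-δ : ∀ {n} (k : Fin n) f → ∑ (λ i → δ i k * f i) ≡ f k
  ∑-δ {suc n} zero f = trans (∑-suc (λ i → δ i zero * f i)) (trans
    (cong₂ _+_ (trans (cong (λ d → d * f zero) (δ-refl {suc n} zero)) (ℚ.*-identityˡ (f zero)))
      (trans (∑.congr {n} (λ i → trans (cong (λ d → d * f (suc i)) (δ-≢ (λ ()))) (ℚ.*-zeroˡ (f (suc i))))) (∑.0-hom {n})))
    (ℚ.+-identityʳ (f zero)))
  ∑-δ {suc n} (suc k) f = trans (∑-suc (λ i → δ i (suc k) * f i)) (trans
    (cong₂ _+_ (trans (cong (λ d → d * f zero) (δ-≢ (λ ()))) (ℚ.*-zeroˡ (f zero)))
      (trans (∑.congr (λ i → cong (λ d → d * f (suc i)) (δ-suc i k))) (∑-δ k (λ i → f (suc i)))))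
    (ℚ.+-identityˡ (f (suc k))))

  ∑-δˡ : ∀ {n} (k : Fin n) f → ∑ (λ i → δ k i * f i) ≡ f k
  ∑-δˡ k f = trans (∑.congr (λ i → cong (λ d → d * f i) (δ-sym k i))) (∑-δ k f)

  -- Spaces with exchangeable coordinates

  Pair : ℕ → Set
  Pair n = Fin n × Fin n

  ∑₂ : ∀ {n} → (Pair n → ℚ) → ℚ
  ∑₂ F = ∑ (λ j → ∑ (λ k → F (j , k)))

  ∑₂-positiveLinear : ∀ n → PositiveLinear (∑₂ {n})
  ∑₂-positiveLinear n = record
    { mono  = λ p → ∑.mono (λ j → ∑.mono (λ k → p (j , k)))
    ; +-hom = λ F G → trans (∑.congr (λ j → ∑.+-hom (λ k → F (j , k)) (λ k → G (j , k))))
                            (∑.+-hom (λ j → ∑ (λ k → F (j , k))) (λ j → ∑ (λ k → G (j , k))))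
    ; *-hom = λ c F → trans (∑.congr (λ j → ∑.*-hom c (λ k → F (j , k))))
                            (∑.*-hom c (λ j → ∑ (λ k → F (j , k))))
    }

  module ∑₂ {n} = PositiveLinear (∑₂-positiveLinear n)

  functional-∑₂ : ∀ {B : Set} {n} {L : (B → ℚ) → ℚ} → PositiveLinear L → ∀ (F : Pair n → B → ℚ) →
                  L (λ b → ∑₂ (λ p → F p b)) ≡ ∑₂ (λ p → L (F p))
  functional-∑₂ lin F = trans (functional-∑ lin (λ j b → ∑ (λ k → F (j , k) b)))
    (∑.congr (λ j → functional-∑ lin (λ k → F (j , k))))

  -- What the analysis needs from the slice: invariance under transpositions and letter counts that
  -- are the same at every point. `slice` is the instance.
  record Space (n ℓ : ℕ) : Set₁ where
    field
      U         : Set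
      at        : U → Fin n → Fin ℓ
      swap      : Fin n → Fin n → U → U
      at-swapˡ  : ∀ j k u → at (swap j k u) j ≡ at u k
      at-swapʳ  : ∀ j k u → at (swap j k u) k ≡ at u j
      at-swap-≢ : ∀ j k u {m} → m ≢ j → m ≢ k → at (swap j k u) m ≡ at u m
      E         : (U → ℚ) → ℚ
      E-lin     : PositiveLinear E
      E-1       : E (λ _ → 1ℚ) ≡ 1ℚ
      E-swap    : ∀ j k X → E (λ u → X (swap j k u)) ≡ E X
      κ         : Fin ℓ → ℚ
      count     : ∀ u a → ∑ (λ m → δ (at u m) a) ≡ κ a

  module Analysis {n ℓ : ℕ} (S : Space n ℓ) where

    open Space S public
    module E = PositiveLinear E-lin

    E-const : ∀ c → E (λ _ → c) ≡ c
    E-const c = trans (E.congr (λ _ → sym (ℚ.*-identityʳ c)))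
      (trans (E.*-hom c (λ _ → 1ℚ)) (trans (cong (λ z → c * z) E-1) (ℚ.*-identityʳ c)))

    E-bound : ∀ {X} a b Y Z → (∀ u → X u ≤ a * Y u + b * Z u) → E X ≤ a * E Y + b * E Z
    E-bound a b Y Z p = ℚ.≤-trans (E.mono p) (ℚ.≤-reflexive (E.combine a b Y Z))

    E-bound-const : ∀ {X} a Y c → (∀ u → X u ≤ a * Y u + c) → E X ≤ a * E Y + c
    E-bound-const a Y c p = ℚ.≤-trans (E.mono p) (ℚ.≤-reflexive
      (trans (E.+-hom (λ u → a * Y u) (λ _ → c)) (cong₂ _+_ (E.*-hom a Y) (E-const c))))

    module Degree1 (c : ℚ) (φ : Fin n → Fin ℓ → ℚ) where

      f : U → ℚ
      f u = c + ∑ (λ j → φ j (at u j))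

      -- The loss of `f` when the letters `a` at `j` and `b` at `k` change places. It is kept as a
      -- function of two letters so that `fix` can freeze them one at a time.
      q : Pair n → Fin ℓ → Fin ℓ → ℚ
      q (j , k) a b = φ j a - φ j b + (φ k b - φ k a)

      α : Pair n → U → ℚ
      α p u = q p (at u (proj₁ p)) (at u (proj₂ p))

      σ : Pair n → U → U
      σ (j , k) = swap j k

      f-swap : ∀ p u → f (σ p u) ≡ f u - α p u
      f-swap (j , k) u with j Fin.≟ k
      ... | yes refl = trans (cong (λ z → c + z) (∑.congr fixed)) (lemma (f u) (φ j (at u j)))
        where
        fixed : ∀ m → φ m (at (swap j j u) m) ≡ φ m (at u m)
        fixed m with m Fin.≟ j
        ... | yes refl = cong (φ m) (at-swapˡ m m u)
        ... | no  m≢j  = cong (φ m) (at-swap-≢ j j u m≢j m≢j)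
        lemma = solve 2 (λ x y → x := x :- (y :- y :+ (y :- y))) refl
      ... | no  j≢k  = begin
        c + ∑ Y                    ≡⟨ lemma₀ c (∑ Y) (∑ X) ⟩
        (c + ∑ X) - (∑ X - ∑ Y)    ≡⟨ cong (λ z → (c + ∑ X) - z) difference ⟩
        f u - α (j , k) u          ∎
        where
        open ≡-Reasoning
        X Y : Fin n → ℚ
        X m = φ m (at u m)
        Y m = φ m (at (swap j k u) m)
        lemma₀ = solve 3 (λ c y x → c :+ y := (c :+ x) :- (x :- y)) refl
        pick : ∀ {x y d d′} → d ≡ x → d′ ≡ y → ∀ z → x * z + y * z ≡ z → z ≡ d * z + d′ * z
        pick refl refl z e = sym e
        lemma₁ = solve 1 (λ z → con 1ℚ :* z :+ con 0ℚ :* z := z) refl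
        lemma₂ = solve 1 (λ z → con 0ℚ :* z :+ con 1ℚ :* z := z) refl
        lemma₃ = solve 1 (λ x → con 0ℚ :* (x :- x) :+ con 0ℚ :* (x :- x) := x :- x) refl
        -- The two sums differ only at `j` and `k`, so the weight `δ m j + δ m k` changes nothing,
        -- and `∑-δ` then extracts the two terms.
        local : ∀ m → X m - Y m ≡ δ m j * (X m - Y m) + δ m k * (X m - Y m)
        local m with m Fin.≟ j | m Fin.≟ k
        ... | yes refl | yes refl = contradiction refl j≢k
        ... | yes refl | no m≢k   = pick (δ-refl m) (δ-≢ m≢k) (X m - Y m) (lemma₁ (X m - Y m))
        ... | no m≢j   | yes refl = pick (δ-≢ m≢j) (δ-refl m) (X m - Y m) (lemma₂ (X m - Y m))
        ... | no m≢j   | no m≢k   = pick (δ-≢ m≢j) (δ-≢ m≢k) (X m - Y m)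
          (subst (λ z → 0ℚ * (X m - z) + 0ℚ * (X m - z) ≡ X m - z)
            (sym (cong (φ m) (at-swap-≢ j k u m≢j m≢k))) (lemma₃ (X m)))
        difference : ∑ X - ∑ Y ≡ α (j , k) u
        difference = begin
          ∑ X - ∑ Y
            ≡⟨ ∑.minus X Y ⟨
          ∑ (λ m → X m - Y m)
            ≡⟨ ∑.congr local ⟩
          ∑ (λ m → δ m j * (X m - Y m) + δ m k * (X m - Y m))
            ≡⟨ ∑.+-hom (λ m → δ m j * (X m - Y m)) (λ m → δ m k * (X m - Y m)) ⟩
          ∑ (λ m → δ m j * (X m - Y m)) + ∑ (λ m → δ m k * (X m - Y m))
            ≡⟨ cong₂ _+_ (∑-δ j (λ m → X m - Y m)) (∑-δ k (λ m → X m - Y m)) ⟩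
          (X j - Y j) + (X k - Y k)
            ≡⟨ cong₂ _+_ (cong (λ z → X j - φ j z) (at-swapˡ j k u)) (cong (λ z → X k - φ k z) (at-swapʳ j k u)) ⟩
          α (j , k) u ∎

      α-swap : ∀ p u → α p (σ p u) ≡ - α p u
      α-swap p@(j , k) u = trans (cong₂ (q p) (at-swapˡ j k u) (at-swapʳ j k u))
        (lemma (φ j (at u j)) (φ j (at u k)) (φ k (at u j)) (φ k (at u k)))
        where
        lemma = solve 4 (λ a b c d → b :- a :+ (c :- d) :=  :- (a :- b :+ (d :- c))) refl

      -- Integration by parts: α p is antisymmetric under σ p, which preserves E.
      by-parts : ∀ p (H : U → ℚ) → (∀ u → H (σ p u) ≡ H u - α p u) → ∀ w →
                 E (λ u → α p u * w (H u)) + E (λ u → α p u * w (H u))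
                   ≡ E (λ u → α p u * (w (H u) - w (H u - α p u)))
      by-parts p@(j , k) H H-swap w = begin
        E (λ u → α p u * w (H u)) + E (λ u → α p u * w (H u))
          ≡⟨ cong (λ z → E (λ u → α p u * w (H u)) + z) (E-swap j k (λ u → α p u * w (H u))) ⟨
        E (λ u → α p u * w (H u)) + E (λ u → α p (σ p u) * w (H (σ p u)))
          ≡⟨ E.+-hom (λ u → α p u * w (H u)) (λ u → α p (σ p u) * w (H (σ p u))) ⟨
        E (λ u → α p u * w (H u) + α p (σ p u) * w (H (σ p u)))
          ≡⟨ E.congr (λ u → cong (λ z → α p u * w (H u) + z) (cong₂ _*_ (α-swap p u) (cong w (H-swap u)))) ⟩
        E (λ u → α p u * w (H u) + (- α p u) * w (H u - α p u))
          ≡⟨ E.congr (λ u → lemma (α p u) (w (H u)) (w (H u - α p u))) ⟩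
        E (λ u → α p u * (w (H u) - w (H u - α p u))) ∎
        where
        open ≡-Reasoning
        lemma = solve 3 (λ a x y → a :* x :+ (:- a) :* y := a :* (x :- y)) refl

      -- The weights serve two walks: constant weight 1 gives the full transposition walk in `∑α`,
      -- and the indicator of the positions other than `j₀` gives the walk that fixes `j₀` in
      -- `f-split`.
      ∑₂-α : ∀ (ω : Fin n → ℚ) u →
             ∑₂ (λ (j , k) → ω j * ω k * α (j , k) u)
               ≡ # 2 * (∑ ω * ∑ (λ j → ω j * φ j (at u j)) - ∑ (λ j → ω j * ∑ (λ k → ω k * φ j (at u k))))
      ∑₂-α ω u = begin
        ∑₂ (λ (j , k) → ω j * ω k * α (j , k) u)
          ≡⟨ ∑₂.congr (λ (j , k) → lemma₁ (ω j) (ω k) (φ j (at u j)) (φ j (at u k)) (φ k (at u k)) (φ k (at u j))) ⟩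
        ∑₂ (λ (j , k) → β j k + β k j)
          ≡⟨ ∑₂.+-hom (λ (j , k) → β j k) (λ (j , k) → β k j) ⟩
        ∑₂ (λ (j , k) → β j k) + ∑₂ (λ (j , k) → β k j)
          ≡⟨ cong (λ z → ∑₂ (λ (j , k) → β j k) + z) (∑-comm (λ j k → β k j)) ⟩
        ∑₂ (λ (j , k) → β j k) + ∑₂ (λ (j , k) → β j k)
          ≡⟨ lemma₂ (∑₂ (λ (j , k) → β j k)) ⟩
        # 2 * ∑₂ (λ (j , k) → β j k)
          ≡⟨ cong (λ z → # 2 * z) (begin
        ∑ (λ j → ∑ (λ k → β j k))
          ≡⟨ ∑.congr row ⟩
        ∑ (λ j → ∑ ω * (ω j * φ j (at u j)) - ω j * ∑ (λ k → ω k * φ j (at u k)))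
          ≡⟨ ∑.minus (λ j → ∑ ω * (ω j * φ j (at u j))) (λ j → ω j * ∑ (λ k → ω k * φ j (at u k))) ⟩
        ∑ (λ j → ∑ ω * (ω j * φ j (at u j))) - ∑ (λ j → ω j * ∑ (λ k → ω k * φ j (at u k)))
          ≡⟨ cong (λ z → z - ∑ (λ j → ω j * ∑ (λ k → ω k * φ j (at u k)))) (∑.*-hom (∑ ω) (λ j → ω j * φ j (at u j))) ⟩
        ∑ ω * ∑ (λ j → ω j * φ j (at u j)) - ∑ (λ j → ω j * ∑ (λ k → ω k * φ j (at u k))) ∎) ⟩
        # 2 * (∑ ω * ∑ (λ j → ω j * φ j (at u j)) - ∑ (λ j → ω j * ∑ (λ k → ω k * φ j (at u k)))) ∎
        where
        open ≡-Reasoning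
        β : Fin n → Fin n → ℚ
        β j k = (ω j * φ j (at u j)) * ω k - ω j * (ω k * φ j (at u k))
        lemma₁ = solve 6 (λ x y a b c d → x :* y :* (a :- b :+ (c :- d)) := ((x :* a) :* y :- x :* (y :* b)) :+
            ((y :* c) :* x :- y :* (x :* d))) refl
        lemma₂ = solve 1 (λ x → x :+ x := con (# 2) :* x) refl
        row : ∀ j → ∑ (β j) ≡ ∑ ω * (ω j * φ j (at u j)) - ω j * ∑ (λ k → ω k * φ j (at u k))
        row j = trans (∑.minus (λ k → (ω j * φ j (at u j)) * ω k) (λ k → ω j * (ω k * φ j (at u k))))
          (cong₂ _-_ (trans (∑.*-hom (ω j * φ j (at u j)) ω) (ℚ.*-comm (ω j * φ j (at u j)) (∑ ω)))
                     (∑.*-hom (ω j) (λ k → ω k * φ j (at u k))))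

      -- Every point has the same letter counts, so summing one function over all positions loses
      -- the dependence on `u`. This is what makes the centred function an eigenvector.
      ∑-at : ∀ (θ : Fin ℓ → ℚ) u → ∑ (λ k → θ (at u k)) ≡ ∑ (λ a → κ a * θ a)
      ∑-at θ u = begin
        ∑ (λ k → θ (at u k))                         ≡⟨ ∑.congr (λ k → ∑-δˡ (at u k) θ) ⟨
        ∑ (λ k → ∑ (λ a → δ (at u k) a * θ a))       ≡⟨ ∑-comm (λ k a → δ (at u k) a * θ a) ⟩
        ∑ (λ a → ∑ (λ k → δ (at u k) a * θ a))       ≡⟨ ∑.congr (λ a → ∑.*-homʳ (θ a) (λ k → δ (at u k) a)) ⟩
        ∑ (λ a → ∑ (λ k → δ (at u k) a) * θ a)       ≡⟨ ∑.congr (λ a → cong (λ z → z * θ a) (count u a)) ⟩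
        ∑ (λ a → κ a * θ a)                          ∎
        where open ≡-Reasoning

  -- Moments of degree 1 functions

  module Mixing {n ℓ : ℕ} (S : Space n ℓ) (r R ν : ℚ) (0<r : 0ℚ < r) (Rr² : R * (r * r) ≡ 1ℚ) (0≤R : 0ℚ ≤ R)
    (0<n : 0ℚ < # n) (nν : # n * ν ≡ 1ℚ) (κ-lower : ∀ a → # n * r + # 3 ≤ Space.κ S a) where

    open Analysis S public

    0≤r : 0ℚ ≤ r
    0≤r = ℚ.<⇒≤ 0<r

    -- By symmetry the letter at j is as likely to be a as the letter at any other position outside s₁, s₂, s₃.
    fix : ∀ j a s₁ s₂ s₃ (X : U → Fin ℓ → ℚ) → (∀ u b → 0ℚ ≤ X u b) →
          (∀ m → m ≢ s₁ → m ≢ s₂ → m ≢ s₃ → ∀ u → X (swap j m u) a ≡ X u a) →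
          r * E (λ u → X u a) ≤ E (λ u → X u (at u j))
    fix j a s₁ s₂ s₃ X X≥0 X-swap = cancel 0<n (ℚ.≤-trans bound (scale (ℚ.<⇒≤ 0<n) at-j))
      where
      Y : U → ℚ
      Y u = X u a
      Z : Fin n → U → ℚ
      Z m u = δ (at u m) a * Y u
      s : Fin n → ℚ
      s m = δ m s₁ + δ m s₂ + δ m s₃
      Z≥0 : ∀ m u → 0ℚ ≤ Z m u
      Z≥0 m u = 0≤δ (at u m) a ⊗ X≥0 u a
      at-j : E (Z j) ≤ E (λ u → X u (at u j))
      at-j = E.mono (λ u → pointwise u (at u j Fin.≟ a))
        where
        pointwise : ∀ u → Dec (at u j ≡ a) → Z j u ≤ X u (at u j)
        pointwise u (yes refl) = ℚ.≤-reflexive (trans (cong (λ d → d * X u (at u j)) (δ-refl (at u j)))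
            (ℚ.*-identityˡ (X u (at u j))))
        pointwise u (no  ≢a)   = subst (_≤ X u (at u j)) (sym (trans (cong (λ d → d * Y u) (δ-≢ ≢a)) (ℚ.*-zeroˡ (Y u))))
            (X≥0 u (at u j))
      EY≥0 : 0ℚ ≤ E Y
      EY≥0 = E.nonneg (λ u → X≥0 u a)
      Z≤Y : ∀ m → E (Z m) ≤ E Y
      Z≤Y m = E.mono (λ u → by (gap (δ≤1 (at u m) a) ⊗ X≥0 u a) (lemma (δ (at u m) a) (Y u)))
        where
        lemma = solve 2 (λ d y → y :- d :* y := (con 1ℚ :- d) :* y) refl
      -- An excluded position is estimated trivially by `E Y`. The remainder `t` allows for
      -- coincidences among `s₁`, `s₂`, `s₃`.
      excluded : ∀ m {t} → 0ℚ ≤ t → s m ≡ 1ℚ + t → E (Z m) ≤ E (Z j) + s m * E Y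
      excluded m {t} 0≤t e = ℚ.≤-trans (Z≤Y m) (by (E.nonneg (Z≥0 j) ⊕ 0≤t ⊗ EY≥0)
        (trans (cong (λ z → (E (Z j) + z * E Y) - E Y) e) (lemma (E (Z j)) (E Y) t)))
        where
        lemma = solve 3 (λ x y t → (x :+ (con 1ℚ :+ t) :* y) :- y := x :+ t :* y) refl
      Zm≡Zj : ∀ {m} → m ≢ s₁ → m ≢ s₂ → m ≢ s₃ → E (Z m) ≡ E (Z j)
      Zm≡Zj {m} m≢s₁ m≢s₂ m≢s₃ = trans (sym (E-swap j m (Z m)))
        (E.congr (λ u → cong₂ (λ b y → δ b a * y) (at-swapʳ j m u) (X-swap m m≢s₁ m≢s₂ m≢s₃ u)))
      exchange : ∀ m → Dec (m ≡ s₁) → Dec (m ≡ s₂) → Dec (m ≡ s₃) → E (Z m) ≤ E (Z j) + s m * E Y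
      exchange m (yes refl) _ _ = excluded m {δ m s₂ + δ m s₃} (0≤δ m s₂ ⊕ 0≤δ m s₃)
        (trans (cong (λ z → z + δ m s₂ + δ m s₃) (δ-refl m)) (ℚ.+-assoc 1ℚ (δ m s₂) (δ m s₃)))
      exchange m (no _) (yes refl) _ = excluded m {δ m s₁ + δ m s₃} (0≤δ m s₁ ⊕ 0≤δ m s₃)
        (trans (cong (λ z → δ m s₁ + z + δ m s₃) (δ-refl m)) (lemma (δ m s₁) (δ m s₃)))
        where
        lemma = solve 2 (λ x y → x :+ con 1ℚ :+ y := con 1ℚ :+ (x :+ y)) refl
      exchange m (no _) (no _) (yes refl) = excluded m {δ m s₁ + δ m s₂} (0≤δ m s₁ ⊕ 0≤δ m s₂)
        (trans (cong (λ z → δ m s₁ + δ m s₂ + z) (δ-refl m)) (ℚ.+-comm (δ m s₁ + δ m s₂) 1ℚ))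
      exchange m (no m≢s₁) (no m≢s₂) (no m≢s₃) = by ((0≤δ m s₁ ⊕ 0≤δ m s₂ ⊕ 0≤δ m s₃) ⊗ EY≥0)
        (trans (cong (λ z → (E (Z j) + s m * E Y) - z) (Zm≡Zj m≢s₁ m≢s₂ m≢s₃)) (lemma (E (Z j)) (E Y) (s m)))
        where
        lemma = solve 3 (λ x y s → (x :+ s :* y) :- x := s :* y) refl
      ∑-s : ∑ s ≡ # 3
      ∑-s = trans (∑.+-hom (λ m → δ m s₁ + δ m s₂) (λ m → δ m s₃))
        (cong₂ _+_ (trans (∑.+-hom (λ m → δ m s₁) (λ m → δ m s₂)) (cong₂ _+_ (one s₁) (one s₂))) (one s₃))
        where
        one : ∀ k → ∑ (λ m → δ m k) ≡ 1ℚ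
        one k = trans (∑.congr (λ m → sym (ℚ.*-identityʳ (δ m k)))) (∑-δ k (λ _ → 1ℚ))
      -- Count the occurrences of `a` over all positions, weighted by `Y`. The excluded positions
      -- cost `# 3 * E Y`, which is why `κ-lower` asks for `# 3` beyond `# n * r`.
      total : κ a * E Y ≤ # n * E (Z j) + # 3 * E Y
      total = begin
        κ a * E Y                                      ≡⟨ E.*-hom (κ a) Y ⟨
        E (λ u → κ a * Y u)                            ≡⟨ E.congr (λ u → cong (λ z → z * Y u) (count u a)) ⟨
        E (λ u → ∑ (λ m → δ (at u m) a) * Y u)         ≡⟨ E.congr (λ u → ∑.*-homʳ (Y u) (λ m → δ (at u m) a)) ⟨
        E (λ u → ∑ (λ m → Z m u))                      ≡⟨ functional-∑ E-lin Z ⟩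
        ∑ (λ m → E (Z m))                              ≤⟨ ∑.mono (λ m → exchange m (m Fin.≟ s₁) (m Fin.≟ s₂) (m Fin.≟ s₃)) ⟩
        ∑ (λ m → E (Z j) + s m * E Y)                  ≡⟨ ∑.+-hom (λ _ → E (Z j)) (λ m → s m * E Y) ⟩
        ∑ {n} (λ _ → E (Z j)) + ∑ (λ m → s m * E Y)    ≡⟨ cong₂ _+_ (∑-const {n} (E (Z j)))
            (trans (∑.*-homʳ (E Y) s) (cong (λ z → z * E Y) ∑-s)) ⟩
        # n * E (Z j) + # 3 * E Y                      ∎
        where open ℚ.≤-Reasoning
      bound : # n * (r * E Y) ≤ # n * E (Z j)
      bound = by (gap total ⊕ gap (κ-lower a) ⊗ EY≥0) (lemma (# n) r (E Y) (E (Z j)) (κ a))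
        where
        lemma = solve 5 (λ n r y z k → n :* z :- n :* (r :* y) := ((n :* z :+ con (# 3) :* y) :- k :* y) :+
            (k :- (n :* r :+ con (# 3))) :* y) refl

    module Moments (c : ℚ) (φ : Fin n → Fin ℓ → ℚ) where

      open Degree1 c φ public

      e : Pair n → ℚ
      e p = E (λ u → α p u * α p u)

      α-diagonal : ∀ j u → α (j , j) u ≡ 0ℚ
      α-diagonal j u = lemma (φ j (at u j))
        where
        lemma = solve 1 (λ x → x :- x :+ (x :- x) := con 0ℚ) refl

      e≥0 : ∀ p → 0ℚ ≤ e p
      e≥0 p = E.nonneg (λ u → sq (α p u))

      -- Even when weighted by `Y`, the letters that `v` has at `j` and `k` occur there with
      -- relative weight at least `r * r`: `fix` is applied to the letter at `k` and then to the
      -- letter at `j`. In the second application the integrand reads the letter at `k`, so `k`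
      -- joins `s₁` and `s₂` as an excluded position; hence three exclusions in `fix`.
      pair : ∀ {j k} → j ≢ k → ∀ s₁ s₂ (Y : U → ℚ) → (∀ u → 0ℚ ≤ Y u) →
             (∀ m → m ≢ s₁ → m ≢ s₂ → ∀ u → Y (swap j m u) ≡ Y u) →
             (∀ m → m ≢ s₁ → m ≢ s₂ → ∀ u → Y (swap k m u) ≡ Y u) →
             ∀ v → r * r * (α (j , k) v * α (j , k) v * E Y) ≤ E (λ u → α (j , k) u * α (j , k) u * Y u)
      pair {j} {k} j≢k s₁ s₂ Y Y≥0 Yj Yk v = begin
        r * r * (Q a b * E Y)                        ≡⟨ ℚ.*-assoc r r (Q a b * E Y) ⟩
        r * (r * (Q a b * E Y))                      ≡⟨ cong (λ z → r * (r * z)) (E.*-hom (Q a b) Y) ⟨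
        r * (r * E (λ u → Q a b * Y u))              ≤⟨ scale 0≤r (fix k b s₁ s₁ s₂ (λ u b → Q a b * Y u)
                                                           (λ u b → sq (q (j , k) a b) ⊗ Y≥0 u)
                                                           (λ m m≢s₁ _ m≢s₂ u → cong (λ z → Q a b * z) (Yk m m≢s₁ m≢s₂ u))) ⟩
        r * E (λ u → Q a (at u k) * Y u)             ≤⟨ fix j a k s₁ s₂ (λ u a → Q a (at u k) * Y u)
                                                           (λ u a → sq (q (j , k) a (at u k)) ⊗ Y≥0 u)
                                                           (λ m m≢k m≢s₁ m≢s₂ u → cong₂ (λ b y → Q a b * y)
                                                              (at-swap-≢ j m u (j≢k ∘ sym) (m≢k ∘ sym)) (Yj m m≢s₁ m≢s₂ u)) ⟩
        E (λ u → α (j , k) u * α (j , k) u * Y u)    ∎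
        where
        open ℚ.≤-Reasoning
        a b : Fin ℓ
        a = at v j
        b = at v k
        Q : Fin ℓ → Fin ℓ → ℚ
        Q a b = q (j , k) a b * q (j , k) a b

      α-bound : ∀ p v → α p v * α p v ≤ R * e p
      α-bound p@(j , k) v = cases (j Fin.≟ k)
        where
        A e′ : ℚ
        A = α p v * α p v
        e′ = E (λ u → α p u * α p u * 1ℚ)
        lemma₁ = solve 2 (λ x y → x :- y := x :- con 1ℚ :* y) refl
        lemma₂ = solve 4 (λ R r a x → R :* x :- (R :* (r :* r)) :* a := R :* (x :- r :* r :* (a :* con 1ℚ))) refl
        cases : Dec (j ≡ k) → A ≤ R * e p
        cases (yes refl) = subst (_≤ R * e p) (sym (trans (cong (λ z → z * α p v) (α-diagonal j v)) (ℚ.*-zeroˡ (α p v))))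
            (0≤R ⊗ e≥0 p)
        cases (no  j≢k)  = by (0≤R ⊗ gap (pair j≢k j j (λ _ → 1ℚ) (λ _ → #-nonneg 1) (λ _ _ _ _ → refl) (λ _ _ _ _ → refl) v))
          (trans (lemma₁ (R * e p) A)
            (trans (cong₂ (λ x y → R * x - y * A) (sym (E.congr (λ u → ℚ.*-identityʳ (α p u * α p u)))) (sym Rr²))
            (trans (lemma₂ R r A e′) (cong (λ z → R * (e′ - r * r * (A * z))) (sym E-1)))))

      -- The mean of `f`, as each position carries `a` with probability `κ a * ν`. With the closed
      -- formula as definition `∑α` is an identity at every point; that it is the mean is then a
      -- consequence, `E-h`.
      μ : ℚ
      μ = c + ν * ∑ (λ j → ∑ (λ a → κ a * φ j a))

      h : U → ℚ
      h u = f u - μ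

      V : ℚ
      V = E (λ u → h u * h u)

      V≥0 : 0ℚ ≤ V
      V≥0 = E.nonneg (λ u → sq (h u))

      h-swap : ∀ p u → h (σ p u) ≡ h u - α p u
      h-swap p u = trans (cong (λ z → z - μ) (f-swap p u)) (lemma (f u) (α p u) μ)
        where
        lemma = solve 3 (λ x a m → (x :- a) :- m := (x :- m) :- a) refl

      ∑α : ∀ u → ∑₂ (λ p → α p u) ≡ # 2 * # n * h u
      ∑α u = begin
        ∑₂ (λ p → α p u)
          ≡⟨ ∑₂.congr (λ p → lemma₁ (α p u)) ⟩
        ∑₂ (λ p → 1ℚ * 1ℚ * α p u)
          ≡⟨ ∑₂-α (λ _ → 1ℚ) u ⟩
        # 2 * (∑ {n} (λ _ → 1ℚ) * ∑ (λ j → 1ℚ * φ j (at u j)) - ∑ (λ j → 1ℚ * ∑ (λ k → 1ℚ * φ j (at u k))))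
          ≡⟨ cong (λ z → # 2 * z) (cong₂ _-_ (cong₂ _*_ (trans (∑-const {n} 1ℚ) (ℚ.*-identityʳ (# n)))
               (∑.congr (λ j → ℚ.*-identityˡ (φ j (at u j)))))
               (∑.congr (λ j → trans (ℚ.*-identityˡ _) (trans (∑.congr (λ k → ℚ.*-identityˡ (φ j (at u k)))) (∑-at (φ j) u))))) ⟩
        # 2 * (# n * X - B)
          ≡⟨ cong (λ z → # 2 * (# n * X - z)) (trans (sym (ℚ.*-identityˡ B)) (cong (λ z → z * B) (sym nν))) ⟩
        # 2 * (# n * X - (# n * ν) * B)
          ≡⟨ lemma₂ (# n) X ν B c ⟩
        # 2 * # n * h u ∎
        where
        open ≡-Reasoning
        X B : ℚ
        X = ∑ (λ j → φ j (at u j))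
        B = ∑ (λ j → ∑ (λ a → κ a * φ j a))
        lemma₁ = solve 1 (λ x → x := con 1ℚ :* con 1ℚ :* x) refl
        lemma₂ = solve 5 (λ n x v b c → con (# 2) :* (n :* x :- (n :* v) :* b) := con (# 2) :* n :* ((c :+ x) :- (c :+ v :* b)))
            refl

      -- The centred function h is an eigenvector of the generator of the random transposition walk.
      generator : ∀ (X : U → ℚ) → # 2 * # n * E (λ u → h u * X u) ≡ ∑₂ (λ p → E (λ u → α p u * X u))
      generator X = begin
        # 2 * # n * E (λ u → h u * X u)          ≡⟨ E.*-hom (# 2 * # n) (λ u → h u * X u) ⟨
        E (λ u → # 2 * # n * (h u * X u))        ≡⟨ E.congr (λ u → ℚ.*-assoc (# 2 * # n) (h u) (X u)) ⟨
        E (λ u → # 2 * # n * h u * X u)          ≡⟨ E.congr (λ u → cong (λ z → z * X u) (∑α u)) ⟨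
        E (λ u → ∑₂ (λ p → α p u) * X u)         ≡⟨ E.congr (λ u → ∑₂.*-homʳ (X u) (λ p → α p u)) ⟨
        E (λ u → ∑₂ (λ p → α p u * X u))         ≡⟨ functional-∑₂ E-lin (λ p u → α p u * X u) ⟩
        ∑₂ (λ p → E (λ u → α p u * X u))         ∎
        where open ≡-Reasoning

      -- The Dirichlet form of `h` against `w ∘ h`. A constant `w` gives `E-h`, the identity gives
      -- `∑e`, and odd powers give the moment bounds through `stein`.
      generator-by-parts : ∀ w → # 4 * # n * E (λ u → h u * w (h u))
                                 ≡ ∑₂ (λ p → E (λ u → α p u * (w (h u) - w (h u - α p u))))
      generator-by-parts w = begin
        # 4 * # n * E (λ u → h u * w (h u))
          ≡⟨ lemma (# n) (E (λ u → h u * w (h u))) ⟩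
        # 2 * # n * E (λ u → h u * w (h u)) + # 2 * # n * E (λ u → h u * w (h u))
          ≡⟨ cong (λ z → z + z) (generator (λ u → w (h u))) ⟩
        ∑₂ (λ p → E (λ u → α p u * w (h u))) + ∑₂ (λ p → E (λ u → α p u * w (h u)))
          ≡⟨ ∑₂.+-hom (λ p → E (λ u → α p u * w (h u))) (λ p → E (λ u → α p u * w (h u))) ⟨
        ∑₂ (λ p → E (λ u → α p u * w (h u)) + E (λ u → α p u * w (h u)))
          ≡⟨ ∑₂.congr (λ p → by-parts p h (h-swap p) w) ⟩
        ∑₂ (λ p → E (λ u → α p u * (w (h u) - w (h u - α p u)))) ∎
        where
        open ≡-Reasoning
        lemma = solve 2 (λ n x → con (# 4) :* n :* x := con (# 2) :* n :* x :+ con (# 2) :* n :* x) refl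

      E-h : E h ≡ 0ℚ
      E-h = ℚ.≤-antisym (cancel 0<4n (ℚ.≤-reflexive zero₁)) (cancel 0<4n (ℚ.≤-reflexive (sym zero₁)))
        where
        0<4n : 0ℚ < # 4 * # n
        0<4n = #-pos 3 ⊗⁺ 0<n
        lemma₁ = solve 1 (λ x → x :* (con 1ℚ :- con 1ℚ) := con 0ℚ) refl
        zero₁ : # 4 * # n * E h ≡ # 4 * # n * 0ℚ
        zero₁ = begin
          # 4 * # n * E h
            ≡⟨ cong (λ z → # 4 * # n * z) (E.congr (λ u → ℚ.*-identityʳ (h u))) ⟨
          # 4 * # n * E (λ u → h u * 1ℚ)
            ≡⟨ generator-by-parts (λ _ → 1ℚ) ⟩
          ∑₂ (λ p → E (λ u → α p u * (1ℚ - 1ℚ)))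
            ≡⟨ ∑₂.congr (λ p → trans (E.congr (λ u → lemma₁ (α p u))) E.0-hom) ⟩
          ∑₂ {n} (λ _ → 0ℚ)
            ≡⟨ ∑₂.0-hom ⟩
          0ℚ
            ≡⟨ ℚ.*-zeroʳ (# 4 * # n) ⟨
          # 4 * # n * 0ℚ ∎
          where open ≡-Reasoning

      ∑e : ∑₂ e ≡ # 4 * # n * V
      ∑e = sym (trans (generator-by-parts (λ x → x))
        (∑₂.congr (λ p → E.congr (λ u → cong (λ z → α p u * z) (lemma (h u) (α p u))))))
        where
        lemma = solve 2 (λ x a → x :- (x :- a) := a) refl

      E-f² : E (λ u → f u * f u) ≡ μ * μ + V
      E-f² = begin
        E (λ u → f u * f u)
          ≡⟨ E.congr (λ u → lemma₁ (f u) μ) ⟩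
        E (λ u → (# 2 * μ * h u + 1ℚ * (h u * h u)) + μ * μ)
          ≡⟨ E.+-hom (λ u → # 2 * μ * h u + 1ℚ * (h u * h u)) (λ _ → μ * μ) ⟩
        E (λ u → # 2 * μ * h u + 1ℚ * (h u * h u)) + E (λ _ → μ * μ)
          ≡⟨ cong₂ _+_ (trans (E.combine (# 2 * μ) 1ℚ h (λ u → h u * h u)) (cong (λ z → # 2 * μ * z + 1ℚ * V) E-h))
              (E-const (μ * μ)) ⟩
        # 2 * μ * 0ℚ + 1ℚ * V + μ * μ
          ≡⟨ lemma₂ μ V ⟩
        μ * μ + V ∎
        where
        open ≡-Reasoning
        lemma₁ = solve 2 (λ x m → x :* x := (con (# 2) :* m :* (x :- m) :+ con 1ℚ :* ((x :- m) :* (x :- m))) :+ m :* m) refl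
        lemma₂ = solve 2 (λ m v → con (# 2) :* m :* con 0ℚ :+ con 1ℚ :* v :+ m :* m := m :* m :+ v) refl

      Γ-bound : ∀ u → ∑₂ (λ p → α p u * α p u) ≤ R * (# 4 * # n * V)
      Γ-bound u = ℚ.≤-trans (∑₂.mono (λ p → α-bound p u))
        (ℚ.≤-reflexive (trans (∑₂.*-hom R e) (cong (λ z → R * z) ∑e)))

      -- With `z` half the derivative of `w`, the second hypothesis is the trapezoid bound for a
      -- convex derivative: its mean over an interval is at most the average of its end values.
      -- Invariance of `E` moves the term at `σ p u` back to `u`. The sum of the squares of `α` is
      -- then bounded pointwise by `Γ-bound`, so that `V` leaves the expectation as a factor.
      stein : ∀ (w z : ℚ → ℚ) → (∀ x → 0ℚ ≤ z x) →
              (∀ x y → (x - y) * (w x - w y) ≤ (x - y) * (x - y) * (z x + z y)) →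
              E (λ u → h u * w (h u)) ≤ # 2 * R * V * E (z ∘ h)
      stein w z z≥0 wz = cancel (#-pos 3 ⊗⁺ 0<n) (begin
        # 4 * # n * E (λ u → h u * w (h u))
          ≡⟨ generator-by-parts w ⟩
        ∑₂ (λ p → E (λ u → α p u * (w (h u) - w (h u - α p u))))
          ≤⟨ ∑₂.mono (λ p → E.mono (λ u → step p u)) ⟩
        ∑₂ (λ p → E (λ u → A p u + A p (σ p u)))
          ≡⟨ ∑₂.congr (λ p@(j , k) → trans (E.+-hom (A p) (λ u → A p (σ p u)))
               (trans (cong (λ y → E (A p) + y) (E-swap j k (A p))) (sym (E.+-hom (A p) (A p))))) ⟩
        ∑₂ (λ p → E (λ u → A p u + A p u))
          ≡⟨ functional-∑₂ E-lin (λ p u → A p u + A p u) ⟨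
        E (λ u → ∑₂ (λ p → A p u + A p u))
          ≡⟨ E.congr (λ u → ∑₂.congr (λ p → lemma₁ (α p u) (z (h u)))) ⟩
        E (λ u → ∑₂ (λ p → α p u * α p u * (# 2 * z (h u))))
          ≡⟨ E.congr (λ u → ∑₂.*-homʳ (# 2 * z (h u)) (λ p → α p u * α p u)) ⟩
        E (λ u → ∑₂ (λ p → α p u * α p u) * (# 2 * z (h u)))
          ≤⟨ E.mono (λ u → by (gap (Γ-bound u) ⊗ (#-nonneg 2 ⊗ z≥0 (h u)))
              (lemma₂ (∑₂ (λ p → α p u * α p u)) (R * (# 4 * # n * V)) (# 2 * z (h u)))) ⟩
        E (λ u → R * (# 4 * # n * V) * (# 2 * z (h u)))
          ≡⟨ trans (E.*-hom (R * (# 4 * # n * V)) (λ u → # 2 * z (h u)))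
              (cong (λ y → R * (# 4 * # n * V) * y) (E.*-hom (# 2) (z ∘ h))) ⟩
        R * (# 4 * # n * V) * (# 2 * E (z ∘ h))
          ≡⟨ lemma₃ R (# n) V (E (z ∘ h)) ⟩
        # 4 * # n * (# 2 * R * V * E (z ∘ h)) ∎)
        where
        open ℚ.≤-Reasoning
        A : Pair n → U → ℚ
        A p u = α p u * α p u * z (h u)
        step : ∀ p u → α p u * (w (h u) - w (h u - α p u)) ≤ A p u + A p (σ p u)
        step p u = subst₂ _≤_
          (cong (λ y → y * (w (h u) - w (h u - α p u))) (lemma₀ (h u) (α p u)))
          (trans (cong (λ y → y * y * (z (h u) + z (h u - α p u))) (lemma₀ (h u) (α p u)))
            (trans (lemma₄ (α p u) (z (h u)) (z (h u - α p u)))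
              (cong₂ (λ a x → A p u + a * a * z x) (sym (α-swap p u)) (sym (h-swap p u)))))
          (wz (h u) (h u - α p u))
          where
          lemma₀ = solve 2 (λ x a → x :- (x :- a) := a) refl
          lemma₄ = solve 3 (λ a x y → a :* a :* (x :+ y) := a :* a :* x :+ (:- a) :* (:- a) :* y) refl
        lemma₁ = solve 2 (λ a z → a :* a :* z :+ a :* a :* z := a :* a :* (con (# 2) :* z)) refl
        lemma₂ = solve 3 (λ x y z → y :* z :- x :* z := (y :- x) :* z) refl
        lemma₃ = solve 4 (λ R n v z → R :* (con (# 4) :* n :* v) :* (con (# 2) :* z) := con (# 4) :* n :*
            (con (# 2) :* R :* v :* z)) refl

      fourth-moment : E (λ u → h u * (h u * h u * h u)) ≤ # 3 * R * (V * V)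
      fourth-moment = ℚ.≤-trans
        (stein (λ x → x * x * x) (λ x → # 3 * ½ * (x * x)) (λ x → #-nonneg 3 ⊗ ℚ.nonNegative⁻¹ ½ ⊗ sq x)
          (λ x y → by (ℚ.nonNegative⁻¹ ½ ⊗ (sq ((x - y) * (x - y)))) (lemma₁ x y)))
        (ℚ.≤-reflexive (trans (cong (λ z → # 2 * R * V * z) (E.*-hom (# 3 * ½) (λ u → h u * h u))) (lemma₂ R V)))
        where
        lemma₁ = solve 2 (λ x y → (x :- y) :* (x :- y) :* (con (# 3) :* con ½ :* (x :* x) :+ con (# 3) :* con ½ :* (y :* y)) :-
            (x :- y) :* (x :* x :* x :- y :* y :* y)
          := con ½ :* ((x :- y) :* (x :- y) :* ((x :- y) :* (x :- y)))) refl
        lemma₂ = solve 2 (λ R v → con (# 2) :* R :* v :* (con (# 3) :* con ½ :* v) := con (# 3) :* R :* (v :* v)) refl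

      -- The fifth power in `stein` leaves 2 · 5/2 times a fourth moment, which contributes the
      -- remaining factor 3 of `# 15`.
      sixth-moment : E (λ u → h u * (h u * h u * h u * h u * h u)) ≤ # 15 * R * R * (V * V * V)
      sixth-moment = ℚ.≤-trans
        (stein (λ x → x * x * x * x * x) (λ x → # 5 * ½ * (x * (x * x * x))) (λ x → #-nonneg 5 ⊗ ℚ.nonNegative⁻¹ ½ ⊗ fourth x)
          (λ x y → by (sq (x - y) ⊗ (ℚ.nonNegative⁻¹ ½ ⊗ (sq ((x - y) * (x + y)) ⊕ (sq x ⊕ sq y ⊕ sq (x + y)) ⊗ sq (x - y))))
              (lemma₁ x y)))
        (ℚ.≤-trans
          (ℚ.≤-reflexive (cong (λ z → # 2 * R * V * z) (E.*-hom (# 5 * ½) (λ u → h u * (h u * h u * h u)))))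
          (by (#-nonneg 5 ⊗ 0≤R ⊗ V≥0 ⊗ gap fourth-moment) (lemma₂ R V (E (λ u → h u * (h u * h u * h u))))))
        where
        fourth : ∀ x → 0ℚ ≤ x * (x * x * x)
        fourth x = subst (0ℚ ≤_) (lemma x) (sq (x * x))
          where
          lemma = solve 1 (λ x → x :* x :* (x :* x) := x :* (x :* x :* x)) refl
        lemma₁ = solve 2 (λ x y → (x :- y) :* (x :- y) :* (con (# 5) :* con ½ :* (x :* (x :* x :* x)) :+ con (# 5) :* con ½ :*
            (y :* (y :* y :* y)))
          :- (x :- y) :* (x :* x :* x :* x :* x :- y :* y :* y :* y :* y)
          := (x :- y) :* (x :- y) :* (con ½ :* ((x :- y) :* (x :+ y) :* ((x :- y) :* (x :+ y)) :+
              (x :* x :+ y :* y :+ (x :+ y) :* (x :+ y)) :* ((x :- y) :* (x :- y))))) refl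
        lemma₂ = solve 3 (λ R v m → con (# 15) :* R :* R :* (v :* v :* v) :- con (# 2) :* R :* v :* (con (# 5) :* con ½ :* m)
            := con (# 5) :* R :* v :* (con (# 3) :* R :* (v :* v) :- m)) refl

  -- Weights on pairs of transpositions

  -- Indicators are written as polynomials in `δ`, so that inequalities between them have
  -- certificates. `incidence` and `meets` count with multiplicity: they only dominate the
  -- complementary indicators, but they sum exactly.
  avoids : ∀ {n} → Fin n → Pair n → ℚ
  avoids j (j′ , k′) = (1ℚ - δ j j′) * (1ℚ - δ j k′)

  disjoint : ∀ {n} → Pair n → Pair n → ℚ
  disjoint (j , k) p′ = avoids j p′ * avoids k p′

  incidence : ∀ {n} → Fin n → Pair n → ℚ
  incidence j (j′ , k′) = δ j j′ + δ j k′

  meets : ∀ {n} → Pair n → Pair n → ℚ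
  meets (j , k) p′ = incidence j p′ + incidence k p′

  avoids≥0 : ∀ {n} (j : Fin n) p → 0ℚ ≤ avoids j p
  avoids≥0 j (j′ , k′) = gap (δ≤1 j j′) ⊗ gap (δ≤1 j k′)

  disjoint≥0 : ∀ {n} (p p′ : Pair n) → 0ℚ ≤ disjoint p p′
  disjoint≥0 (j , k) p′ = avoids≥0 j p′ ⊗ avoids≥0 k p′

  incidence≥0 : ∀ {n} (j : Fin n) p → 0ℚ ≤ incidence j p
  incidence≥0 j (j′ , k′) = 0≤δ j j′ ⊕ 0≤δ j k′

  avoids-lower : ∀ {n} (j : Fin n) p → 1ℚ ≤ avoids j p + incidence j p
  avoids-lower j (j′ , k′) = by (0≤δ j j′ ⊗ 0≤δ j k′) (lemma (δ j j′) (δ j k′))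
    where
    lemma = solve 2 (λ x y → ((con 1ℚ :- x) :* (con 1ℚ :- y) :+ (x :+ y)) :- con 1ℚ := x :* y) refl

  avoids≤1 : ∀ {n} (j : Fin n) p → avoids j p ≤ 1ℚ
  avoids≤1 j (j′ , k′) = by (0≤δ j j′ ⊕ gap (δ≤1 j j′) ⊗ 0≤δ j k′) (lemma (δ j j′) (δ j k′))
    where
    lemma = solve 2 (λ x y → con 1ℚ :- (con 1ℚ :- x) :* (con 1ℚ :- y) := x :+ (con 1ℚ :- x) :* y) refl

  disjoint≤1 : ∀ {n} (p p′ : Pair n) → disjoint p p′ ≤ 1ℚ
  disjoint≤1 (j , k) p′ = by (gap (avoids≤1 j p′) ⊕ avoids≥0 j p′ ⊗ gap (avoids≤1 k p′)) (lemma (avoids j p′) (avoids k p′))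
    where
    lemma = solve 2 (λ x y → con 1ℚ :- x :* y := (con 1ℚ :- x) :+ x :* (con 1ℚ :- y)) refl

  disjoint-lower : ∀ {n} (j k : Fin n) p → avoids j p ≤ disjoint (j , k) p + incidence k p
  disjoint-lower j k p = by (gap (avoids≤1 j p) ⊗ incidence≥0 k p ⊕ avoids≥0 j p ⊗ gap (avoids-lower k p))
    (lemma (avoids j p) (avoids k p) (incidence k p))
    where
    lemma = solve 3 (λ x y i → (x :* y :+ i) :- x := (con 1ℚ :- x) :* i :+ x :* ((y :+ i) :- con 1ℚ)) refl

  covers : ∀ {n} (p p′ : Pair n) → 1ℚ ≤ disjoint p p′ + meets p p′
  covers (j , k) p′ = by (gap (avoids-lower j p′) ⊕ gap (disjoint-lower j k p′))
    (lemma (avoids j p′) (disjoint (j , k) p′) (incidence j p′) (incidence k p′))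
    where
    lemma = solve 4 (λ x d i k → (d :+ (i :+ k)) :- con 1ℚ := ((x :+ i) :- con 1ℚ) :+ ((d :+ k) :- x)) refl

  meets-sym : ∀ {n} (p p′ : Pair n) → meets p p′ ≡ meets p′ p
  meets-sym (j , k) (j′ , k′) = trans (lemma (δ j j′) (δ j k′) (δ k j′) (δ k k′))
    (cong₂ _+_ (cong₂ _+_ (δ-sym j j′) (δ-sym k j′)) (cong₂ _+_ (δ-sym j k′) (δ-sym k k′)))
    where
    lemma = solve 4 (λ a b c d → (a :+ b) :+ (c :+ d) := (a :+ c) :+ (b :+ d)) refl

  data Disjointness {n : ℕ} : (p p′ : Pair n) → Set where
    meeting  : ∀ {p p′} → disjoint p p′ ≡ 0ℚ → Disjointness p p′
    distinct : ∀ {j k j′ k′} → j ≢ j′ → j ≢ k′ → k ≢ j′ → k ≢ k′ →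
               disjoint (j , k) (j′ , k′) ≡ 1ℚ → Disjointness (j , k) (j′ , k′)

  avoids-or-hits : ∀ {n} (j : Fin n) j′ k′ → avoids j (j′ , k′) ≡ 0ℚ ⊎ (j ≢ j′ × j ≢ k′ × avoids j (j′ , k′) ≡ 1ℚ)
  avoids-or-hits j j′ k′ with j Fin.≟ j′ | j Fin.≟ k′
  ... | yes refl | _        = inj₁ (trans (cong (λ z → (1ℚ - z) * (1ℚ - δ j k′)) (δ-refl j)) (ℚ.*-zeroˡ (1ℚ - δ j k′)))
  ... | no _     | yes refl = inj₁ (trans (cong (λ z → (1ℚ - δ j j′) * (1ℚ - z)) (δ-refl j)) (ℚ.*-zeroʳ (1ℚ - δ j j′)))
  ... | no j≢j′  | no j≢k′  = inj₂ (j≢j′ , j≢k′ , cong₂ (λ x y → (1ℚ - x) * (1ℚ - y)) (δ-≢ j≢j′) (δ-≢ j≢k′))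

  disjointness : ∀ {n} (p p′ : Pair n) → Disjointness p p′
  disjointness (j , k) (j′ , k′) with avoids-or-hits j j′ k′ | avoids-or-hits k j′ k′
  ... | inj₁ e | _ = meeting (trans (cong (λ z → z * avoids k (j′ , k′)) e) (ℚ.*-zeroˡ (avoids k (j′ , k′))))
  ... | inj₂ _ | inj₁ e = meeting (trans (cong (λ z → avoids j (j′ , k′) * z) e) (ℚ.*-zeroʳ (avoids j (j′ , k′))))
  ... | inj₂ (a , b , e) | inj₂ (c , d , e′) = distinct a b c d (cong₂ _*_ e e′)

  ∑₂-incidence : ∀ {n} (t : Pair n → ℚ) → (∀ j k → t (j , k) ≡ t (k , j)) → ∀ j →
                 ∑₂ (λ p → incidence j p * t p) ≡ # 2 * ∑ (λ k → t (j , k))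
  ∑₂-incidence t t-sym j = begin
    ∑₂ (λ p → incidence j p * t p)
      ≡⟨ ∑₂.congr (λ p@(j′ , k′) → ℚ.*-distribʳ-+ (t p) (δ j j′) (δ j k′)) ⟩
    ∑₂ (λ (j′ , k′) → δ j j′ * t (j′ , k′) + δ j k′ * t (j′ , k′))
      ≡⟨ ∑₂.+-hom (λ (j′ , k′) → δ j j′ * t (j′ , k′)) (λ (j′ , k′) → δ j k′ * t (j′ , k′)) ⟩
    ∑ (λ j′ → ∑ (λ k′ → δ j j′ * t (j′ , k′))) + ∑ (λ j′ → ∑ (λ k′ → δ j k′ * t (j′ , k′)))
      ≡⟨ cong₂ _+_ (trans (∑.congr (λ j′ → ∑.*-hom (δ j j′) (λ k′ → t (j′ , k′)))) (∑-δˡ j (λ j′ → ∑ (λ k′ → t (j′ , k′)))))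
                   (∑.congr (λ j′ → trans (∑-δˡ j (λ k′ → t (j′ , k′))) (t-sym j′ j))) ⟩
    ∑ (λ k → t (j , k)) + ∑ (λ k → t (j , k))
      ≡⟨ lemma (∑ (λ k → t (j , k))) ⟩
    # 2 * ∑ (λ k → t (j , k)) ∎
    where
    open ≡-Reasoning
    lemma = solve 1 (λ x → x :+ x := con (# 2) :* x) refl

  -- If nearly no weight sits on pairs of disjoint edges, then some star carries nearly all of it.
  module Star {n : ℕ} (t : Pair n → ℚ) (t≥0 : ∀ p → 0ℚ ≤ t p) (t-sym : ∀ j k → t (j , k) ≡ t (k , j))
    (ξ η : ℚ) (0≤ξ : 0ℚ ≤ ξ) (0<η : 0ℚ < η) (t≤ξ : ∀ p → t p ≤ ξ) (ξ≤η : # 32 * ξ ≤ η)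
    (Q≤ : ∑₂ (λ p → ∑₂ (λ p′ → disjoint p p′ * (t p * t p′))) ≤ pos 1 / 8 * (η * η)) (j₀ : Fin n) where

    τ Q P : ℚ
    s T : Fin n → ℚ
    τ = ∑₂ t
    s j = ∑ (λ k → t (j , k))
    T j = ∑₂ (λ p → avoids j p * t p)
    P = ∑ (λ j → s j * s j)
    Q = ∑₂ (λ p → ∑₂ (λ p′ → disjoint p p′ * (t p * t p′)))

    s≥0 : ∀ j → 0ℚ ≤ s j
    s≥0 j = ∑.nonneg (λ k → t≥0 (j , k))

    τ≥0 : 0ℚ ≤ τ
    τ≥0 = ∑₂.nonneg t≥0

    ∑₂-ts : ∑₂ (λ (j , k) → t (j , k) * (# 2 * s j + # 2 * s k)) ≡ # 4 * P
    ∑₂-ts = begin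
      ∑₂ (λ (j , k) → t (j , k) * (# 2 * s j + # 2 * s k))
        ≡⟨ ∑₂.congr (λ (j , k) → lemma₁ (t (j , k)) (s j) (s k)) ⟩
      ∑₂ (λ (j , k) → # 2 * (t (j , k) * s j) + # 2 * (t (j , k) * s k))
        ≡⟨ ∑₂.combine (# 2) (# 2) (λ (j , k) → t (j , k) * s j) (λ (j , k) → t (j , k) * s k) ⟩
      # 2 * ∑ (λ j → ∑ (λ k → t (j , k) * s j)) + # 2 * ∑ (λ j → ∑ (λ k → t (j , k) * s k))
        ≡⟨ cong₂ (λ x y → # 2 * x + # 2 * y) (∑.congr (λ j → ∑.*-homʳ (s j) (λ k → t (j , k))))
             (trans (∑-comm (λ j k → t (j , k) * s k)) (∑.congr (λ k → trans (∑.*-homʳ (s k) (λ j → t (j , k)))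
               (cong (λ z → z * s k) (∑.congr (λ j → t-sym j k)))))) ⟩
      # 2 * P + # 2 * P
        ≡⟨ lemma₂ P ⟩
      # 4 * P ∎
      where
      open ≡-Reasoning
      lemma₁ = solve 3 (λ t x y → t :* (con (# 2) :* x :+ con (# 2) :* y) := con (# 2) :* (t :* x) :+ con (# 2) :* (t :* y)) refl
      lemma₂ = solve 1 (λ x → con (# 2) :* x :+ con (# 2) :* x := con (# 4) :* x) refl

    -- Two edges are disjoint or share an endpoint. The second kind is counted through incidences,
    -- and these add up to four times the sum of the squared degrees `s j`.
    τ²-bound : τ * τ ≤ Q + # 4 * P
    τ²-bound = begin
      τ * τ
        ≡⟨ trans (∑₂.congr (λ p → ∑₂.*-hom (t p) t)) (∑₂.*-homʳ τ t) ⟨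
      ∑₂ (λ p → ∑₂ (λ p′ → t p * t p′))
        ≤⟨ ∑₂.mono (λ p → ∑₂.mono (λ p′ → by (gap (covers p p′) ⊗ (t≥0 p ⊗ t≥0 p′))
            (lemma (disjoint p p′) (meets p p′) (t p) (t p′)))) ⟩
      ∑₂ (λ p → ∑₂ (λ p′ → disjoint p p′ * (t p * t p′) + t p * (meets p p′ * t p′)))
        ≡⟨ trans (∑₂.congr (λ p → ∑₂.+-hom (λ p′ → disjoint p p′ * (t p * t p′)) (λ p′ → t p * (meets p p′ * t p′))))
             (∑₂.+-hom (λ p → ∑₂ (λ p′ → disjoint p p′ * (t p * t p′))) (λ p → ∑₂ (λ p′ → t p * (meets p p′ * t p′)))) ⟩
      Q + ∑₂ (λ p → ∑₂ (λ p′ → t p * (meets p p′ * t p′)))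
        ≡⟨ cong (λ z → Q + z) (trans (∑₂.congr (λ p → trans (∑₂.*-hom (t p) (λ p′ → meets p p′ * t p′))
            (cong (λ z → t p * z) (meets-sum p)))) ∑₂-ts) ⟩
      Q + # 4 * P ∎
      where
      open ℚ.≤-Reasoning
      lemma = solve 4 (λ d m x y → (d :* (x :* y) :+ x :* (m :* y)) :- x :* y := ((d :+ m) :- con 1ℚ) :* (x :* y)) refl
      meets-sum : ∀ p → ∑₂ (λ p′ → meets p p′ * t p′) ≡ # 2 * s (proj₁ p) + # 2 * s (proj₂ p)
      meets-sum (j , k) = trans (∑₂.congr (λ p′ → ℚ.*-distribʳ-+ (t p′) (incidence j p′) (incidence k p′)))
        (trans (∑₂.+-hom (λ p′ → incidence j p′ * t p′) (λ p′ → incidence k p′ * t p′))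
          (cong₂ _+_ (∑₂-incidence t t-sym j) (∑₂-incidence t t-sym k)))

    star : Fin n → ℚ
    star j = ∑ (λ k → ∑₂ (λ p′ → disjoint (j , k) p′ * (t (j , k) * t p′)))

    -- The left side counts an edge `(j , k)` together with an edge avoiding `j`. If the two are not
    -- disjoint, they share `k`; such pairs weigh at most `t (j , k) * (# 2 * s k)`, and
    -- `t (j , k) ≤ ξ`.
    star-lower : ∀ j → s j * T j ≤ star j + # 2 * ξ * τ
    star-lower j = begin
      s j * T j
        ≡⟨ ∑.*-homʳ (T j) (λ k → t (j , k)) ⟨
      ∑ (λ k → t (j , k) * T j)
        ≤⟨ ∑.mono row ⟩
      ∑ (λ k → ∑₂ (λ p′ → disjoint (j , k) p′ * (t (j , k) * t p′)) + # 2 * ξ * s k)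
        ≡⟨ ∑.+-hom (λ k → ∑₂ (λ p′ → disjoint (j , k) p′ * (t (j , k) * t p′))) (λ k → # 2 * ξ * s k) ⟩
      star j + ∑ (λ k → # 2 * ξ * s k)
        ≡⟨ cong (λ z → star j + z) (∑.*-hom (# 2 * ξ) s) ⟩
      star j + # 2 * ξ * τ ∎
      where
      open ℚ.≤-Reasoning
      lemma₁ = solve 5 (λ d i a t x → (d :* (t :* x) :+ t :* (i :* x)) :- t :* (a :* x) := ((d :+ i) :- a) :* (t :* x)) refl
      lemma₂ = solve 4 (λ x t s ξ → (x :+ con (# 2) :* ξ :* s) :- (x :+ t :* (con (# 2) :* s)) := con (# 2) :* s :* (ξ :- t)) refl
      row : ∀ k → t (j , k) * T j ≤ ∑₂ (λ p′ → disjoint (j , k) p′ * (t (j , k) * t p′)) + # 2 * ξ * s k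
      row k = begin
        t (j , k) * T j
          ≡⟨ ∑₂.*-hom (t (j , k)) (λ p′ → avoids j p′ * t p′) ⟨
        ∑₂ (λ p′ → t (j , k) * (avoids j p′ * t p′))
          ≤⟨ ∑₂.mono (λ p′ → by (gap (disjoint-lower j k p′) ⊗ (t≥0 (j , k) ⊗ t≥0 p′))
               (lemma₁ (disjoint (j , k) p′) (incidence k p′) (avoids j p′) (t (j , k)) (t p′))) ⟩
        ∑₂ (λ p′ → disjoint (j , k) p′ * (t (j , k) * t p′) + t (j , k) * (incidence k p′ * t p′))
          ≡⟨ ∑₂.+-hom (λ p′ → disjoint (j , k) p′ * (t (j , k) * t p′)) (λ p′ → t (j , k) * (incidence k p′ * t p′)) ⟩
        X + ∑₂ (λ p′ → t (j , k) * (incidence k p′ * t p′))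
          ≡⟨ cong (λ z → X + z) (trans (∑₂.*-hom (t (j , k)) (λ p′ → incidence k p′ * t p′))
              (cong (λ z → t (j , k) * z) (∑₂-incidence t t-sym k))) ⟩
        X + t (j , k) * (# 2 * s k)
          ≤⟨ by (#-nonneg 2 ⊗ s≥0 k ⊗ gap (t≤ξ (j , k))) (lemma₂ X (t (j , k)) (s k) ξ) ⟩
        X + # 2 * ξ * s k ∎
        where
        X : ℚ
        X = ∑₂ (λ p′ → disjoint (j , k) p′ * (t (j , k) * t p′))

    star≥0 : ∀ j → 0ℚ ≤ star j
    star≥0 j = ∑.nonneg (λ k → ∑₂.nonneg (λ p′ → disjoint≥0 (j , k) p′ ⊗ (t≥0 (j , k) ⊗ t≥0 p′)))

    single≤∑ : ∀ (g : Fin n → ℚ) → (∀ i → 0ℚ ≤ g i) → ∀ j → g j ≤ ∑ g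
    single≤∑ g g≥0 j = subst (_≤ ∑ g) (∑-δ j g) (∑.mono (λ i → by (gap (δ≤1 i j) ⊗ g≥0 i) (lemma (δ i j) (g i))))
      where
      lemma = solve 2 (λ d x → x :- d :* x := (con 1ℚ :- d) :* x) refl

    -- From `η < T j` and `star-lower`, `η * (s j * s j)` is at most `s j * (star j + # 2 * ξ * τ)`.
    -- Replacing `s j` by `τ` in front of `star j` lets the stars add up to `Q`.
    weighted : (∀ j → η < T j) → η * P ≤ τ * (pos 1 / 8 * (η * η)) + # 2 * ξ * τ * τ
    weighted η<T = begin
      η * P
        ≡⟨ ∑.*-hom η (λ j → s j * s j) ⟨
      ∑ (λ j → η * (s j * s j))
        ≤⟨ ∑.mono row ⟩
      ∑ (λ j → τ * star j + # 2 * ξ * τ * s j)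
        ≡⟨ ∑.combine τ (# 2 * ξ * τ) star s ⟩
      τ * Q + # 2 * ξ * τ * τ
        ≤⟨ by (τ≥0 ⊗ gap Q≤) (lemma₂ τ Q (pos 1 / 8 * (η * η)) (# 2 * ξ * τ * τ)) ⟩
      τ * (pos 1 / 8 * (η * η)) + # 2 * ξ * τ * τ ∎
      where
      open ℚ.≤-Reasoning
      lemma₁ = solve 6 (λ τ x ξ s T η → (τ :* x :+ con (# 2) :* ξ :* τ :* s) :- η :* (s :* s) := s :*
          ((x :+ con (# 2) :* ξ :* τ) :- s :* T) :+ s :* s :* (T :- η) :+ x :* (τ :- s)) refl
      lemma₂ = solve 4 (λ τ q e x → (τ :* e :+ x) :- (τ :* q :+ x) := τ :* (e :- q)) refl
      row : ∀ j → η * (s j * s j) ≤ τ * star j + # 2 * ξ * τ * s j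
      row j = by (s≥0 j ⊗ gap (star-lower j) ⊕ sq (s j) ⊗ gap (ℚ.<⇒≤ (η<T j)) ⊕ star≥0 j ⊗ gap (single≤∑ s s≥0 j))
        (lemma₁ τ (star j) ξ (s j) (T j) η)

    -- If every `T j` exceeded `η`, then `τ²-bound` and `weighted` would give ητ² ≤ η³/8 + η²τ/2 +
    -- 8ξτ². As ξ ≤ η/32 and η < τ, the right side is at most 7/8 of the left: this is the origin of
    -- the 1/8 and the 32 in the hypotheses.
    light : Σ[ j ∈ Fin n ] T j ≤ η
    light with Fin.any? (λ j → T j ℚ.≤? η)
    ... | yes found = found
    ... | no  none  = contradiction (ℚ.<-≤-trans 0<ητ² (subst (_≤ 0ℚ) (lemma₂ (η * (τ * τ))) (ℚ.neg-antimono-≤ negative)))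
        (ℚ.<-irrefl refl)
      where
      η<T : ∀ j → η < T j
      η<T j = ℚ.≰⇒> (λ T≤η → none (j , T≤η))
      η<τ : η < τ
      η<τ = ℚ.<-≤-trans (η<T j₀) (∑₂.mono (λ p → by (gap (avoids≤1 j₀ p) ⊗ t≥0 p) (lemma (avoids j₀ p) (t p))))
        where
        lemma = solve 2 (λ d x → x :- d :* x := (con 1ℚ :- d) :* x) refl
      0<τ : 0ℚ < τ
      0<τ = ℚ.<-trans 0<η η<τ
      0<ητ² : 0ℚ < η * (τ * τ)
      0<ητ² = 0<η ⊗⁺ (0<τ ⊗⁺ 0<τ)
      -- The contradiction as a single identity. The multipliers 8η, 32 and 2τ² are chosen so that
      -- `P` and `ξ` cancel.
      lemma₁ = solve 4 (λ η τ ξ p → con (# 8) :* η :* ((con (pos 1 / 8) :* (η :* η) :+ con (# 4) :* p) :- τ :* τ)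
        :+ con (# 32) :* ((τ :* (con (pos 1 / 8) :* (η :* η)) :+ con (# 2) :* ξ :* τ :* τ) :- η :* p)
        :+ con (# 2) :* (τ :* τ) :* (η :- con (# 32) :* ξ) :+ η :* (τ :- η) :* (con (# 5) :* τ :+ η) :=  :- (η :* (τ :* τ))) refl
      lemma₂ = solve 1 (λ x → :- (:- x) := x) refl
      0≤η = ℚ.<⇒≤ 0<η
      negative : 0ℚ ≤ - (η * (τ * τ))
      negative = subst (0ℚ ≤_) (lemma₁ η τ ξ P)
        ( #-nonneg 8 ⊗ 0≤η ⊗ gap (ℚ.≤-trans τ²-bound (ℚ.+-monoˡ-≤ (# 4 * P) Q≤))
        ⊕ #-nonneg 32 ⊗ gap (weighted η<T)
        ⊕ #-nonneg 2 ⊗ sq τ ⊗ gap ξ≤η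
        ⊕ 0≤η ⊗ gap (ℚ.<⇒≤ η<τ) ⊗ (#-nonneg 5 ⊗ τ≥0 ⊕ 0≤η))

  -- The energy of disjoint transpositions

  ∣x∣² : ∀ x → ∣ x ∣ * ∣ x ∣ ≡ x * x
  ∣x∣² x = trans (sym (ℚ.∣p*q∣≡∣p∣*∣q∣ x x)) (ℚ.0≤p⇒∣p∣≡p (sq x))

  abstract
    dist² : ℚ → ℚ
    dist² x = (∣ x - 0ℚ ∣ ⊓ ∣ x - 1ℚ ∣) * (∣ x - 0ℚ ∣ ⊓ ∣ x - 1ℚ ∣)

    dist²-def : ∀ x → dist² x ≡ (∣ x - 0ℚ ∣ ⊓ ∣ x - 1ℚ ∣) * (∣ x - 0ℚ ∣ ⊓ ∣ x - 1ℚ ∣)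
    dist²-def x = refl

    dist²≥0 : ∀ x → 0ℚ ≤ dist² x
    dist²≥0 x = sq (∣ x - 0ℚ ∣ ⊓ ∣ x - 1ℚ ∣)

    dist²≤ : ∀ x b → dist² x ≤ (x - bit b) * (x - bit b)
    dist²≤ x b = subst (dist² x ≤_) (∣x∣² (x - bit b))
        (ℚ.≤-trans (scale 0≤m (m≤ b)) (ℚ.*-monoʳ-≤-nonNeg ∣ x - bit b ∣ {{ℚ.∣-∣-nonNeg (x - bit b)}} (m≤ b)))
      where
      m≤ : ∀ b → ∣ x - 0ℚ ∣ ⊓ ∣ x - 1ℚ ∣ ≤ ∣ x - bit b ∣
      m≤ true = ℚ.p⊓q≤q ∣ x - 0ℚ ∣ ∣ x - 1ℚ ∣
      m≤ false = ℚ.p⊓q≤p ∣ x - 0ℚ ∣ ∣ x - 1ℚ ∣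
      0≤m : 0ℚ ≤ ∣ x - 0ℚ ∣ ⊓ ∣ x - 1ℚ ∣
      0≤m = ℚ.⊓-glb (ℚ.0≤∣p∣ (x - 0ℚ)) (ℚ.0≤∣p∣ (x - 1ℚ))

    dist²-attained : ∀ x → Σ[ b ∈ _ ] dist² x ≡ (x - bit b) * (x - bit b)
    dist²-attained x with ℚ.⊓-sel ∣ x - 0ℚ ∣ ∣ x - 1ℚ ∣
    ... | inj₁ e = false , trans (cong (λ z → z * z) e) (∣x∣² (x - 0ℚ))
    ... | inj₂ e = true  , trans (cong (λ z → z * z) e) (∣x∣² (x - 1ℚ))

  ∑₂-comm : ∀ {n} (F : Pair n → Pair n → ℚ) → ∑₂ (λ p → ∑₂ (F p)) ≡ ∑₂ (λ p′ → ∑₂ (λ p → F p p′))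
  ∑₂-comm {n} F = functional-∑₂ (∑₂-positiveLinear n) (λ p′ p → F p p′)

  G : ℚ → ℚ
  G x = x * x - x

  module Concentration {n ℓ : ℕ} (S : Space n ℓ) (r R ν : ℚ) (0<r : 0ℚ < r) (Rr² : R * (r * r) ≡ 1ℚ) (0≤R : 0ℚ ≤ R)
    (0<n : 0ℚ < # n) (nν : # n * ν ≡ 1ℚ) (κ-lower : ∀ a → # n * r + # 3 ≤ Space.κ S a)
    (c : ℚ) (φ : Fin n → Fin ℓ → ℚ) where

    open Mixing S r R ν 0<r Rr² 0≤R 0<n nν κ-lower
    open Moments c φ

    m : ℚ
    m = E (λ u → f u * f u)

    -- From f⁴ ≤ 8h⁴ + 8μ⁴ and the fourth moment of `h`; 24 is 8 · 3.
    f⁴-bound : E (λ u → f u * f u * (f u * f u)) ≤ (# 8 + # 24 * R) * (m * m)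
    f⁴-bound = begin
      E (λ u → f u * f u * (f u * f u))
        ≤⟨ E-bound-const (# 8) (λ u → h u * (h u * h u * h u)) (# 8 * (μ * μ * (μ * μ))) (λ u →
             by (sq (f u - μ - μ) ⊗ (#-nonneg 2 ⊗ sq μ ⊕ #-nonneg 2 ⊗ sq (f u - μ) ⊕ sq (f u)) ⊕ #-nonneg 4 ⊗ sq
                 (μ * μ - h u * h u))
                (lemma₁ (f u) μ)) ⟩
      # 8 * E (λ u → h u * (h u * h u * h u)) + # 8 * (μ * μ * (μ * μ))
        ≤⟨ by (#-nonneg 8 ⊗ gap fourth-moment ⊕ #-nonneg 8 ⊗ (#-nonneg 2 ⊗ sq μ ⊗ V≥0 ⊕ V≥0 ⊗ V≥0) ⊕ #-nonneg 24 ⊗ 0≤R ⊗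
            (sq μ ⊗ sq μ ⊕ #-nonneg 2 ⊗ sq μ ⊗ V≥0))
             (lemma₂ (E (λ u → h u * (h u * h u * h u))) μ V R) ⟩
      (# 8 + # 24 * R) * ((μ * μ + V) * (μ * μ + V))
        ≡⟨ cong (λ z → (# 8 + # 24 * R) * (z * z)) E-f² ⟨
      (# 8 + # 24 * R) * (m * m) ∎
      where
      open ℚ.≤-Reasoning
      lemma₁ = solve 2 (λ f m → (con (# 8) :* ((f :- m) :* ((f :- m) :* (f :- m) :* (f :- m))) :+ con (# 8) :*
          (m :* m :* (m :* m))) :- f :* f :* (f :* f)
        := (f :- m :- m) :* (f :- m :- m) :* (con (# 2) :* (m :* m) :+ con (# 2) :* ((f :- m) :* (f :- m)) :+ f :* f)
        :+ con (# 4) :* ((m :* m :- (f :- m) :* (f :- m)) :* (m :* m :- (f :- m) :* (f :- m)))) refl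
      lemma₂ = solve 4 (λ x μ v R → (con (# 8) :+ con (# 24) :* R) :* ((μ :* μ :+ v) :* (μ :* μ :+ v)) :-
          (con (# 8) :* x :+ con (# 8) :* (μ :* μ :* (μ :* μ)))
        := con (# 8) :* (con (# 3) :* R :* (v :* v) :- x) :+ con (# 8) :* (con (# 2) :* (μ :* μ) :* v :+ v :* v) :+ con
            (# 24) :* R :* (μ :* μ :* (μ :* μ) :+ con (# 2) :* (μ :* μ) :* v)) refl

    α-disjoint : ∀ {j k j′ k′} → j ≢ j′ → j ≢ k′ → k ≢ j′ → k ≢ k′ → ∀ u → α (j′ , k′) (swap j k u) ≡ α (j′ , k′) u
    α-disjoint {j} {k} {j′} {k′} a b c d u =
      cong₂ (q (j′ , k′)) (at-swap-≢ j k u (a ∘ sym) (c ∘ sym)) (at-swap-≢ j k u (b ∘ sym) (d ∘ sym))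

    -- The mixed second difference of x² − x along two disjoint transpositions is 2 α α′.
    mixed : ∀ {j k j′ k′} → j ≢ j′ → j ≢ k′ → k ≢ j′ → k ≢ k′ →
            E (λ u → α (j , k) u * α (j , k) u * (α (j′ , k′) u * α (j′ , k′) u))
              ≡ # 2 * E (λ u → G (f u) * (α (j , k) u * α (j′ , k′) u))
    mixed {j} {k} {j′} {k′} j≢j′ j≢k′ k≢j′ k≢k′ = begin
      E (λ u → a u * a u * (b u * b u))
        -- Each swap flips the sign of exactly one of `a` and `b`. Adding `X` over the four images
        -- of `u` therefore produces `a u * b u` times the mixed second difference of `G ∘ f`, twice
        -- the left integrand.
        ≡⟨ E.congr (λ u → lemma₁ (f u) (a u) (b u)) ⟩
      E (λ u → ½ * (Y (f u) (a u) (b u) + Y (f u - a u) (- a u) (b u)) + ½ * (Y (f u - b u) (a u) (- b u) + Y (f u - b u - a u)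
          (- a u) (- b u)))
        ≡⟨ E.congr (λ u → sym (cong₂ (λ x y → ½ * x + ½ * y) (cong (λ z → X u + z) (X-p u)) (cong₂ _+_ (X-p′ u) (X-pp′ u)))) ⟩
      E (λ u → ½ * (X u + X (σ p u)) + ½ * (X (σ p′ u) + X (σ p (σ p′ u))))
        ≡⟨ E.combine ½ ½ (λ u → X u + X (σ p u)) (λ u → X (σ p′ u) + X (σ p (σ p′ u))) ⟩
      ½ * E (λ u → X u + X (σ p u)) + ½ * E (λ u → X (σ p′ u) + X (σ p (σ p′ u)))
        ≡⟨ cong (λ z → ½ * E (λ u → X u + X (σ p u)) + ½ * z) (E-swap j′ k′ (λ u → X u + X (σ p u))) ⟩
      ½ * E (λ u → X u + X (σ p u)) + ½ * E (λ u → X u + X (σ p u))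
        ≡⟨ cong (λ z → ½ * z + ½ * z) (trans (E.+-hom X (λ u → X (σ p u))) (cong (λ z → E X + z) (E-swap j k X))) ⟩
      ½ * (E X + E X) + ½ * (E X + E X)
        ≡⟨ lemma₂ (E X) ⟩
      # 2 * E X ∎
      where
      open ≡-Reasoning
      p p′ : Pair n
      p = j , k
      p′ = j′ , k′
      a b X : U → ℚ
      a = α p
      b = α p′
      Y : ℚ → ℚ → ℚ → ℚ
      Y x y z = G x * (y * z)
      X u = Y (f u) (a u) (b u)
      Y-cong : ∀ {x x′ y y′ z z′} → x ≡ x′ → y ≡ y′ → z ≡ z′ → Y x y z ≡ Y x′ y′ z′
      Y-cong refl refl refl = refl
      X-p : ∀ u → X (σ p u) ≡ Y (f u - a u) (- a u) (b u)
      X-p u = Y-cong (f-swap p u) (α-swap p u) (α-disjoint j≢j′ j≢k′ k≢j′ k≢k′ u)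
      a-p′ : ∀ u → a (σ p′ u) ≡ a u
      a-p′ u = α-disjoint (j≢j′ ∘ sym) (k≢j′ ∘ sym) (j≢k′ ∘ sym) (k≢k′ ∘ sym) u
      X-p′ : ∀ u → X (σ p′ u) ≡ Y (f u - b u) (a u) (- b u)
      X-p′ u = Y-cong (f-swap p′ u) (a-p′ u) (α-swap p′ u)
      X-pp′ : ∀ u → X (σ p (σ p′ u)) ≡ Y (f u - b u - a u) (- a u) (- b u)
      X-pp′ u = trans (X-p (σ p′ u)) (Y-cong (cong₂ _-_ (f-swap p′ u) (a-p′ u)) (cong -_ (a-p′ u)) (α-swap p′ u))
      lemma₁ = solve 3 (λ x a b → a :* a :* (b :* b) := con ½ :*
          ((x :* x :- x) :* (a :* b) :+ ((x :- a) :* (x :- a) :- (x :- a)) :* ((:- a) :* b))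
        :+ con ½ :* (((x :- b) :* (x :- b) :- (x :- b)) :* (a :* (:- b)) :+ ((x :- b :- a) :* (x :- b :- a) :- (x :- b :- a)) :*
            ((:- a) :* (:- b)))) refl
      lemma₂ = solve 1 (λ x → con ½ :* (x :+ x) :+ con ½ :* (x :+ x) := con (# 2) :* x) refl

    -- Disjoint transpositions are independent up to the factor `r * r`: `pair`, with the square of
    -- the second `α` as weight, holds at every `v`, and averaging over `v` turns the square of the
    -- first into its mean.
    e-product : ∀ {j k j′ k′} → j ≢ j′ → j ≢ k′ → k ≢ j′ → k ≢ k′ →
                r * r * (e (j , k) * e (j′ , k′)) ≤ E (λ u → α (j , k) u * α (j , k) u * (α (j′ , k′) u * α (j′ , k′) u))
    e-product {j} {k} {j′} {k′} j≢j′ j≢k′ k≢j′ k≢k′ = begin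
      r * r * (e (j , k) * e (j′ , k′))
        ≡⟨ trans (E.*-hom (r * r) (λ v → A v * E B)) (cong (λ z → r * r * z) (E.*-homʳ (E B) A)) ⟨
      E (λ v → r * r * (A v * E B))
        ≤⟨ E.mono bound ⟩
      E (λ v → E (λ u → A u * B u))
        ≡⟨ E-const (E (λ u → A u * B u)) ⟩
      E (λ u → A u * B u) ∎
      where
      open ℚ.≤-Reasoning
      A B : U → ℚ
      A u = α (j , k) u * α (j , k) u
      B u = α (j′ , k′) u * α (j′ , k′) u
      lemma = solve 2 (λ x y → x :* (con 0ℚ :* con 0ℚ :* y) := con 0ℚ) refl
      bound : ∀ v → r * r * (A v * E B) ≤ E (λ u → A u * B u)
      bound v with j Fin.≟ k
      ... | no  j≢k  = pair j≢k j′ k′ B (λ u → sq (α (j′ , k′) u))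
        (λ l l≢j′ l≢k′ u → cong (λ z → z * z) (α-disjoint j≢j′ j≢k′ l≢j′ l≢k′ u))
        (λ l l≢j′ l≢k′ u → cong (λ z → z * z) (α-disjoint k≢j′ k≢k′ l≢j′ l≢k′ u)) v
      ... | yes refl = subst (_≤ E (λ u → A u * B u))
        (sym (trans (cong (λ z → r * r * (z * z * E B)) (α-diagonal j v)) (lemma (r * r) (E B))))
        (E.nonneg (λ u → sq (α (j , j) u) ⊗ sq (α (j′ , k′) u)))

    S₀ : U → ℚ
    S₀ u = ∑₂ (λ p → ∑₂ (λ p′ → disjoint p p′ * (α p u * α p′ u)))

    -- Turns near-Booleanness into a statement about the weights: the right side pairs `G ∘ f`,
    -- which vanishes at Boolean values, with `S₀`, whose size is controlled by the moments of `h`.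
    disjoint-energy : r * r * ∑₂ (λ p → ∑₂ (λ p′ → disjoint p p′ * (e p * e p′))) ≤ # 2 * E (λ u → G (f u) * S₀ u)
    disjoint-energy = begin
      r * r * ∑₂ (λ p → ∑₂ (λ p′ → disjoint p p′ * (e p * e p′)))
        ≡⟨ trans (∑₂.congr (λ p → ∑₂.*-hom (r * r) (λ p′ → disjoint p p′ * (e p * e p′))))
            (∑₂.*-hom (r * r) (λ p → ∑₂ (λ p′ → disjoint p p′ * (e p * e p′)))) ⟨
      ∑₂ (λ p → ∑₂ (λ p′ → r * r * (disjoint p p′ * (e p * e p′))))
        ≤⟨ ∑₂.mono (λ p → ∑₂.mono (λ p′ → term p p′)) ⟩
      ∑₂ (λ p → ∑₂ (λ p′ → # 2 * E (λ u → G (f u) * (disjoint p p′ * (α p u * α p′ u)))))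
        ≡⟨ trans (∑₂.congr (λ p → ∑₂.*-hom (# 2) (λ p′ → E (λ u → G (f u) * (disjoint p p′ * (α p u * α p′ u))))))
             (∑₂.*-hom (# 2) (λ p → ∑₂ (λ p′ → E (λ u → G (f u) * (disjoint p p′ * (α p u * α p′ u)))))) ⟩
      # 2 * ∑₂ (λ p → ∑₂ (λ p′ → E (λ u → G (f u) * (disjoint p p′ * (α p u * α p′ u)))))
        ≡⟨ cong (λ z → # 2 * z) (trans (functional-∑₂ E-lin (λ p u → ∑₂ (λ p′ → G (f u) * (disjoint p p′ * (α p u * α p′ u)))))
             (∑₂.congr (λ p → functional-∑₂ E-lin (λ p′ u → G (f u) * (disjoint p p′ * (α p u * α p′ u)))))) ⟨
      # 2 * E (λ u → ∑₂ (λ p → ∑₂ (λ p′ → G (f u) * (disjoint p p′ * (α p u * α p′ u)))))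
        ≡⟨ cong (λ z → # 2 * z) (E.congr
            (λ u → trans (∑₂.congr (λ p → ∑₂.*-hom (G (f u)) (λ p′ → disjoint p p′ * (α p u * α p′ u))))
             (∑₂.*-hom (G (f u)) (λ p → ∑₂ (λ p′ → disjoint p p′ * (α p u * α p′ u)))))) ⟩
      # 2 * E (λ u → G (f u) * S₀ u) ∎
      where
      open ℚ.≤-Reasoning
      lemma₀ = solve 2 (λ x y → x :* (con 0ℚ :* y) := con 0ℚ) refl
      lemma₁ = solve 2 (λ x y → x :* y := x :* (con 1ℚ :* y)) refl
      term : ∀ p p′ → r * r * (disjoint p p′ * (e p * e p′)) ≤ # 2 * E (λ u → G (f u) * (disjoint p p′ * (α p u * α p′ u)))
      term p p′ with disjointness p p′
      ... | meeting d≡0 = ℚ.≤-reflexive (trans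
        (trans (cong (λ z → r * r * (z * (e p * e p′))) d≡0) (lemma₀ (r * r) (e p * e p′)))
        (sym (trans (cong (λ z → # 2 * z)
            (trans (E.congr (λ u → trans (cong (λ z → G (f u) * (z * (α p u * α p′ u))) d≡0)
            (lemma₀ (G (f u)) (α p u * α p′ u)))) E.0-hom))
          (ℚ.*-zeroʳ (# 2)))))
      ... | distinct a b c d d≡1 = subst₂ _≤_
        (trans (lemma₁ (r * r) (e p * e p′)) (cong (λ z → r * r * (z * (e p * e p′))) (sym d≡1)))
        (cong (λ z → # 2 * z) (E.congr (λ u → trans (lemma₁ (G (f u)) (α p u * α p′ u))
            (cong (λ z → G (f u) * (z * (α p u * α p′ u))) (sym d≡1)))))
        (ℚ.≤-trans (e-product a b c d) (ℚ.≤-reflexive (mixed a b c d)))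

    Γ : U → ℚ
    Γ u = ∑₂ (λ p → α p u * α p u)

    ∑₂-meets : ∀ u → ∑₂ (λ p → ∑₂ (λ p′ → meets p p′ * (α p′ u * α p′ u))) ≡ # 4 * # n * Γ u
    ∑₂-meets u = begin
      ∑₂ (λ p → ∑₂ (λ p′ → meets p p′ * t p′))
        ≡⟨ ∑₂.congr (λ p@(j , k) → trans (∑₂.congr (λ p′ → ℚ.*-distribʳ-+ (t p′) (incidence j p′) (incidence k p′)))
             (trans (∑₂.+-hom (λ p′ → incidence j p′ * t p′) (λ p′ → incidence k p′ * t p′))
               (cong₂ _+_ (∑₂-incidence t t-sym j) (∑₂-incidence t t-sym k)))) ⟩
      ∑₂ (λ (j , k) → # 2 * s j + # 2 * s k)
        ≡⟨ ∑₂.combine (# 2) (# 2) (λ (j , k) → s j) (λ (j , k) → s k) ⟩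
      # 2 * ∑ (λ j → ∑ {n} (λ k → s j)) + # 2 * ∑ {n} (λ j → ∑ (λ k → s k))
        ≡⟨ cong₂ (λ x y → # 2 * x + # 2 * y) (trans (∑.congr (λ j → ∑-const {n} (s j))) (∑.*-hom (# n) s)) (∑-const {n} (∑ s)) ⟩
      # 2 * (# n * Γ u) + # 2 * (# n * Γ u)
        ≡⟨ lemma₁ (# n) (Γ u) ⟩
      # 4 * # n * Γ u ∎
      where
      open ≡-Reasoning
      t : Pair n → ℚ
      t p = α p u * α p u
      s : Fin n → ℚ
      s j = ∑ (λ k → t (j , k))
      lemma₀ = solve 4 (λ a b c d → a :- b :+ (d :- c) := d :- c :+ (a :- b)) refl
      t-sym : ∀ j k → t (j , k) ≡ t (k , j)
      t-sym j k = cong (λ z → z * z) (lemma₀ (φ j (at u j)) (φ j (at u k)) (φ k (at u j)) (φ k (at u k)))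
      lemma₁ = solve 2 (λ n g → con (# 2) :* (n :* g) :+ con (# 2) :* (n :* g) := con (# 4) :* n :* g) refl

    X₀ : U → ℚ
    X₀ u = ∑₂ (λ p → ∑₂ (λ p′ → (1ℚ - disjoint p p′) * (α p u * α p′ u)))

    -- `1ℚ - disjoint p p′` is at most `meets p p′`, and a product is at most half the sum of the
    -- squares. Every transposition meets `# 4 * # n` ordered pairs, counted with multiplicity, so
    -- what separates `S₀` from a full square has only the order of n Γ.
    X₀-bound : ∀ u → (X₀ u ≤ # 4 * # n * Γ u) × (- (# 4 * # n * Γ u) ≤ X₀ u)
    X₀-bound u =
        ℚ.≤-trans (∑₂.mono (λ p → ∑₂.mono (λ p′ → by (upper p p′) (lemma₁ (disjoint p p′) (meets p p′) (α p u) (α p′ u)))))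
            (ℚ.≤-reflexive total)
      , subst (_≤ X₀ u) (trans (∑₂∑₂-neg) (cong -_ total))
          (∑₂.mono (λ p → ∑₂.mono (λ p′ → by (lower p p′) (lemma₂ (disjoint p p′) (meets p p′) (α p u) (α p′ u)))))
      where
      B : Pair n → Pair n → ℚ
      B p p′ = meets p p′ * (½ * (α p u * α p u) + ½ * (α p′ u * α p′ u))
      covers′ : ∀ p p′ → 0ℚ ≤ (disjoint p p′ + meets p p′) - 1ℚ
      covers′ p p′ = gap (covers p p′)
      half : ∀ p p′ → 0ℚ ≤ ½ * (α p u * α p u) + ½ * (α p′ u * α p′ u)
      half p p′ = ℚ.nonNegative⁻¹ ½ ⊗ sq (α p u) ⊕ ℚ.nonNegative⁻¹ ½ ⊗ sq (α p′ u)
      upper : ∀ p p′ → _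
      upper p p′ = covers′ p p′ ⊗ half p p′ ⊕ gap (disjoint≤1 p p′) ⊗ (ℚ.nonNegative⁻¹ ½ ⊗ sq (α p u - α p′ u))
      lower : ∀ p p′ → _
      lower p p′ = covers′ p p′ ⊗ half p p′ ⊕ gap (disjoint≤1 p p′) ⊗ (ℚ.nonNegative⁻¹ ½ ⊗ sq (α p u + α p′ u))
      lemma₁ = solve 4 (λ d i a b → i :* (con ½ :* (a :* a) :+ con ½ :* (b :* b)) :- (con 1ℚ :- d) :* (a :* b)
        := ((d :+ i) :- con 1ℚ) :* (con ½ :* (a :* a) :+ con ½ :* (b :* b)) :+ (con 1ℚ :- d) :*
            (con ½ :* ((a :- b) :* (a :- b)))) refl
      lemma₂ = solve 4 (λ d i a b → (con 1ℚ :- d) :* (a :* b) :- (:- con 1ℚ) :* (i :* (con ½ :* (a :* a) :+ con ½ :* (b :* b)))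
        := ((d :+ i) :- con 1ℚ) :* (con ½ :* (a :* a) :+ con ½ :* (b :* b)) :+ (con 1ℚ :- d) :*
            (con ½ :* ((a :+ b) :* (a :+ b)))) refl
      lemma₃ = solve 3 (λ i a b → i :* (con ½ :* a :+ con ½ :* b) := con ½ :* (i :* a) :+ con ½ :* (i :* b)) refl
      lemma₄ = solve 1 (λ x → con ½ :* x :+ con ½ :* x := x) refl
      lemma₅ = solve 1 (λ x → (:- con 1ℚ) :* x :=  :- x) refl
      total : ∑₂ (λ p → ∑₂ (λ p′ → B p p′)) ≡ # 4 * # n * Γ u
      total = begin
        ∑₂ (λ p → ∑₂ (λ p′ → B p p′))
          ≡⟨ ∑₂.congr (λ p → trans (∑₂.congr (λ p′ → lemma₃ (meets p p′) (α p u * α p u) (α p′ u * α p′ u)))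
               (∑₂.combine ½ ½ (λ p′ → meets p p′ * (α p u * α p u)) (λ p′ → meets p p′ * (α p′ u * α p′ u)))) ⟩
        ∑₂ (λ p → ½ * ∑₂ (λ p′ → meets p p′ * (α p u * α p u)) + ½ * ∑₂ (λ p′ → meets p p′ * (α p′ u * α p′ u)))
          ≡⟨ ∑₂.combine ½ ½ (λ p → ∑₂ (λ p′ → meets p p′ * (α p u * α p u))) (λ p → ∑₂ (λ p′ → meets p p′ * (α p′ u * α p′ u))) ⟩
        ½ * ∑₂ (λ p → ∑₂ (λ p′ → meets p p′ * (α p u * α p u))) + ½ * ∑₂ (λ p → ∑₂ (λ p′ → meets p p′ * (α p′ u * α p′ u)))
          ≡⟨ cong₂ (λ x y → ½ * x + ½ * y) (trans (∑₂-comm (λ p p′ → meets p p′ * (α p u * α p u)))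
               (trans (∑₂.congr (λ p′ → ∑₂.congr (λ p → cong (λ z → z * (α p u * α p u)) (meets-sym p p′)))) (∑₂-meets u)))
                   (∑₂-meets u) ⟩
        ½ * (# 4 * # n * Γ u) + ½ * (# 4 * # n * Γ u)
          ≡⟨ lemma₄ (# 4 * # n * Γ u) ⟩
        # 4 * # n * Γ u ∎
        where open ≡-Reasoning
      ∑₂∑₂-neg : ∑₂ (λ p → ∑₂ (λ p′ → (- 1ℚ) * B p p′)) ≡ - ∑₂ (λ p → ∑₂ (λ p′ → B p p′))
      ∑₂∑₂-neg = trans (∑₂.congr (λ p → ∑₂.*-hom (- 1ℚ) (B p)))
        (trans (∑₂.*-hom (- 1ℚ) (λ p → ∑₂ (B p))) (lemma₅ (∑₂ (λ p → ∑₂ (B p)))))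

    S₀-split : ∀ u → S₀ u ≡ # 2 * # n * h u * (# 2 * # n * h u) - X₀ u
    S₀-split u = begin
      S₀ u
        ≡⟨ ∑₂.congr (λ p → ∑₂.congr (λ p′ → lemma (disjoint p p′) (α p u) (α p′ u))) ⟩
      ∑₂ (λ p → ∑₂ (λ p′ → α p u * α p′ u - (1ℚ - disjoint p p′) * (α p u * α p′ u)))
        ≡⟨ trans (∑₂.congr (λ p → ∑₂.minus (λ p′ → α p u * α p′ u) (λ p′ → (1ℚ - disjoint p p′) * (α p u * α p′ u))))
             (∑₂.minus (λ p → ∑₂ (λ p′ → α p u * α p′ u)) (λ p → ∑₂ (λ p′ → (1ℚ - disjoint p p′) * (α p u * α p′ u)))) ⟩
      ∑₂ (λ p → ∑₂ (λ p′ → α p u * α p′ u)) - X₀ u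
        ≡⟨ cong (λ z → z - X₀ u) (trans (∑₂.congr (λ p → ∑₂.*-hom (α p u) (λ p′ → α p′ u)))
            (∑₂.*-homʳ (∑₂ (λ p → α p u)) (λ p → α p u))) ⟩
      ∑₂ (λ p → α p u) * ∑₂ (λ p → α p u) - X₀ u
        ≡⟨ cong (λ z → z * z - X₀ u) (∑α u) ⟩
      # 2 * # n * h u * (# 2 * # n * h u) - X₀ u ∎
      where
      open ≡-Reasoning
      lemma = solve 3 (λ d a b → d :* (a :* b) := a :* b :- (con 1ℚ :- d) :* (a :* b)) refl

    -- At the scale n² the sum `S₀` is 4h² up to an error of at most 16RV. From (x - y)² ≤ 2x² + 2y²
    -- come the constants 32 = 2 · 4² and 512 = 2 · 16² of the next bound.
    S₁ : U → ℚ
    S₁ u = ν * ν * S₀ u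

    S₁-bound : ∀ u → S₁ u * S₁ u ≤ # 32 * (h u * (h u * h u * h u)) + # 512 * (R * R) * (V * V)
    S₁-bound u = begin
      S₁ u * S₁ u
        ≡⟨ cong (λ z → ν * ν * z * (ν * ν * z)) (S₀-split u) ⟩
      ν * ν * (# 2 * # n * h u * (# 2 * # n * h u) - X₀ u) * (ν * ν * (# 2 * # n * h u * (# 2 * # n * h u) - X₀ u))
        ≤⟨ by (sq (ν * ν * (# 2 * # n * h u * (# 2 * # n * h u) + X₀ u)) ⊕ #-nonneg 2 ⊗ sq (ν * ν) ⊗ gap X₀²)
              (lemma₁ ν (# 2 * # n * h u) (X₀ u) Z) ⟩
      # 2 * ((ν * ν) * (ν * ν)) * ((# 2 * # n * h u * (# 2 * # n * h u)) * (# 2 * # n * h u * (# 2 * # n * h u)) + Z * Z)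
        ≡⟨ lemma₂ (# n) ν (h u) R V ⟩
      (# n * ν) * (# n * ν) * ((# n * ν) * (# n * ν)) * (# 32 * (h u * (h u * h u * h u)) + # 512 * (R * R) * (V * V))
        ≡⟨ trans (cong (λ z → z * z * (z * z) * (# 32 * (h u * (h u * h u * h u)) + # 512 * (R * R) * (V * V))) nν)
             (lemma₃ (# 32 * (h u * (h u * h u * h u)) + # 512 * (R * R) * (V * V))) ⟩
      # 32 * (h u * (h u * h u * h u)) + # 512 * (R * R) * (V * V) ∎
      where
      open ℚ.≤-Reasoning
      Z : ℚ
      Z = # 4 * # n * (R * (# 4 * # n * V))
      Γ≤ : # 4 * # n * Γ u ≤ Z
      Γ≤ = scale (#-nonneg 4 ⊗ #-nonneg n) (Γ-bound u)
      X₀² : X₀ u * X₀ u ≤ Z * Z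
      X₀² = ²-mono (ℚ.≤-trans (proj₁ (X₀-bound u)) Γ≤) (ℚ.≤-trans (ℚ.neg-antimono-≤ Γ≤) (proj₂ (X₀-bound u)))
      lemma₁ = solve 4 (λ v a x z → con (# 2) :* ((v :* v) :* (v :* v)) :* ((a :* a) :* (a :* a) :+ z :* z) :- v :* v :*
          (a :* a :- x) :* (v :* v :* (a :* a :- x))
        := v :* v :* (a :* a :+ x) :* (v :* v :* (a :* a :+ x)) :+ con (# 2) :* (v :* v :* (v :* v)) :* (z :* z :- x :* x)) refl
      lemma₂ = solve 5 (λ n v h R V → con (# 2) :* ((v :* v) :* (v :* v)) :* ((con (# 2) :* n :* h :* (con (# 2) :* n :* h)) :*
          (con (# 2) :* n :* h :* (con (# 2) :* n :* h)) :+ con (# 4) :* n :* (R :* (con (# 4) :* n :* V)) :*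
          (con (# 4) :* n :* (R :* (con (# 4) :* n :* V))))
        := (n :* v) :* (n :* v) :* ((n :* v) :* (n :* v)) :* (con (# 32) :* (h :* (h :* h :* h)) :+ con (# 512) :* (R :* R) :*
            (V :* V))) refl
      lemma₃ = solve 1 (λ x → con 1ℚ :* con 1ℚ :* (con 1ℚ :* con 1ℚ) :* x := x) refl

  -- Rounding to a dictator

  -- Bounds E[(f² + (f − 1)²) S₁²] when E f² ≤ 4.
  C₆ : ℚ → ℚ
  C₆ R = # 39936 * R + # 593920 * (R * R)

  nearest : ∀ x → Σ[ b ∈ Bool ] (∀ b′ → (x - bit b) * (x - bit b) ≤ (x - bit b′) * (x - bit b′))
  nearest x with ℚ.≤-total ½ x
  ... | inj₁ ½≤x = true , λ where
      true  → ℚ.≤-refl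
      false → by (#-nonneg 2 ⊗ gap ½≤x) (lemma x)
    where
    lemma = solve 1 (λ x → (x :- con 0ℚ) :* (x :- con 0ℚ) :- (x :- con 1ℚ) :* (x :- con 1ℚ) := con (# 2) :* (x :- con ½)) refl
  ... | inj₂ x≤½ = false , λ where
      true  → by (#-nonneg 2 ⊗ gap x≤½) (lemma x)
      false → ℚ.≤-refl
    where
    lemma = solve 1 (λ x → (x :- con 1ℚ) :* (x :- con 1ℚ) :- (x :- con 0ℚ) :* (x :- con 0ℚ) := con (# 2) :* (con ½ :- x)) refl

  round : ℚ → Bool
  round x = proj₁ (nearest x)

  module Dictator {n ℓ : ℕ} (S : Space n ℓ) (r R ν : ℚ) (0<r : 0ℚ < r) (Rr² : R * (r * r) ≡ 1ℚ) (0≤R : 0ℚ ≤ R)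
    (0<n : 0ℚ < # n) (nν : # n * ν ≡ 1ℚ) (κ-lower : ∀ a → # n * r + # 3 ≤ Space.κ S a)
    (c : ℚ) (φ : Fin n → Fin ℓ → ℚ) where

    open Mixing S r R ν 0<r Rr² 0≤R 0<n nν κ-lower
    open Moments c φ
    open Concentration S r R ν 0<r Rr² 0≤R 0<n nν κ-lower c φ

    d : U → ℚ
    d u = dist² (f u)

    0≤ν : 0ℚ ≤ ν
    0≤ν = cancel 0<n (subst₂ _≤_ (sym (ℚ.*-zeroʳ (# n))) (sym nν) (#-nonneg 1))

    -- Normalised so that the total weight is 4V by `∑e`, while a single weight is of order `ν`, as
    -- small as `Star` wants its `ξ`.
    t : Pair n → ℚ
    t p = ν * e p

    -- A small `λ₁` makes the moment term small whatever `f` is; the price is a large `λ₂`, which a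
    -- sufficiently small `E d` pays for. The factor `R` undoes the `r * r` of `disjoint-energy`.
    energy : ∀ {λ₁ λ₂} → 0ℚ ≤ λ₁ → 0ℚ ≤ λ₂ → λ₁ * λ₂ ≡ 1ℚ → m ≤ # 4 →
             ∑₂ (λ p → ∑₂ (λ p′ → disjoint p p′ * (t p * t p′))) ≤ R * (λ₁ * C₆ R + λ₂ * E d)
    energy {λ₁} {λ₂} 0≤λ₁ 0≤λ₂ λλ m≤4 = begin
      ∑₂ (λ p → ∑₂ (λ p′ → disjoint p p′ * (t p * t p′)))
        ≡⟨ ∑₂.congr (λ p → trans (∑₂.congr (λ p′ → lemma₁ ν (disjoint p p′) (e p) (e p′)))
            (∑₂.*-hom (ν * ν) (λ p′ → disjoint p p′ * (e p * e p′)))) ⟩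
      ∑₂ (λ p → ν * ν * ∑₂ (λ p′ → disjoint p p′ * (e p * e p′)))
        ≡⟨ ∑₂.*-hom (ν * ν) (λ p → ∑₂ (λ p′ → disjoint p p′ * (e p * e p′))) ⟩
      ν * ν * Q
        ≡⟨ trans (sym (ℚ.*-identityˡ (ν * ν * Q))) (trans (cong (λ z → z * (ν * ν * Q)) (sym Rr²)) (lemma₂ R (r * r) (ν * ν) Q)) ⟩
      R * (ν * ν * (r * r * Q))
        ≤⟨ scale 0≤R (scale (sq ν) disjoint-energy) ⟩
      R * (ν * ν * (# 2 * E (λ u → G (f u) * S₀ u)))
        ≡⟨ cong (λ z → R * z) (trans (lemma₃ (ν * ν) (E (λ u → G (f u) * S₀ u)))
            (trans (sym (E.*-hom (# 2 * (ν * ν)) (λ u → G (f u) * S₀ u)))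
             (E.congr (λ u → lemma₄ (G (f u)) (ν * ν) (S₀ u))))) ⟩
      R * E (λ u → # 2 * (G (f u) * S₁ u))
        ≤⟨ scale 0≤R (E-bound λ₁ λ₂ M d young) ⟩
      R * (λ₁ * E M + λ₂ * E d)
        ≤⟨ scale 0≤R (by (0≤λ₁ ⊗ gap E-M) (lemma₅ λ₁ (E M) (C₆ R) (λ₂ * E d))) ⟩
      R * (λ₁ * C₆ R + λ₂ * E d) ∎
      where
      open ℚ.≤-Reasoning
      Q : ℚ
      Q = ∑₂ (λ p → ∑₂ (λ p′ → disjoint p p′ * (e p * e p′)))
      M : U → ℚ
      M u = (f u * f u + (f u - 1ℚ) * (f u - 1ℚ)) * (S₁ u * S₁ u)
      lemma₁ = solve 4 (λ v d x y → d :* (v :* x :* (v :* y)) := v :* v :* (d :* (x :* y))) refl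
      lemma₂ = solve 4 (λ R r v q → R :* r :* (v :* q) := R :* (v :* (r :* q))) refl
      lemma₃ = solve 2 (λ v x → v :* (con (# 2) :* x) := con (# 2) :* v :* x) refl
      lemma₄ = solve 3 (λ g v s → con (# 2) :* v :* (g :* s) := con (# 2) :* (g :* (v :* s))) refl
      lemma₅ = solve 4 (λ l x y z → (l :* y :+ z) :- (l :* x :+ z) := l :* (y :- x)) refl
      -- AM-GM, weighted so that the small factor is whichever of f, f − 1 realises the distance.
      young : ∀ u → # 2 * (G (f u) * S₁ u) ≤ λ₁ * M u + λ₂ * d u
      young u with dist²-attained (f u)
      ... | false , e₀ = by (0≤λ₁ ⊗ sq ((f u - 1ℚ) * S₁ u - λ₂ * f u) ⊕ 0≤λ₁ ⊗ sq (f u * S₁ u))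
        (trans (trans (cong (λ z → (λ₁ * M u + λ₂ * z) - # 2 * (G (f u) * S₁ u)) e₀)
           (trans (lemma λ₁ λ₂ (f u) (S₁ u)) (cong (λ z → (λ₁ * M u + z * λ₂ * (f u * f u)) - # 2 * z * (G (f u) * S₁ u))
               (sym λλ))))
           (lemma′ λ₁ λ₂ (f u) (S₁ u)))
        where
        lemma = solve 4 (λ l k x s → (l :* ((x :* x :+ (x :- con 1ℚ) :* (x :- con 1ℚ)) :* (s :* s)) :+ k :*
            ((x :- con 0ℚ) :* (x :- con 0ℚ))) :- con (# 2) :* ((x :* x :- x) :* s)
          := (l :* ((x :* x :+ (x :- con 1ℚ) :* (x :- con 1ℚ)) :* (s :* s)) :+ con 1ℚ :* k :* (x :* x)) :- con
              (# 2) :* con 1ℚ :* ((x :* x :- x) :* s)) refl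
        lemma′ = solve 4 (λ l k x s → (l :* ((x :* x :+ (x :- con 1ℚ) :* (x :- con 1ℚ)) :* (s :* s)) :+ l :* k :* k :*
            (x :* x)) :- con (# 2) :* (l :* k) :* ((x :* x :- x) :* s)
          := l :* (((x :- con 1ℚ) :* s :- k :* x) :* ((x :- con 1ℚ) :* s :- k :* x)) :+ l :* (x :* s :* (x :* s))) refl
      ... | true , e₁ = by (0≤λ₁ ⊗ sq (f u * S₁ u - λ₂ * (f u - 1ℚ)) ⊕ 0≤λ₁ ⊗ sq ((f u - 1ℚ) * S₁ u))
        (trans (trans (cong (λ z → (λ₁ * M u + λ₂ * z) - # 2 * (G (f u) * S₁ u)) e₁)
           (trans (lemma λ₁ λ₂ (f u) (S₁ u))
               (cong (λ z → (λ₁ * M u + z * λ₂ * ((f u - 1ℚ) * (f u - 1ℚ))) - # 2 * z * (G (f u) * S₁ u)) (sym λλ))))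
           (lemma′ λ₁ λ₂ (f u) (S₁ u)))
        where
        lemma = solve 4 (λ l k x s → (l :* ((x :* x :+ (x :- con 1ℚ) :* (x :- con 1ℚ)) :* (s :* s)) :+ k :*
            ((x :- con 1ℚ) :* (x :- con 1ℚ))) :- con (# 2) :* ((x :* x :- x) :* s)
          := (l :* ((x :* x :+ (x :- con 1ℚ) :* (x :- con 1ℚ)) :* (s :* s)) :+ con 1ℚ :* k :* ((x :- con 1ℚ) :* (x :- con 1ℚ)))
              :- con (# 2) :* con 1ℚ :* ((x :* x :- x) :* s)) refl
        lemma′ = solve 4 (λ l k x s → (l :* ((x :* x :+ (x :- con 1ℚ) :* (x :- con 1ℚ)) :* (s :* s)) :+ l :* k :* k :*
            ((x :- con 1ℚ) :* (x :- con 1ℚ))) :- con (# 2) :* (l :* k) :* ((x :* x :- x) :* s)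
          := l :* ((x :* s :- k :* (x :- con 1ℚ)) :* (x :* s :- k :* (x :- con 1ℚ))) :+ l :*
              ((x :- con 1ℚ) :* s :* ((x :- con 1ℚ) :* s))) refl
      V≤4 : V ≤ # 4
      V≤4 = ℚ.≤-trans (by (sq μ) (lemma (μ * μ) V)) (subst (_≤ # 4) E-f² m≤4)
        where
        lemma = solve 2 (λ x v → (x :+ v) :- v := x) refl
      μ²≤4 : μ * μ ≤ # 4
      μ²≤4 = ℚ.≤-trans (by V≥0 (lemma (μ * μ) V)) (subst (_≤ # 4) E-f² m≤4)
        where
        lemma = solve 2 (λ x v → (x :+ v) :- x := v) refl
      V²≤16 : V * V ≤ # 16
      V²≤16 = by (gap V≤4 ⊗ (V≥0 ⊕ #-nonneg 4)) (lemma V)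
        where
        lemma = solve 1 (λ v → con (# 16) :- v :* v := (con (# 4) :- v) :* (v :+ con (# 4))) refl
      V³≤64 : V * V * V ≤ # 64
      V³≤64 = by (#-nonneg 16 ⊗ gap V≤4 ⊕ V≥0 ⊗ gap V²≤16) (lemma V)
        where
        lemma = solve 1 (λ v → con (# 64) :- v :* v :* v := con (# 16) :* (con (# 4) :- v) :+ v :* (con (# 16) :- v :* v)) refl
      h⁴ h⁶ : U → ℚ
      h⁴ u = h u * (h u * h u * h u)
      h⁶ u = h u * (h u * h u * h u * h u * h u)
      S-bound : ∀ u → S₁ u * S₁ u ≤ # 32 * h⁴ u + # 8192 * (R * R)
      S-bound u = ℚ.≤-trans (S₁-bound u) (by (#-nonneg 512 ⊗ (0≤R ⊗ 0≤R) ⊗ gap V²≤16) (lemma (h⁴ u) (R * R) (V * V)))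
        where
        lemma = solve 3 (λ x y v → (con (# 32) :* x :+ con (# 8192) :* y) :- (con (# 32) :* x :+ con (# 512) :* y :* v) := con
            (# 512) :* y :* (con (# 16) :- v)) refl
      f-bound : ∀ u → f u * f u + (f u - 1ℚ) * (f u - 1ℚ) ≤ # 26 + # 6 * (h u * h u)
      f-bound u = by (#-nonneg 6 ⊗ gap μ²≤4 ⊕ sq (f u + 1ℚ) ⊕ #-nonneg 3 ⊗ sq (f u - μ - μ)) (lemma (f u) μ)
        where
        lemma = solve 2 (λ f m → (con (# 26) :+ con (# 6) :* ((f :- m) :* (f :- m))) :- (f :* f :+ (f :- con 1ℚ) :* (f :- con 1ℚ))
          := con (# 6) :* (con (# 4) :- m :* m) :+ (f :+ con 1ℚ) :* (f :+ con 1ℚ) :+ con (# 3) :*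
              ((f :- m :- m) :* (f :- m :- m))) refl
      -- The product of `f-bound` and `S-bound`: 832 = 26 · 32, 192 = 6 · 32, 49152 = 6 · 8192,
      -- 212992 = 26 · 8192. With `V≤4` and the moments of `h` this becomes `C₆ R`, where 39936 =
      -- 832 · 3 · 16 and 593920 = 192 · 15 · 64 + 49152 · 4 + 212992.
      M-bound : ∀ u → M u ≤ (# 832 * h⁴ u + # 192 * h⁶ u) + (# 49152 * (R * R) * (h u * h u) + # 212992 * (R * R))
      M-bound u = by (gap (f-bound u) ⊗ sq (S₁ u) ⊕ (#-nonneg 26 ⊕ #-nonneg 6 ⊗ sq (h u)) ⊗ gap (S-bound u))
        (lemma (f u * f u + (f u - 1ℚ) * (f u - 1ℚ)) (S₁ u * S₁ u) (h u) (R * R))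
        where
        lemma = solve 4 (λ x s h R → ((con (# 832) :* (h :* (h :* h :* h)) :+ con (# 192) :* (h :* (h :* h :* h :* h :* h))) :+
            (con (# 49152) :* R :* (h :* h) :+ con (# 212992) :* R)) :- x :* s
          := ((con (# 26) :+ con (# 6) :* (h :* h)) :- x) :* s :+ (con (# 26) :+ con (# 6) :* (h :* h)) :*
              ((con (# 32) :* (h :* (h :* h :* h)) :+ con (# 8192) :* R) :- s)) refl
      E-M : E M ≤ C₆ R
      E-M = begin
        E M
          ≤⟨ E.mono M-bound ⟩
        E (λ u → (# 832 * h⁴ u + # 192 * h⁶ u) + (# 49152 * (R * R) * (h u * h u) + # 212992 * (R * R)))
          ≡⟨ trans (E.+-hom (λ u → # 832 * h⁴ u + # 192 * h⁶ u) (λ u → # 49152 * (R * R) * (h u * h u) + # 212992 * (R * R)))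
               (cong₂ _+_ (E.combine (# 832) (# 192) h⁴ h⁶)
                 (trans (E.+-hom (λ u → # 49152 * (R * R) * (h u * h u)) (λ _ → # 212992 * (R * R)))
                   (cong₂ _+_ (E.*-hom (# 49152 * (R * R)) (λ u → h u * h u)) (E-const (# 212992 * (R * R)))))) ⟩
        (# 832 * E h⁴ + # 192 * E h⁶) + (# 49152 * (R * R) * V + # 212992 * (R * R))
          ≤⟨ by ( #-nonneg 832 ⊗ gap fourth-moment ⊕ #-nonneg 192 ⊗ gap sixth-moment
                ⊕ #-nonneg 832 ⊗ (#-nonneg 3 ⊗ 0≤R) ⊗ gap V²≤16 ⊕ #-nonneg 192 ⊗ (#-nonneg 15 ⊗ (0≤R ⊗ 0≤R)) ⊗ gap V³≤64
                ⊕ #-nonneg 49152 ⊗ (0≤R ⊗ 0≤R) ⊗ gap V≤4)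
                (lemma (E h⁴) (E h⁶) V R) ⟩
        C₆ R ∎
        where
        lemma = solve 4 (λ a b v R → (con (# 39936) :* R :+ con (# 593920) :* (R :* R)) :-
            ((con (# 832) :* a :+ con (# 192) :* b) :+ (con (# 49152) :* (R :* R) :* v :+ con (# 212992) :* (R :* R)))
          := con (# 832) :* (con (# 3) :* R :* (v :* v) :- a) :+ con (# 192) :* (con (# 15) :* R :* R :* (v :* v :* v) :- b)
          :+ con (# 832) :* (con (# 3) :* R) :* (con (# 16) :- v :* v) :+ con (# 192) :* (con (# 15) :* (R :* R)) :*
              (con (# 64) :- v :* v :* v)
          :+ con (# 49152) :* (R :* R) :* (con (# 4) :- v)) refl

    e≤ : ∀ p → e p ≤ # 4 * m
    e≤ p@(j , k) = ℚ.≤-trans (E.mono pointwise)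
        (ℚ.≤-reflexive (trans (E.combine (# 2) (# 2) (λ u → f u * f u) (λ u → f (σ p u) * f (σ p u)))
      (trans (cong (λ z → # 2 * m + # 2 * z) (E-swap j k (λ u → f u * f u))) (lemma₂ m))))
      where
      lemma₁ = solve 2 (λ x a → (con (# 2) :* (x :* x) :+ con (# 2) :* ((x :- a) :* (x :- a))) :- a :* a := (x :+ (x :- a)) :*
          (x :+ (x :- a))) refl
      lemma₂ = solve 1 (λ m → con (# 2) :* m :+ con (# 2) :* m := con (# 4) :* m) refl
      pointwise : ∀ u → α p u * α p u ≤ # 2 * (f u * f u) + # 2 * (f (σ p u) * f (σ p u))
      pointwise u = by (sq (f u + (f u - α p u)))
        (trans (cong (λ z → (# 2 * (f u * f u) + # 2 * (z * z)) - α p u * α p u) (f-swap p u)) (lemma₁ (f u) (α p u)))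

    -- Averaging f over the transpositions that fix j₀ leaves a function θ of the letter at j₀ alone.
    module Centre (j₀ : Fin n) (ν₁ : ℚ) (ν₁-inverse : ν₁ * (# n - 1ℚ) ≡ 1ℚ) where

      ω : Fin n → ℚ
      ω j = 1ℚ - δ j₀ j

      B : ℚ
      B = ∑ (λ j → ω j * ∑ (λ a → κ a * φ j a))

      -- The conditional mean of `f` given the letter `a` at `j₀`. One occurrence of `a` is then
      -- used up, so the other n - 1 positions share the remaining letters; hence the subtracted sum
      -- and the factor `ν₁`.
      θ : Fin ℓ → ℚ
      θ a = c + φ j₀ a + ν₁ * (B - ∑ (λ j → ω j * φ j a))

      H : U → ℚ
      H u = ½ * ν₁ * ∑₂ (λ p → avoids j₀ p * α p u)

      ∑-ω : ∀ g → ∑ (λ j → ω j * g j) ≡ ∑ g - g j₀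
      ∑-ω g = trans (∑.congr (λ j → lemma (δ j₀ j) (g j)))
          (trans (∑.minus g (λ j → δ j₀ j * g j)) (cong (λ z → ∑ g - z) (∑-δˡ j₀ g)))
        where
        lemma = solve 2 (λ d x → (con 1ℚ :- d) :* x := x :- d :* x) refl

      ∑ω : ∑ ω ≡ # n - 1ℚ
      ∑ω = trans (∑.congr (λ j → sym (ℚ.*-identityʳ (ω j))))
          (trans (∑-ω (λ _ → 1ℚ)) (cong (λ z → z - 1ℚ) (trans (∑-const {n} 1ℚ) (ℚ.*-identityʳ (# n)))))

      f-split : ∀ u → f u ≡ θ (at u j₀) + H u
      f-split u = sym (begin
        θ a + ½ * ν₁ * ∑₂ (λ p → avoids j₀ p * α p u)
          ≡⟨ cong (λ z → θ a + ½ * ν₁ * z) (∑₂-α ω u) ⟩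
        θ a + ½ * ν₁ * (# 2 * (∑ ω * ∑ (λ j → ω j * φ j (at u j)) - ∑ (λ j → ω j * ∑ (λ k → ω k * φ j (at u k)))))
          ≡⟨ cong (λ z → θ a + ½ * ν₁ * (# 2 * z)) (cong₂ _-_ (cong₂ _*_ ∑ω (∑-ω (λ j → φ j (at u j)))) inner) ⟩
        θ a + ½ * ν₁ * (# 2 * ((# n - 1ℚ) * (X - φ j₀ a) - (B - D)))
          ≡⟨ lemma₁ c (φ j₀ a) ν₁ B D (# n) X ⟩
        (c + φ j₀ a) + (ν₁ * (# n - 1ℚ)) * (X - φ j₀ a)
          ≡⟨ cong (λ z → (c + φ j₀ a) + z * (X - φ j₀ a)) ν₁-inverse ⟩
        (c + φ j₀ a) + 1ℚ * (X - φ j₀ a)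
          ≡⟨ lemma₂ c (φ j₀ a) X ⟩
        f u ∎)
        where
        open ≡-Reasoning
        a : Fin ℓ
        a = at u j₀
        X D : ℚ
        X = ∑ (λ j → φ j (at u j))
        D = ∑ (λ j → ω j * φ j a)
        inner : ∑ (λ j → ω j * ∑ (λ k → ω k * φ j (at u k))) ≡ B - D
        inner = trans (∑.congr (λ j → trans
            (cong (λ z → ω j * z) (trans (∑-ω (λ k → φ j (at u k))) (cong (λ z → z - φ j a) (∑-at (φ j) u))))
            (lemma (ω j) (∑ (λ a → κ a * φ j a)) (φ j a))))
          (∑.minus (λ j → ω j * ∑ (λ a → κ a * φ j a)) (λ j → ω j * φ j a))
          where
          lemma = solve 3 (λ w x y → w :* (x :- y) := w :* x :- w :* y) refl
        lemma₁ = solve 7 (λ c y v B D n X → (c :+ y :+ v :* (B :- D)) :+ con ½ :* v :*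
            (con (# 2) :* ((n :- con 1ℚ) :* (X :- y) :- (B :- D))) := (c :+ y) :+ (v :* (n :- con 1ℚ)) :* (X :- y)) refl
        lemma₂ = solve 3 (λ c y x → (c :+ y) :+ con 1ℚ :* (x :- y) := c :+ x) refl

      -- A swap away from `j₀` leaves `θ` alone, so `H` changes exactly as `f` does. This is the
      -- hypothesis of `by-parts`.
      H-swap : ∀ {j k} → j₀ ≢ j → j₀ ≢ k → ∀ u → H (swap j k u) ≡ H u - α (j , k) u
      H-swap {j} {k} j₀≢j j₀≢k u = begin
        H (swap j k u)
          ≡⟨ lemma₁ (θ a′) (H (swap j k u)) ⟩
        (θ a′ + H (swap j k u)) - θ a′
          ≡⟨ cong₂ _-_ (trans (sym (f-split (swap j k u))) (f-swap (j , k) u)) (cong θ (at-swap-≢ j k u j₀≢j j₀≢k)) ⟩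
        (f u - α (j , k) u) - θ (at u j₀)
          ≡⟨ cong (λ z → (z - α (j , k) u) - θ (at u j₀)) (f-split u) ⟩
        (θ (at u j₀) + H u - α (j , k) u) - θ (at u j₀)
          ≡⟨ lemma₂ (θ (at u j₀)) (H u) (α (j , k) u) ⟩
        H u - α (j , k) u ∎
        where
        open ≡-Reasoning
        a′ : Fin ℓ
        a′ = at (swap j k u) j₀
        lemma₁ = solve 2 (λ x y → y := (x :+ y) :- x) refl
        lemma₂ = solve 3 (λ x y z → (x :+ y :- z) :- x := y :- z) refl

      -- `H` is an eigenvector of the walk on the n - 1 positions other than `j₀`. Integration by
      -- parts there turns its second moment into the weight outside the star of `j₀`, which `light`
      -- makes small.
      E-H² : # 4 * E (λ u → H u * H u) ≡ ν₁ * ∑₂ (λ p → avoids j₀ p * e p)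
      E-H² = begin
        # 4 * E (λ u → H u * H u)
          ≡⟨ cong (λ z → # 4 * z) (E.congr
              (λ u → trans (lemma₁ ν₁ (A u) (H u))
              (cong (λ z → ½ * ν₁ * z) (sym (∑₂.*-homʳ (H u) (λ p → avoids j₀ p * α p u)))))) ⟩
        # 4 * E (λ u → ½ * ν₁ * ∑₂ (λ p → avoids j₀ p * α p u * H u))
          ≡⟨ cong (λ z → # 4 * z) (trans (E.*-hom (½ * ν₁) (λ u → ∑₂ (λ p → avoids j₀ p * α p u * H u)))
               (cong (λ z → ½ * ν₁ * z) (functional-∑₂ E-lin (λ p u → avoids j₀ p * α p u * H u)))) ⟩
        # 4 * (½ * ν₁ * ∑₂ (λ p → E (λ u → avoids j₀ p * α p u * H u)))
          ≡⟨ trans (lemma₂ ν₁ (∑₂ (λ p → E (λ u → avoids j₀ p * α p u * H u))))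
              (cong (λ z → ν₁ * z) (sym (∑₂.*-hom (# 2) (λ p → E (λ u → avoids j₀ p * α p u * H u))))) ⟩
        ν₁ * ∑₂ (λ p → # 2 * E (λ u → avoids j₀ p * α p u * H u))
          ≡⟨ cong (λ z → ν₁ * z) (∑₂.congr term) ⟩
        ν₁ * ∑₂ (λ p → avoids j₀ p * e p) ∎
        where
        open ≡-Reasoning
        A : U → ℚ
        A u = ∑₂ (λ p → avoids j₀ p * α p u)
        lemma₁ = solve 3 (λ v a x → con ½ :* v :* a :* x := con ½ :* v :* (a :* x)) refl
        lemma₂ = solve 2 (λ v x → con (# 4) :* (con ½ :* v :* x) := v :* (con (# 2) :* x)) refl
        lemma₃ = solve 2 (λ a y → con 0ℚ :* a :* y := con 0ℚ :* (a :* y)) refl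
        lemma₄ = solve 1 (λ x → con (# 2) :* x := x :+ x) refl
        lemma₅ = solve 2 (λ x a → x :- (x :- a) := a) refl
        term : ∀ p → # 2 * E (λ u → avoids j₀ p * α p u * H u) ≡ avoids j₀ p * e p
        term p@(j , k) with avoids-or-hits j₀ j k
        ... | inj₁ z≡0 = trans
          (cong (λ z → # 2 * z) (trans (E.congr (λ u → trans (cong (λ z → z * α p u * H u) z≡0) (lemma₃ (α p u) (H u))))
              (E.*-hom 0ℚ (λ u → α p u * H u))))
          (trans (lemma (E (λ u → α p u * H u)) (e p)) (cong (λ z → z * e p) (sym z≡0)))
          where
          lemma = solve 2 (λ x y → con (# 2) :* (con 0ℚ :* x) := con 0ℚ :* y) refl
        ... | inj₂ (j₀≢j , j₀≢k , z≡1) = begin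
          # 2 * E (λ u → avoids j₀ p * α p u * H u)
            ≡⟨ cong (λ z → # 2 * z) (E.congr
                (λ u → trans (cong (λ z → z * α p u * H u) z≡1) (cong (λ z → z * H u) (ℚ.*-identityˡ (α p u))))) ⟩
          # 2 * E (λ u → α p u * H u)
            ≡⟨ lemma₄ (E (λ u → α p u * H u)) ⟩
          E (λ u → α p u * H u) + E (λ u → α p u * H u)
            ≡⟨ by-parts p H (H-swap j₀≢j j₀≢k) (λ x → x) ⟩
          E (λ u → α p u * (H u - (H u - α p u)))
            ≡⟨ E.congr (λ u → cong (λ z → α p u * z) (lemma₅ (H u) (α p u))) ⟩
          e p
            ≡⟨ trans (sym (ℚ.*-identityˡ (e p))) (cong (λ z → z * e p) (sym z≡1)) ⟩
          avoids j₀ p * e p ∎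

      -- Let `b` be the bit nearest to `f` and `g` the bit nearest to `θ`. Then (f - g)² ≤ 2H² + 2(θ
      -- - g)², and (θ - g)² ≤ (θ - b)² ≤ 2H² + 2(f - b)².
      rounding : E (λ u → (f u - bit (round (θ (at u j₀)))) * (f u - bit (round (θ (at u j₀))))) ≤ # 6 * E
          (λ u → H u * H u) + # 4 * E d
      rounding = E-bound (# 6) (# 4) (λ u → H u * H u) d pointwise
        where
        pointwise : ∀ u → (f u - bit (round (θ (at u j₀)))) * (f u - bit (round (θ (at u j₀)))) ≤ # 6 * (H u * H u) + # 4 * d u
        pointwise u = goal (dist²-attained (f u))
          where
          x : ℚ
          x = θ (at u j₀)
          H≡ : H u ≡ f u - x
          H≡ = trans (lemma₁ x (H u)) (cong (λ z → z - x) (sym (f-split u)))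
            where
            lemma₁ = solve 2 (λ x y → y := (x :+ y) :- x) refl
          goal : Σ[ b ∈ Bool ] d u ≡ (f u - bit b) * (f u - bit b) →
                 (f u - bit (round x)) * (f u - bit (round x)) ≤ # 6 * (H u * H u) + # 4 * d u
          goal (b , e₀) = subst₂ (λ y z → (f u - bit (round x)) * (f u - bit (round x)) ≤ # 6 * (y * y) + # 4 * z) (sym H≡)
              (sym e₀)
            (by (#-nonneg 2 ⊗ gap (proj₂ (nearest x) b) ⊕ sq (f u - x - (x - bit (round x))) ⊕ #-nonneg 2 ⊗ sq
                (f u - bit b + (f u - x)))
              (lemma₂ (f u) x (bit (round x)) (bit b)))
            where
            lemma₂ = solve 4 (λ f t g b → (con (# 6) :* ((f :- t) :* (f :- t)) :+ con (# 4) :* ((f :- b) :* (f :- b))) :-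
                (f :- g) :* (f :- g)
              := con (# 2) :* (((t :- b) :* (t :- b)) :- ((t :- g) :* (t :- g)))
              :+ (f :- t :- (t :- g)) :* (f :- t :- (t :- g)) :+ con (# 2) :* ((f :- b :+ (f :- t)) :* (f :- b :+ (f :- t)))) refl

  -- Bootstrapping

  -- If `b` is not a nearest bit, then t = x - b has absolute value at least ½, and t² ≤ 4t⁴. The
  -- `y` of the certificates is 2|t| - 1, for which 4t² - 1 = y² + 2y.
  sq-dist-≤ : ∀ x b → (x - bit b) * (x - bit b) ≤ dist² x + # 4 * ((x - bit b) * (x - bit b) * ((x - bit b) * (x - bit b)))
  sq-dist-≤ x b with dist²-attained x
  ... | b′ , e = go b b′ e (dist²≤ x b)
    where
    same : ∀ b → dist² x ≡ (x - bit b) * (x - bit b) → (x - bit b) * (x - bit b) ≤ dist² x + # 4 *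
        ((x - bit b) * (x - bit b) * ((x - bit b) * (x - bit b)))
    same b e = by (#-nonneg 4 ⊗ sq ((x - bit b) * (x - bit b)))
      (trans (cong (λ z → (dist² x + # 4 * ((x - bit b) * (x - bit b) * ((x - bit b) * (x - bit b)))) - z) (sym e))
          (lemma (dist² x) (# 4 * ((x - bit b) * (x - bit b) * ((x - bit b) * (x - bit b))))))
      where
      lemma = solve 2 (λ x y → (x :+ y) :- x := y) refl
    go : ∀ b b′ → dist² x ≡ (x - bit b′) * (x - bit b′) → dist² x ≤ (x - bit b) * (x - bit b) →
         (x - bit b) * (x - bit b) ≤ dist² x + # 4 * ((x - bit b) * (x - bit b) * ((x - bit b) * (x - bit b)))
    go false false e _ = same false e
    go true  true  e _ = same true e
    go false true  e p = by (dist²≥0 x ⊕ sq (x - 0ℚ) ⊗ (sq y ⊕ #-nonneg 2 ⊗ y≥0)) (lemma₂ (dist² x) x)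
      where
      y = (x - 0ℚ) * (x - 0ℚ) - (x - 1ℚ) * (x - 1ℚ)
      y≥0 : 0ℚ ≤ y
      y≥0 = gap (subst (_≤ (x - 0ℚ) * (x - 0ℚ)) e p)
      lemma₂ = solve 2 (λ d x → (d :+ con (# 4) :* ((x :- con 0ℚ) :* (x :- con 0ℚ) :* ((x :- con 0ℚ) :* (x :- con 0ℚ)))) :-
          (x :- con 0ℚ) :* (x :- con 0ℚ)
        := d :+ (x :- con 0ℚ) :* (x :- con 0ℚ) :* (((x :- con 0ℚ) :* (x :- con 0ℚ) :- (x :- con 1ℚ) :* (x :- con 1ℚ)) :*
            ((x :- con 0ℚ) :* (x :- con 0ℚ) :- (x :- con 1ℚ) :* (x :- con 1ℚ)) :+ con (# 2) :*
            ((x :- con 0ℚ) :* (x :- con 0ℚ) :- (x :- con 1ℚ) :* (x :- con 1ℚ)))) refl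
    go true  false e p = by (dist²≥0 x ⊕ sq (x - 1ℚ) ⊗ (sq y ⊕ #-nonneg 2 ⊗ y≥0)) (lemma₂ (dist² x) x)
      where
      y = (x - 1ℚ) * (x - 1ℚ) - (x - 0ℚ) * (x - 0ℚ)
      y≥0 : 0ℚ ≤ y
      y≥0 = gap (subst (_≤ (x - 1ℚ) * (x - 1ℚ)) e p)
      lemma₂ = solve 2 (λ d x → (d :+ con (# 4) :* ((x :- con 1ℚ) :* (x :- con 1ℚ) :* ((x :- con 1ℚ) :* (x :- con 1ℚ)))) :-
          (x :- con 1ℚ) :* (x :- con 1ℚ)
        := d :+ (x :- con 1ℚ) :* (x :- con 1ℚ) :* (((x :- con 1ℚ) :* (x :- con 1ℚ) :- (x :- con 0ℚ) :* (x :- con 0ℚ)) :*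
            ((x :- con 1ℚ) :* (x :- con 1ℚ) :- (x :- con 0ℚ) :* (x :- con 0ℚ)) :+ con (# 2) :*
            ((x :- con 1ℚ) :* (x :- con 1ℚ) :- (x :- con 0ℚ) :* (x :- con 0ℚ)))) refl

  module FKN {n ℓ : ℕ} (S : Space n ℓ) (r R ν : ℚ) (0<r : 0ℚ < r) (Rr² : R * (r * r) ≡ 1ℚ) (0≤R : 0ℚ ≤ R)
    (0<n : 0ℚ < # n) (nν : # n * ν ≡ 1ℚ) (κ-lower : ∀ a → # n * r + # 3 ≤ Space.κ S a) where

    open Mixing S r R ν 0<r Rr² 0≤R 0<n nν κ-lower

    C : ℚ
    C = # 8 + # 24 * R

    distance : (U → ℚ) → ℚ
    distance f = E (λ u → dist² (f u))

    distance≥0 : ∀ f → 0ℚ ≤ distance f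
    distance≥0 f = E.nonneg (λ u → dist²≥0 (f u))

    error : (U → ℚ) → Fin n → (Fin ℓ → Bool) → ℚ
    error f j γ = E (λ u → (f u - bit (γ (at u j))) * (f u - bit (γ (at u j))))

    norm-bound : ∀ f → E (λ u → f u * f u) ≤ # 2 * distance f + # 2
    norm-bound f = E-bound-const (# 2) (λ u → dist² (f u)) (# 2) pointwise
      where
      lemma₀ = solve 1 (λ x → (con (# 2) :* ((x :- con 0ℚ) :* (x :- con 0ℚ)) :+ con (# 2)) :- x :* x := x :* x :+ con (# 2)) refl
      lemma₁ = solve 1 (λ x → (con (# 2) :* ((x :- con 1ℚ) :* (x :- con 1ℚ)) :+ con (# 2)) :- x :* x := (x :- con (# 2)) :*
          (x :- con (# 2))) refl
      pointwise : ∀ u → f u * f u ≤ # 2 * dist² (f u) + # 2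
      pointwise u with dist²-attained (f u)
      ... | false , e = by (sq (f u) ⊕ #-nonneg 2) (trans (cong (λ z → (# 2 * z + # 2) - f u * f u) e) (lemma₀ (f u)))
      ... | true  , e = by (sq (f u - # 2)) (trans (cong (λ z → (# 2 * z + # 2) - f u * f u) e) (lemma₁ (f u)))

    module _ (c : ℚ) (φ : Fin n → Fin ℓ → ℚ) where

      open Moments c φ using (f; e; e≥0)
      open Dictator S r R ν 0<r Rr² 0≤R 0<n nν κ-lower c φ using (d; 0≤ν; t; energy; e≤; module Centre)

      dictator : ∀ {λ₁ λ₂ η} → 0ℚ ≤ λ₁ → 0ℚ ≤ λ₂ → λ₁ * λ₂ ≡ 1ℚ → 0ℚ < η → E (λ u → f u * f u) ≤ # 4 →
                 R * (λ₁ * C₆ R + λ₂ * E d) ≤ pos 1 / 8 * (η * η) → # 512 * ν ≤ η → # 2 ≤ # n → Fin n →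
                 Σ[ j ∈ Fin n ] Σ[ γ ∈ (Fin ℓ → Bool) ] error f j γ ≤ # 3 * η + # 4 * distance f
      dictator {λ₁} {λ₂} {η} 0≤λ₁ 0≤λ₂ λλ 0<η m≤4 small ν-small 2≤n i = j , (λ a → round (θ a)) , bound
        where
        t-sym : ∀ j k → t (j , k) ≡ t (k , j)
        t-sym j k = cong (λ z → ν * z) (E.congr
            (λ u → cong (λ z → z * z) (lemma (φ j (at u j)) (φ j (at u k)) (φ k (at u j)) (φ k (at u k)))))
          where
          lemma = solve 4 (λ a b c d → a :- b :+ (d :- c) := d :- c :+ (a :- b)) refl
        t≤ : ∀ p → t p ≤ # 16 * ν
        t≤ p = by (0≤ν ⊗ (gap (e≤ p) ⊕ #-nonneg 4 ⊗ gap m≤4)) (lemma ν (e p) (E (λ u → f u * f u)))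
          where
          lemma = solve 3 (λ v e m → con (# 16) :* v :- v :* e := v :* ((con (# 4) :* m :- e) :+ con (# 4) :* (con (# 4) :- m)))
              refl
        -- 512 = 32 · 16, where 16 bounds every `e p` by `e≤` and `m≤4`.
        ξ≤η : # 32 * (# 16 * ν) ≤ η
        ξ≤η = subst (_≤ η) (lemma ν) ν-small
          where
          lemma = solve 1 (λ v → con (# 512) :* v := con (# 32) :* (con (# 16) :* v)) refl
        open Star t (λ p → 0≤ν ⊗ e≥0 p) t-sym (# 16 * ν) η (#-nonneg 16 ⊗ 0≤ν) 0<η t≤ ξ≤η
          (ℚ.≤-trans (energy 0≤λ₁ 0≤λ₂ λλ m≤4) small) i using (T; light)
        j : Fin n
        j = proj₁ light
        0<n-1 : 0ℚ < # n - 1ℚ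
        0<n-1 = ℚ.<-≤-trans (#-pos 0) (by (gap 2≤n) (lemma (# n)))
          where
          lemma = solve 1 (λ n → (n :- con 1ℚ) :- con (# 1) := n :- con (# 2)) refl
        ν₁ : ℚ
        ν₁ = proj₁ (inverse 0<n-1)
        0≤ν₁ : 0ℚ ≤ ν₁
        0≤ν₁ = ℚ.<⇒≤ (proj₁ (proj₂ (inverse 0<n-1)))
        ν₁-inverse : ν₁ * (# n - 1ℚ) ≡ 1ℚ
        ν₁-inverse = trans (ℚ.*-comm ν₁ (# n - 1ℚ)) (proj₂ (proj₂ (inverse 0<n-1)))
        open Centre j ν₁ ν₁-inverse using (θ; H; E-H²; rounding)
        T≡ : T j ≡ ν * ∑₂ (λ p → avoids j p * e p)
        T≡ = trans (∑₂.congr (λ p → lemma (avoids j p) ν (e p))) (∑₂.*-hom ν (λ p → avoids j p * e p))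
          where
          lemma = solve 3 (λ a v e → a :* (v :* e) := v :* (a :* e)) refl
        -- `T j` is normalised by `ν` and `E-H²` by `ν₁`; the quotient n/(n - 1) is at most 2.
        H-bound : # 4 * E (λ u → H u * H u) ≤ # 2 * η
        H-bound = begin
          # 4 * E (λ u → H u * H u)
            ≡⟨ E-H² ⟩
          ν₁ * A
            ≡⟨ trans (lemma₁ ν₁ A) (cong (λ z → ν₁ * (z * A)) (sym nν)) ⟩
          ν₁ * (# n * ν * A)
            ≡⟨ trans (lemma₂ ν₁ (# n) ν A) (cong (λ z → ν₁ * # n * z) (sym T≡)) ⟩
          ν₁ * # n * T j
            ≤⟨ by (0≤ν₁ ⊗ gap 2≤n ⊗ T≥0) (trans (cong (λ z → # 2 * z * T j - ν₁ * # n * T j) (sym ν₁-inverse))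
                (lemma₃ ν₁ (# n) (T j))) ⟩
          # 2 * 1ℚ * T j
            ≤⟨ by (#-nonneg 2 ⊗ gap (proj₂ light)) (lemma₄ η (T j)) ⟩
          # 2 * η ∎
          where
          open ℚ.≤-Reasoning
          A : ℚ
          A = ∑₂ (λ p → avoids j p * e p)
          T≥0 : 0ℚ ≤ T j
          T≥0 = ∑₂.nonneg (λ p → avoids≥0 j p ⊗ (0≤ν ⊗ e≥0 p))
          lemma₁ = solve 2 (λ v a → v :* a := v :* (con 1ℚ :* a)) refl
          lemma₂ = solve 4 (λ v n w a → v :* (n :* w :* a) := v :* n :* (w :* a)) refl
          lemma₃ = solve 3 (λ v n t → con (# 2) :* (v :* (n :- con 1ℚ)) :* t :- v :* n :* t := v :* (n :- con (# 2)) :* t) refl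
          lemma₄ = solve 2 (λ e t → con (# 2) :* e :- con (# 2) :* con 1ℚ :* t := con (# 2) :* (e :- t)) refl
        bound : error f j (λ a → round (θ a)) ≤ # 3 * η + # 4 * distance f
        bound = ℚ.≤-trans rounding (by (#-nonneg 3 ⊗ ℚ.nonNegative⁻¹ ½ ⊗ gap H-bound)
            (lemma (E (λ u → H u * H u)) η (distance f)))
          where
          lemma = solve 3 (λ h e d → (con (# 3) :* e :+ con (# 4) :* d) :- (con (# 6) :* h :+ con (# 4) :* d) := con
              (# 3) :* con ½ :* (con (# 2) :* e :- con (# 4) :* h)) refl

      -- A weak bound improves itself: the fourth moment controls the event that f is nearer to 1 − g than to g.
      bootstrap : ∀ {m₀} j γ → # 8 * C * m₀ ≤ 1ℚ → error f j γ ≤ m₀ →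
                  error f j γ ≤ distance f + # 16 * C * (distance f * distance f)
      bootstrap {m₀} j γ Cm₀ M≤m₀ = by (gap M≤ ⊕ #-nonneg 4 ⊗ C≥0 ⊗ gap M≤2ε ⊗ (#-nonneg 2 ⊗ distance≥0 f ⊕ M≥0))
          (lemma₃ M (distance f) C)
        where
        g : U → ℚ
        g u = bit (γ (at u j))
        -- `g` reads only the letter at `j`, so `f - g` is again of degree 1 and `f⁴-bound` applies
        -- to the error itself.
        φ′ : Fin n → Fin ℓ → ℚ
        φ′ k a = φ k a - δ k j * bit (γ a)
        module D′ = Concentration S r R ν 0<r Rr² 0≤R 0<n nν κ-lower c φ′
        module F′ = Degree1 c φ′
        f′≡ : ∀ u → F′.f u ≡ f u - g u
        f′≡ u = trans (cong (λ z → c + z) (trans (∑.minus (λ k → φ k (at u k)) (λ k → δ k j * bit (γ (at u k))))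
            (cong (λ z → ∑ (λ k → φ k (at u k)) - z) (∑-δ j (λ k → bit (γ (at u k)))))))
          (lemma c (∑ (λ k → φ k (at u k))) (g u))
          where
          lemma = solve 3 (λ c x y → c :+ (x :- y) := (c :+ x) :- y) refl
        M : ℚ
        M = error f j γ
        M≥0 : 0ℚ ≤ M
        M≥0 = E.nonneg (λ u → sq (f u - g u))
        C≥0 : 0ℚ ≤ C
        C≥0 = #-nonneg 8 ⊕ #-nonneg 24 ⊗ 0≤R
        Y : U → ℚ
        Y u = (f u - g u) * (f u - g u) * ((f u - g u) * (f u - g u))
        M≤ : M ≤ distance f + # 4 * (C * (M * M))
        M≤ = begin
          M
            ≤⟨ E-bound 1ℚ (# 4) (λ u → dist² (f u)) Y (λ u → subst (λ z → (f u - g u) * (f u - g u) ≤ z + # 4 * Y u)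
                (sym (ℚ.*-identityˡ (dist² (f u)))) (sq-dist-≤ (f u) (γ (at u j)))) ⟩
          1ℚ * distance f + # 4 * E Y
            ≡⟨ cong₂ (λ x y → x + # 4 * y) (ℚ.*-identityˡ (distance f))
                (E.congr (λ u → cong (λ z → z * z * (z * z)) (sym (f′≡ u)))) ⟩
          distance f + # 4 * E (λ u → F′.f u * F′.f u * (F′.f u * F′.f u))
            ≤⟨ by (#-nonneg 4 ⊗ gap D′.f⁴-bound) (lemma (distance f) (E (λ u → F′.f u * F′.f u * (F′.f u * F′.f u)))
                (C * (D′.m * D′.m))) ⟩
          distance f + # 4 * (C * (D′.m * D′.m))
            ≡⟨ cong (λ z → distance f + # 4 * (C * (z * z))) (E.congr (λ u → cong (λ z → z * z) (f′≡ u))) ⟩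
          distance f + # 4 * (C * (M * M)) ∎
          where
          open ℚ.≤-Reasoning
          lemma = solve 3 (λ d x y → (d :+ con (# 4) :* y) :- (d :+ con (# 4) :* x) := con (# 4) :* (y :- x)) refl
        -- By the choice of `m₀` the quartic term of `M≤` is at most half of `M`. Inserting the
        -- result into `M≤` once more gives the coefficient 16 C.
        M≤2ε : M ≤ # 2 * distance f
        M≤2ε = by (#-nonneg 2 ⊗ gap M≤ ⊕ M≥0 ⊗ (gap Cm₀ ⊕ #-nonneg 8 ⊗ C≥0 ⊗ gap M≤m₀)) (lemma M (distance f) C m₀)
          where
          lemma = solve 4 (λ M d C m → con (# 2) :* d :- M := con (# 2) :* ((d :+ con (# 4) :* (C :* (M :* M))) :- M) :+ M :*
              ((con 1ℚ :- con (# 8) :* C :* m) :+ con (# 8) :* C :* (m :- M))) refl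
        lemma₃ = solve 3 (λ M d C → (d :+ con (# 16) :* C :* (d :* d)) :- M := ((d :+ con (# 4) :* (C :* (M :* M))) :- M) :+ con
            (# 4) :* C :* (con (# 2) :* d :- M) :* (con (# 2) :* d :+ M)) refl

  archimedean : ∀ q → Σ[ N ∈ ℕ ] q ≤ # N
  archimedean q@(ℚ.mkℚ m d _) = ℤ.∣ m ∣ , ℚ.toℚᵘ-cancel-≤ (ℚᵘ.≤-respʳ-≃ (ℚᵘ.≃-sym (ℚ.toℚᵘ-fromℚᵘ (ℚᵘ.mkℚᵘ (pos ℤ.∣ m ∣) 0)))
    (ℚᵘ.*≤* (ℤ.≤-trans (ℤ.≤-reflexive (ℤ.*-identityʳ m))
        (ℤ.≤-trans (i≤∣i∣ m) (subst (pos ℤ.∣ m ∣ ℤ.≤_) (ℤ.pos-* ℤ.∣ m ∣ (suc d)) (ℤ.+≤+ (ℕ.m≤m*n ℤ.∣ m ∣ (suc d))))))))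
    where
    import Data.Rational.Unnormalised.Base as ℚᵘ
    import Data.Rational.Unnormalised.Properties as ℚᵘ
    import Data.Nat.Properties as ℕ
    i≤∣i∣ : ∀ i → i ℤ.≤ pos ℤ.∣ i ∣
    i≤∣i∣ (pos k)      = ℤ.≤-refl
    i≤∣i∣ (ℤ.-[1+ k ]) = ℤ.-≤+

  -- Constants

  -- The choice of j and γ survives small perturbations of f, as is needed for functions known only by approximations.
  record Robust (ρ : ℚ) : Set₁ where
    field
      N      : ℕ
      K      : ℚ
      0≤K    : 0ℚ ≤ K
      m₀     : ℚ
      0<m₀   : 0ℚ < m₀
      ε₁     : ℚ
      0<ε₁   : 0ℚ < ε₁
      robust : ∀ {n ℓ} (S : Space n ℓ) → N ℕ.≤ n → (∀ a → ρ * # n ≤ Space.κ S a) → ∀ c φ →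
               let open Space S; f = Analysis.Degree1.f S c φ in
               Σ[ j ∈ Fin n ] Σ[ γ ∈ (Fin ℓ → Bool) ] ∀ c′ φ′ →
               let f′ = Analysis.Degree1.f S c′ φ′ in
               E (λ u → (f′ u - f u) * (f′ u - f u)) ≤ pos 1 / 4 * m₀ →
               E (λ u → dist² (f u)) ≤ E (λ u → dist² (f′ u)) + ε₁ →
               E (λ u → (f′ u - bit (γ (at u j))) * (f′ u - bit (γ (at u j))))
                 ≤ E (λ u → dist² (f′ u)) + K * (E (λ u → dist² (f′ u)) * E (λ u → dist² (f′ u)))

  module Choice (ρ : ℚ) (0<ρ : 0ℚ < ρ) where

    private
      0<½ : 0ℚ < ½
      0<½ = ℚ.positive⁻¹ ½

      0<⅟ : ∀ k → 0ℚ < pos 1 / suc k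
      0<⅟ k = ℚ.positive⁻¹ (pos 1 / suc k) {{ℚ.normalize-pos 1 (suc k)}}

      _⁻¹[_] : ∀ x → 0ℚ < x → ℚ
      x ⁻¹[ p ] = proj₁ (inverse p)

      ⁻¹-pos : ∀ {x} (p : 0ℚ < x) → 0ℚ < x ⁻¹[ p ]
      ⁻¹-pos p = proj₁ (proj₂ (inverse p))

      ⁻¹-inverse : ∀ {x} (p : 0ℚ < x) → x * x ⁻¹[ p ] ≡ 1ℚ
      ⁻¹-inverse p = proj₂ (proj₂ (inverse p))

      -- The other half of `ρ * # n` absorbs the `# 3` of the lower bound on letter counts, once n ≥
      -- 3/r.
      r : ℚ
      r = ½ * ρ
      0<r : 0ℚ < r
      0<r = 0<½ ⊗⁺ 0<ρ
      R : ℚ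
      R = (r * r) ⁻¹[ 0<r ⊗⁺ 0<r ]
      0<R : 0ℚ < R
      0<R = ⁻¹-pos (0<r ⊗⁺ 0<r)
      0≤R : 0ℚ ≤ R
      0≤R = ℚ.<⇒≤ 0<R
      Rr² : R * (r * r) ≡ 1ℚ
      Rr² = trans (ℚ.*-comm R (r * r)) (⁻¹-inverse (0<r ⊗⁺ 0<r))
      C : ℚ
      C = # 8 + # 24 * R
      0<C : 0ℚ < C
      0<C = ℚ.<-≤-trans (#-pos 7) (by (#-nonneg 24 ⊗ 0≤R) (lemma (# 24 * R)))
        where
        lemma = solve 1 (λ x → (con (# 8) :+ x) :- con (# 8) := x) refl
      0<8C : 0ℚ < # 8 * C
      0<8C = #-pos 7 ⊗⁺ 0<C

    m₀ : ℚ
    m₀ = (# 8 * C) ⁻¹[ 0<8C ]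

    0<m₀ : 0ℚ < m₀
    0<m₀ = ⁻¹-pos 0<8C

    private
      -- `η` and `a₂` make `# 3 * η + # 4 * a₂` equal to m₀/4. Together with a perturbation of m₀/4
      -- in mean square, and doubled by the triangle inequality for squares, this is exactly the
      -- `m₀` that `bootstrap` accepts.
      η : ℚ
      η = m₀ * (pos 1 / 24)
      0<η : 0ℚ < η
      0<η = 0<m₀ ⊗⁺ 0<⅟ 23
      0<RC₆ : 0ℚ < R * C₆ R
      0<RC₆ = 0<R ⊗⁺ (ℚ.<-≤-trans (#-pos 39935 ⊗⁺ 0<R)
          (by (#-nonneg 593920 ⊗ (0≤R ⊗ 0≤R)) (lemma (# 39936 * R) (# 593920 * (R * R)))))
        where
        lemma = solve 2 (λ x y → (x :+ y) :- x := y) refl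
      -- λ₁, λ₂ and a₁ make both halves of the energy bound R (λ₁ C₆ + λ₂ E dist²) at most η²/16.
      λ₁ : ℚ
      λ₁ = pos 1 / 16 * (η * η) * (R * C₆ R) ⁻¹[ 0<RC₆ ]
      0<λ₁ : 0ℚ < λ₁
      0<λ₁ = 0<⅟ 15 ⊗⁺ (0<η ⊗⁺ 0<η) ⊗⁺ ⁻¹-pos 0<RC₆
      λ₂ : ℚ
      λ₂ = λ₁ ⁻¹[ 0<λ₁ ]
      0<λ₂ : 0ℚ < λ₂
      0<λ₂ = ⁻¹-pos 0<λ₁
      0<Rλ₂ : 0ℚ < R * λ₂
      0<Rλ₂ = 0<R ⊗⁺ 0<λ₂
      a₁ a₂ : ℚ
      a₁ = pos 1 / 16 * (η * η) * (R * λ₂) ⁻¹[ 0<Rλ₂ ]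
      a₂ = m₀ * (pos 1 / 32)
      ε₀ : ℚ
      ε₀ = a₁ ⊓ (a₂ ⊓ 1ℚ)
      0<ε₀ : 0ℚ < ε₀
      0<ε₀ = ⊓-pos (0<⅟ 15 ⊗⁺ (0<η ⊗⁺ 0<η) ⊗⁺ ⁻¹-pos 0<Rλ₂) (⊓-pos (0<m₀ ⊗⁺ 0<⅟ 31) (#-pos 0))

    ε₁ : ℚ
    ε₁ = ½ * ε₀

    0<ε₁ : 0ℚ < ε₁
    0<ε₁ = 0<½ ⊗⁺ 0<ε₀

    private
      ι : ℚ
      ι = ε₁ ⁻¹[ 0<ε₁ ]
      0≤ι : 0ℚ ≤ ι
      0≤ι = ℚ.<⇒≤ (⁻¹-pos 0<ε₁)

    -- The first summand is that of `bootstrap`. The rest is for a distance D ≥ ε₁: as ι = 1/ε₁, it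
    -- satisfies ιD² ≥ D and 2ι²D² ≥ 2, and so covers the trivial bound 2D + 2.
    K : ℚ
    K = # 16 * C + (ι + # 2 * (ι * ι))

    0≤K : 0ℚ ≤ K
    0≤K = #-nonneg 16 ⊗ ℚ.<⇒≤ 0<C ⊕ (0≤ι ⊕ #-nonneg 2 ⊗ (0≤ι ⊗ 0≤ι))

    private
      N₁ N₂ : ℕ
      N₁ = proj₁ (archimedean (# 3 * r ⁻¹[ 0<r ]))
      N₂ = proj₁ (archimedean (# 512 * η ⁻¹[ 0<η ]))

    N : ℕ
    N = 2 ℕ.+ (N₁ ℕ.+ N₂)

    module _ {n ℓ : ℕ} (S : Space n ℓ) (N≤n : N ℕ.≤ n) (κ-lower : ∀ a → ρ * # n ≤ Space.κ S a) where

      private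
        2≤n : # 2 ≤ # n
        2≤n = #-mono (ℕ.≤-trans (ℕ.m≤m+n 2 (N₁ ℕ.+ N₂)) N≤n)
        N₁≤n : # N₁ ≤ # n
        N₁≤n = #-mono (ℕ.≤-trans (ℕ.≤-trans (ℕ.m≤m+n N₁ N₂) (ℕ.m≤n+m (N₁ ℕ.+ N₂) 2)) N≤n)
        N₂≤n : # N₂ ≤ # n
        N₂≤n = #-mono (ℕ.≤-trans (ℕ.≤-trans (ℕ.m≤n+m N₂ N₁) (ℕ.m≤n+m (N₁ ℕ.+ N₂) 2)) N≤n)
        0<n : 0ℚ < # n
        0<n = ℚ.<-≤-trans (#-pos 1) 2≤n
        i : Fin n
        i = fromℕ< (ℕ.≤-trans (ℕ.m≤m+n 1 (1 ℕ.+ (N₁ ℕ.+ N₂))) N≤n)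
        ν : ℚ
        ν = (# n) ⁻¹[ 0<n ]
        nν : # n * ν ≡ 1ℚ
        nν = ⁻¹-inverse 0<n
        lower : ∀ a → # n * r + # 3 ≤ Space.κ S a
        lower a = ℚ.≤-trans (by (ℚ.<⇒≤ 0<r ⊗ gap (ℚ.≤-trans (proj₂ (archimedean (# 3 * r ⁻¹[ 0<r ]))) N₁≤n))
            (trans (lemma₁ ρ (# n)) (trans (cong (λ z → r * # n - # 3 * z) (sym (⁻¹-inverse 0<r)))
                (lemma₂ r (# n) (r ⁻¹[ 0<r ])))))
          (κ-lower a)
          where
          lemma₁ = solve 2 (λ ρ n → ρ :* n :- (n :* (con ½ :* ρ) :+ con (# 3)) := (con ½ :* ρ) :* n :- con (# 3) :* con 1ℚ) refl
          lemma₂ = solve 3 (λ r n s → r :* n :- con (# 3) :* (r :* s) := r :* (n :- con (# 3) :* s)) refl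
        ν-small : # 512 * ν ≤ η
        ν-small = cancel 0<n (by (ℚ.<⇒≤ 0<η ⊗ gap (ℚ.≤-trans (proj₂ (archimedean (# 512 * η ⁻¹[ 0<η ]))) N₂≤n))
          (trans (lemma₁ (# n) η ν) (trans (cong₂ (λ y z → η * # n - # 512 * (y * z)) nν refl)
            (trans (cong (λ z → η * # n - # 512 * (1ℚ * z)) (sym (⁻¹-inverse 0<η))) (lemma₂ η (# n) (η ⁻¹[ 0<η ]))))))
          where
          lemma₁ = solve 3 (λ n η v → n :* η :- n :* (con (# 512) :* v) := η :* n :- con (# 512) :* ((n :* v) :* con 1ℚ)) refl
          lemma₂ = solve 3 (λ η n s → η :* n :- con (# 512) :* (con 1ℚ :* (η :* s)) := η :* (n :- con (# 512) :* s)) refl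

      open Analysis S
      open FKN S r R ν 0<r Rr² 0≤R 0<n nν lower using (distance; distance≥0; error; norm-bound; dictator; bootstrap)

      -- The case distinction concerns `f` alone, so `j` and `γ` do not depend on `f′`. If the
      -- distance of `f` is at least `ε₀`, that of `f′` is still at least `ε₀ - ε₁ = ε₁`, and the
      -- constant 0 will do.
      robust : ∀ c φ → Σ[ j ∈ Fin n ] Σ[ γ ∈ (Fin ℓ → Bool) ] ∀ c′ φ′ →
               let f = Degree1.f c φ; f′ = Degree1.f c′ φ′ in
               E (λ u → (f′ u - f u) * (f′ u - f u)) ≤ pos 1 / 4 * m₀ → distance f ≤ distance f′ + ε₁ →
               error f′ j γ ≤ distance f′ + K * (distance f′ * distance f′)
      robust c φ = choose (ℚ.≤-total (distance f) ε₀)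
        where
        f : U → ℚ
        f = Degree1.f c φ
        Goal : Set
        Goal = Σ[ j ∈ Fin n ] Σ[ γ ∈ (Fin ℓ → Bool) ] ∀ c′ φ′ →
               let f′ = Degree1.f c′ φ′ in
               E (λ u → (f′ u - f u) * (f′ u - f u)) ≤ pos 1 / 4 * m₀ → distance f ≤ distance f′ + ε₁ →
               error f′ j γ ≤ distance f′ + K * (distance f′ * distance f′)
        choose : distance f ≤ ε₀ ⊎ ε₀ ≤ distance f → Goal
        choose (inj₁ small) = proj₁ found , proj₁ (proj₂ found) , near
          where
          D≤a₁ : distance f ≤ a₁
          D≤a₁ = ℚ.≤-trans small (ℚ.p⊓q≤p a₁ (a₂ ⊓ 1ℚ))
          D≤a₂ : distance f ≤ a₂
          D≤a₂ = ℚ.≤-trans small (ℚ.≤-trans (ℚ.p⊓q≤q a₁ (a₂ ⊓ 1ℚ)) (ℚ.p⊓q≤p a₂ 1ℚ))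
          D≤1 : distance f ≤ 1ℚ
          D≤1 = ℚ.≤-trans small (ℚ.≤-trans (ℚ.p⊓q≤q a₁ (a₂ ⊓ 1ℚ)) (ℚ.p⊓q≤q a₂ 1ℚ))
          norm≤4 : E (λ u → f u * f u) ≤ # 4
          norm≤4 = ℚ.≤-trans (norm-bound f) (by (#-nonneg 2 ⊗ gap D≤1) (lemma (distance f)))
            where
            lemma = solve 1 (λ d → con (# 4) :- (con (# 2) :* d :+ con (# 2)) := con (# 2) :* (con 1ℚ :- d)) refl
          energy-small : R * (λ₁ * C₆ R + λ₂ * distance f) ≤ pos 1 / 8 * (η * η)
          energy-small = begin
            R * (λ₁ * C₆ R + λ₂ * distance f)
              ≤⟨ by (ℚ.<⇒≤ 0<Rλ₂ ⊗ gap D≤a₁) (lemma₁ R λ₁ (C₆ R) λ₂ (distance f) a₁) ⟩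
            R * (λ₁ * C₆ R + λ₂ * a₁)
              ≡⟨ lemma₂ R λ₂ (C₆ R) (η * η) ((R * C₆ R) ⁻¹[ 0<RC₆ ]) ((R * λ₂) ⁻¹[ 0<Rλ₂ ]) ⟩
            pos 1 / 16 * (η * η) * (R * C₆ R * (R * C₆ R) ⁻¹[ 0<RC₆ ]) + pos 1 / 16 * (η * η) * (R * λ₂ * (R * λ₂) ⁻¹[ 0<Rλ₂ ])
              ≡⟨ cong₂ (λ x y → pos 1 / 16 * (η * η) * x + pos 1 / 16 * (η * η) * y) (⁻¹-inverse 0<RC₆) (⁻¹-inverse 0<Rλ₂) ⟩
            pos 1 / 16 * (η * η) * 1ℚ + pos 1 / 16 * (η * η) * 1ℚ
              ≡⟨ lemma₃ (η * η) ⟩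
            pos 1 / 8 * (η * η) ∎
            where
            open ℚ.≤-Reasoning
            lemma₁ = solve 6 (λ R l c k d a → R :* (l :* c :+ k :* a) :- R :* (l :* c :+ k :* d) := R :* k :* (a :- d)) refl
            lemma₂ = solve 6 (λ R k c e x y → R :* (con (pos 1 / 16) :* e :* x :* c :+ k :* (con (pos 1 / 16) :* e :* y)) := con
                (pos 1 / 16) :* e :* (R :* c :* x) :+ con (pos 1 / 16) :* e :* (R :* k :* y)) refl
            lemma₃ = solve 1 (λ e → con (pos 1 / 16) :* e :* con 1ℚ :+ con (pos 1 / 16) :* e :* con 1ℚ := con
                (pos 1 / 8) :* e) refl
          found : Σ[ j ∈ Fin n ] Σ[ γ ∈ (Fin ℓ → Bool) ] error f j γ ≤ # 3 * η + # 4 * distance f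
          found = dictator c φ (ℚ.<⇒≤ 0<λ₁) (ℚ.<⇒≤ 0<λ₂) (⁻¹-inverse 0<λ₁) 0<η norm≤4 energy-small ν-small 2≤n i
          near : ∀ c′ φ′ → let f′ = Degree1.f c′ φ′ in
               E (λ u → (f′ u - f u) * (f′ u - f u)) ≤ pos 1 / 4 * m₀ → distance f ≤ distance f′ + ε₁ →
               error f′ (proj₁ found) (proj₁ (proj₂ found)) ≤ distance f′ + K * (distance f′ * distance f′)
          near c′ φ′ close _ = ℚ.≤-trans
            (bootstrap c′ φ′ j γ (ℚ.≤-reflexive (⁻¹-inverse 0<8C)) weak)
            (by ((0≤ι ⊕ #-nonneg 2 ⊗ (0≤ι ⊗ 0≤ι)) ⊗ sq (distance f′))
                (lemma (distance f′) (distance f′ * distance f′) (# 16 * C) (ι + # 2 * (ι * ι))))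
            where
            f′ : U → ℚ
            f′ = Degree1.f c′ φ′
            j = proj₁ found
            γ = proj₁ (proj₂ found)
            g : U → ℚ
            g u = bit (γ (at u j))
            lemma = solve 4 (λ d x c k → (d :+ (c :+ k) :* x) :- (d :+ c :* x) := k :* x) refl
            lemma₁ = solve 3 (λ x y g → (con (# 2) :* ((x :- y) :* (x :- y)) :+ con (# 2) :* ((y :- g) :* (y :- g))) :-
                (x :- g) :* (x :- g) := (x :- y :- (y :- g)) :* (x :- y :- (y :- g))) refl
            lemma₂ = solve 4 (λ m x e d → m :- (con (# 2) :* x :+ con (# 2) :* e)
              := con (# 2) :* (con (pos 1 / 4) :* m :- x) :+ con (# 2) :*
                  ((con (# 3) :* (m :* (con (pos 1 / 24))) :+ con (# 4) :* d) :- e) :+ con (# 8) :*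
                  (m :* (con (pos 1 / 32)) :- d)) refl
            weak : error f′ j γ ≤ m₀
            weak = ℚ.≤-trans
              (E-bound (# 2) (# 2) (λ u → (f′ u - f u) * (f′ u - f u)) (λ u → (f u - g u) * (f u - g u))
                (λ u → by (sq (f′ u - f u - (f u - g u))) (lemma₁ (f′ u) (f u) (g u))))
              (by (#-nonneg 2 ⊗ gap close ⊕ #-nonneg 2 ⊗ gap (proj₂ (proj₂ found)) ⊕ #-nonneg 8 ⊗ gap D≤a₂)
                (lemma₂ m₀ (E (λ u → (f′ u - f u) * (f′ u - f u))) (error f j γ) (distance f)))
        choose (inj₂ large) = i , (λ _ → false) , far
          where
          far : ∀ c′ φ′ → let f′ = Degree1.f c′ φ′ in
               E (λ u → (f′ u - f u) * (f′ u - f u)) ≤ pos 1 / 4 * m₀ → distance f ≤ distance f′ + ε₁ →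
               error f′ i (λ _ → false) ≤ distance f′ + K * (distance f′ * distance f′)
          far c′ φ′ _ close = ℚ.≤-trans (ℚ.≤-reflexive (E.congr (λ u → lemma₀ (f′ u))))
            (ℚ.≤-trans (norm-bound f′)
            (by (#-nonneg 16 ⊗ ℚ.<⇒≤ 0<C ⊗ sq D ⊕ 0≤ι ⊗ distance≥0 f′ ⊗ gap D-lower ⊕ #-nonneg 2 ⊗ (0≤ι ⊗ 0≤ι) ⊗
                (gap D-lower ⊗ (distance≥0 f′ ⊕ ℚ.<⇒≤ 0<ε₁)))
              (trans (lemma₁ D (# 16 * C) ι) (trans
                  (cong (λ z → # 16 * C * (D * D) + (ι * (D * D) - z * D) + # 2 * (ι * ι * (D * D) - z * z))
                  (sym (⁻¹-inverse 0<ε₁))) (lemma₂ D (# 16 * C) ι ε₁)))))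
            where
            f′ : U → ℚ
            f′ = Degree1.f c′ φ′
            D : ℚ
            D = distance f′
            D-lower : ε₁ ≤ D
            D-lower = by (gap (ℚ.≤-trans large close)) (lemma ε₀ D)
              where
              lemma = solve 2 (λ e d → d :- con ½ :* e := (d :+ con ½ :* e) :- e) refl
            lemma₀ = solve 1 (λ x → (x :- con 0ℚ) :* (x :- con 0ℚ) := x :* x) refl
            lemma₁ = solve 3 (λ d c k → (d :+ (c :+ (k :+ con (# 2) :* (k :* k))) :* (d :* d)) :- (con (# 2) :* d :+ con (# 2))
                := c :* (d :* d) :+ (k :* (d :* d) :- con 1ℚ :* d) :+ con (# 2) :* (k :* k :* (d :* d) :- con 1ℚ :* con 1ℚ)) refl
            lemma₂ = solve 4 (λ d c k e → c :* (d :* d) :+ (k :* (d :* d) :- (e :* k) :* d) :+ con (# 2) :*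
                (k :* k :* (d :* d) :- (e :* k) :* (e :* k))
              := c :* (d :* d) :+ k :* d :* (d :- e) :+ con (# 2) :* (k :* k) :* ((d :- e) :* (d :+ e))) refl

  stability : ∀ ρ → 0ℚ < ρ → Robust ρ
  stability ρ 0<ρ = record { Choice ρ 0<ρ }

  -- The multislice

  -- An involution is a bijection, so mapping it over a complete list without duplicates permutes
  -- that list. It is used both for positions and for points.
  sum-involution : ∀ {A : Set} {xs : List A} → Unique xs → (∀ x → x ∈ xs) → ∀ (τ : A → A) → (∀ x → τ (τ x) ≡ x) →
                   ∀ f → sumOver xs (λ x → f (τ x)) ≡ sumOver xs f
  sum-involution {xs = xs} unique complete τ τ-involutive f = trans (sym (sum-map τ xs f))
    (sum-↭ (∼bag⇒↭ (unique∧set⇒bag (Unique.map⁺ injective unique) unique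
      (λ {x} → mk⇔ (λ _ → complete x) (λ _ → subst (_∈ List.map τ xs) (τ-involutive x) (∈-map⁺ τ (complete (τ x))))))) f)
    where
    injective : ∀ {x y} → τ x ≡ τ y → x ≡ y
    injective {x} {y} e = trans (sym (τ-involutive x)) (trans (cong τ e) (τ-involutive y))

  module _ {n : ℕ} where

    transposeˡ : ∀ (j k : Fin n) → transpose j k j ≡ k
    transposeˡ j k with j Fin.≟ j
    ... | yes _   = refl
    ... | no  j≢j = contradiction refl j≢j

    transposeʳ : ∀ (j k : Fin n) → transpose j k k ≡ j
    transposeʳ j k with k Fin.≟ j
    ... | yes k≡j = k≡j
    ... | no  _   with k Fin.≟ k
    ...   | yes _   = refl
    ...   | no  k≢k = contradiction refl k≢k

    transpose-≢ : ∀ (j k : Fin n) {m} → m ≢ j → m ≢ k → transpose j k m ≡ m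
    transpose-≢ j k {m} m≢j m≢k with m Fin.≟ j
    ... | yes m≡j = contradiction m≡j m≢j
    ... | no  _   with m Fin.≟ k
    ...   | yes m≡k = contradiction m≡k m≢k
    ...   | no  _   = refl

    transpose-involutive : ∀ (j k : Fin n) m → transpose j k (transpose j k m) ≡ m
    transpose-involutive j k m = cases (m Fin.≟ j) (m Fin.≟ k)
      where
      cases : Dec (m ≡ j) → Dec (m ≡ k) → transpose j k (transpose j k m) ≡ m
      cases (yes refl) _        = trans (cong (transpose j k) (transposeˡ j k)) (transposeʳ j k)
      cases (no _)   (yes refl) = trans (cong (transpose j k) (transposeʳ j k)) (transposeˡ j k)
      cases (no m≢j) (no m≢k)   = trans (cong (transpose j k) (transpose-≢ j k m≢j m≢k)) (transpose-≢ j k m≢j m≢k)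

  #-injective : ∀ {m n} → # m ≡ # n → m ≡ n
  #-injective {m} {n} e = ℕ.≤-antisym (ℕ.≮⇒≥ (λ n<m → strict n<m (sym e))) (ℕ.≮⇒≥ (λ m<n → strict m<n e))
    where
    strict : ∀ {m n} → m ℕ.< n → # m ≢ # n
    strict {m} {n} m<n e = ℚ.<-irrefl e (ℚ.<-≤-trans (subst (# m <_) (sym (#-+ 1 m))
      (subst (_< # 1 + # m) (ℚ.+-identityˡ (# m)) (ℚ.+-monoˡ-< (# m) (#-pos 0)))) (#-mono m<n))

  ∑-count : ∀ {n ℓ} (w : Vec (Fin ℓ) n) a → ∑ (λ m → δ (lookup w m) a) ≡ # Vec.count (Fin._≟ a) w
  ∑-count []      a = trans (∑.congr {0} {g = λ _ → 0ℚ} (λ ())) (∑.0-hom {0})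
  ∑-count (x ∷ w) a = trans (∑-suc (λ m → δ (lookup (x ∷ w) m) a))
      (trans (cong₂ _+_ (δ-does x a) (∑-count w a)) (head (does (x Fin.≟ a)) (Vec.count (Fin._≟ a) w)))
    where
    head : ∀ b k → bit b + # k ≡ # (if b then suc else id) k
    head true  k = sym (#-+ 1 k)
    head false k = ℚ.+-identityˡ (# k)

  swapWord : ∀ {n ℓ} → Fin n → Fin n → Vec (Fin ℓ) n → Vec (Fin ℓ) n
  swapWord j k w = tabulate (λ m → lookup w (transpose j k m))

  lookup-swapWord : ∀ {n ℓ} j k (w : Vec (Fin ℓ) n) m → lookup (swapWord j k w) m ≡ lookup w (transpose j k m)
  lookup-swapWord j k w m = Vec.lookup∘tabulate (λ m → lookup w (transpose j k m)) m

  swapWord-involutive : ∀ {n ℓ} j k (w : Vec (Fin ℓ) n) → swapWord j k (swapWord j k w) ≡ w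
  swapWord-involutive j k w = trans
    (Vec.tabulate-cong (λ m → trans (lookup-swapWord j k w (transpose j k m)) (cong (lookup w) (transpose-involutive j k m))))
    (Vec.tabulate∘lookup w)

  swapWord-profile : ∀ {n ℓ} {κ : Vec ℕ ℓ} j k (w : Vec (Fin ℓ) n) → HasProfile κ w → HasProfile κ (swapWord j k w)
  swapWord-profile {n} j k w p a = trans (#-injective (begin
    # Vec.count (Fin._≟ a) (swapWord j k w)                  ≡⟨ ∑-count (swapWord j k w) a ⟨
    ∑ (λ m → δ (lookup (swapWord j k w) m) a)                ≡⟨ ∑.congr (λ m → cong (λ b → δ b a) (lookup-swapWord j k w m)) ⟩
    ∑ (λ m → δ (lookup w (transpose j k m)) a)               ≡⟨ ∑-allFin n (λ m → δ (lookup w (transpose j k m)) a) ⟩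
    sumOver (List.allFin n) (λ m → δ (lookup w (transpose j k m)) a)
      ≡⟨ sum-involution (Unique.allFin⁺ n) ∈-allFin (transpose j k) (transpose-involutive j k) (λ m → δ (lookup w m) a) ⟩
    sumOver (List.allFin n) (λ m → δ (lookup w m) a)             ≡⟨ ∑-allFin n (λ m → δ (lookup w m) a) ⟨
    ∑ (λ m → δ (lookup w m) a)                               ≡⟨ ∑-count w a ⟩
    # Vec.count (Fin._≟ a) w                                 ∎)) (p a)
    where open ≡-Reasoning

  words-unique : ∀ n ℓ → Unique (words n ℓ)
  words-unique zero    ℓ = All.[] AllPairs.∷ AllPairs.[]
  words-unique (suc n) ℓ = Unique.cartesianProductWith⁺ _∷_ Vec.∷-injective (Unique.allFin⁺ ℓ) (words-unique n ℓ)

  words-complete : ∀ {n ℓ} (w : Vec (Fin ℓ) n) → w ∈ words n ℓ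
  words-complete []      = here refl
  words-complete (x ∷ w) = ∈-cartesianProductWith⁺ _∷_ (∈-allFin x) (words-complete w)

  reciprocal≥0 : ∀ k → 0ℚ ≤ reciprocal k
  reciprocal≥0 zero    = ℚ.≤-refl
  reciprocal≥0 (suc k) = ℚ.nonNegative⁻¹ (pos 1 / suc k) {{ℚ.normalize-nonNeg 1 (suc k)}}

  reciprocal-inverse : ∀ k → reciprocal (suc k) * # suc k ≡ 1ℚ
  reciprocal-inverse k = ℚ.toℚᵘ-injective (ℚᵘ.≃-trans (ℚ.toℚᵘ-homo-* (reciprocal (suc k)) (# suc k))
    (ℚᵘ.≃-trans (ℚᵘ.*-cong (ℚ.toℚᵘ-fromℚᵘ (ℚᵘ.mkℚᵘ (pos 1) k)) (ℚ.toℚᵘ-fromℚᵘ (ℚᵘ.mkℚᵘ (pos (suc k)) 0)))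
      (ℚᵘ.*≡* (cong pos (trans (ℕ.*-identityʳ (suc k ℕ.+ 0))
          (trans (ℕ.+-identityʳ (suc k)) (sym (trans (ℕ.*-identityˡ (suc k ℕ.* 1)) (ℕ.*-identityʳ (suc k))))))))))

  map-mapMaybe : ∀ {A B : Set} {P : A → Set} (P? : ∀ x → Dec (P x)) (h : B → A) (mk : ∀ x → P x → B) → (∀ x p → h (mk x p) ≡ x) →
                 ∀ xs → List.map h (List.mapMaybe (λ x → Maybe.map (mk x) (dec⇒maybe (P? x))) xs) ≡ List.filter P? xs
  map-mapMaybe P? h mk e []       = refl
  map-mapMaybe P? h mk e (x ∷ xs) with P? x
  ... | yes p = cong₂ _∷_ (e x p) (map-mapMaybe P? h mk e xs)
  ... | no  _ = map-mapMaybe P? h mk e xs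

  module _ {ℓ : ℕ} (n : ℕ) (κ : Vec ℕ ℓ) where

    -- Forgetting the profiles leaves a plain filtered list of words, whose uniqueness and
    -- completeness lift back to `points`.
    map-word-points : List.map word (points n κ) ≡ List.filter (hasProfile? κ) (words n ℓ)
    map-word-points = map-mapMaybe (hasProfile? κ) word (λ w p → point w p) (λ w p → refl) (words n ℓ)

    points-unique : Unique (points n κ)
    points-unique = Unique.map⁻ (subst Unique (sym map-word-points) (Unique.filter⁺ (hasProfile? κ) (words-unique n ℓ)))

    points-complete : ∀ u → u ∈ points n κ
    points-complete (point w p) with ∈-map⁻ word (subst (w ∈_) (sym map-word-points)
      (∈-filter⁺ (hasProfile? κ) (words-complete w) (recompute (hasProfile? κ w) p)))
    ... | point _ _ , u∈ , refl = u∈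

    swapPoint : Fin n → Fin n → Multislice n κ → Multislice n κ
    swapPoint j k (point w p) = point (swapWord j k w) (swapWord-profile {κ = κ} j k w p)

    swapPoint-involutive : ∀ j k u → swapPoint j k (swapPoint j k u) ≡ u
    swapPoint-involutive j k (point w p) = lemma (swapWord-involutive j k w)
      where
      lemma : ∀ {w w′} .{p : HasProfile κ w} .{p′ : HasProfile κ w′} → w ≡ w′ → point {n = n} {κ = κ} w p ≡ point w′ p′
      lemma refl = refl

    count-letter : ∀ (u : Multislice n κ) a → Vec.count (Fin._≟ a) (word u) ≡ lookup κ a
    count-letter (point w p) a = recompute (Vec.count (Fin._≟ a) w ℕ.≟ lookup κ a) (p a)

    mean : (Multislice n κ → ℚ) → ℚ
    mean X = reciprocal (List.length (points n κ)) * sumOver (points n κ) X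

    mean-positiveLinear : PositiveLinear mean
    mean-positiveLinear = record
      { mono  = λ p → scale (reciprocal≥0 (List.length (points n κ))) (Sum.mono p)
      ; +-hom = λ X Y → trans (cong (λ z → ρ * z) (Sum.+-hom X Y))
          (ℚ.*-distribˡ-+ ρ (sumOver (points n κ) X) (sumOver (points n κ) Y))
      ; *-hom = λ c X → trans (cong (λ z → ρ * z) (Sum.*-hom c X)) (lemma ρ c (sumOver (points n κ) X))
      }
      where
      module Sum = PositiveLinear (sum-positiveLinear (points n κ))
      ρ : ℚ
      ρ = reciprocal (List.length (points n κ))
      lemma = solve 3 (λ r c x → r :* (c :* x) := c :* (r :* x)) refl

    mean-empty : List.length (points n κ) ≡ 0 → ∀ X → mean X ≡ 0ℚ
    mean-empty e X = trans (cong (λ k → reciprocal k * sumOver (points n κ) X) e) (ℚ.*-zeroˡ (sumOver (points n κ) X))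

    slice : ∀ {k} → List.length (points n κ) ≡ suc k → Space n ℓ
    slice {k} nonempty = record
      { U         = Multislice n κ
      ; at        = λ u → lookup (word u)
      ; swap      = swapPoint
      ; at-swapˡ  = λ j k u → trans (lookup-swapWord j k (word u) j) (cong (lookup (word u)) (transposeˡ j k))
      ; at-swapʳ  = λ j k u → trans (lookup-swapWord j k (word u) k) (cong (lookup (word u)) (transposeʳ j k))
      ; at-swap-≢ = λ j k u {m} m≢j m≢k → trans (lookup-swapWord j k (word u) m)
          (cong (lookup (word u)) (transpose-≢ j k m≢j m≢k))
      ; E         = mean
      ; E-lin     = mean-positiveLinear
      ; E-1       = trans (cong₂ (λ m s → reciprocal m * s) nonempty
                      (trans (sum-const (points n κ) 1ℚ) (trans (cong (λ m → # m * 1ℚ) nonempty) (ℚ.*-identityʳ (# suc k)))))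
                      (reciprocal-inverse k)
      ; E-swap    = λ j k X → cong (λ s → reciprocal (List.length (points n κ)) * s)
                      (sum-involution points-unique points-complete (swapPoint j k) (swapPoint-involutive j k) X)
      ; κ         = λ a → # lookup κ a
      ; count     = λ u a → trans (∑-count (word u) a) (cong #_ (count-letter u a))
      }

open import Defs
open Rational using (#_; ⊓-pos; _⊕_; _⊗_; _⊗⁺_; by; gap; scale; sq; #-nonneg; bit; δ; δ-does; ∑-allFin; ∑-δˡ;
  sumOver; sum-[]; sum-∷; PositiveLinear; module PositiveLinear; module Analysis; dist²; dist²-def; dist²≥0; dist²≤; ∣x∣²;
  Robust; module Robust; stability; mean; mean-positiveLinear; mean-empty; slice; points-complete)

-- Real numbers

private
  half : ∀ ε → .{{Positive ε}} → Positive (½ ℚ.* ε)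
  half ε = ℚ.pos*pos⇒pos ½ ε

  halves = solve 1 (λ ε → con ½ :* ε :+ con ½ :* ε := ε) refl

∣-∣-triangle : ∀ {δ ε} x y z → ℚ.∣ x ℚ.- y ∣ ℚ.≤ δ → ℚ.∣ y ℚ.- z ∣ ℚ.≤ ε → ℚ.∣ x ℚ.- z ∣ ℚ.≤ δ ℚ.+ ε
∣-∣-triangle x y z p q = ℚ.≤-trans (subst (λ t → ℚ.∣ t ∣ ℚ.≤ ℚ.∣ x ℚ.- y ∣ ℚ.+ ℚ.∣ y ℚ.- z ∣) (lemma x y z)
    (ℚ.∣p+q∣≤∣p∣+∣q∣ (x ℚ.- y) (y ℚ.- z)))
  (ℚ.+-mono-≤ p q)
  where
  lemma = solve 3 (λ x y z → (x :- y) :+ (y :- z) := x :- z) refl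

∣-∣-sym : ∀ x y → ℚ.∣ x ℚ.- y ∣ ≡ ℚ.∣ y ℚ.- x ∣
∣-∣-sym x y = trans (cong ℚ.∣_∣ (lemma x y)) (ℚ.∣-p∣≡∣p∣ (y ℚ.- x))
  where
  lemma = solve 2 (λ x y → x :- y :=  :- (y :- x)) refl

p≤∣p∣ : ∀ p → p ℚ.≤ ℚ.∣ p ∣
p≤∣p∣ p with ℚ.≤-total 0ℚ p
... | inj₁ 0≤p = ℚ.≤-reflexive (sym (ℚ.0≤p⇒∣p∣≡p 0≤p))
... | inj₂ p≤0 = ℚ.≤-trans p≤0 (ℚ.0≤∣p∣ p)

∣-∣-upper : ∀ {δ} x y → ℚ.∣ x ℚ.- y ∣ ℚ.≤ δ → x ℚ.≤ y ℚ.+ δ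
∣-∣-upper {δ} x y p = by (gap (ℚ.≤-trans (p≤∣p∣ (x ℚ.- y)) p)) (lemma x y δ)
  where
  lemma = solve 3 (λ x y d → (y :+ d) :- x := d :- (x :- y)) refl

≃-refl : ∀ {x} → x ≃ x
≃-refl {x} ε = 0 , λ n _ → subst (ℚ._≤ ε) (sym (cong ℚ.∣_∣ (ℚ.+-inverseʳ (seq x n)))) (ℚ.<⇒≤ (ℚ.positive⁻¹ ε))

≃-sym : ∀ {x y} → x ≃ y → y ≃ x
≃-sym {x} {y} e ε with e ε
... | N , h = N , λ n N≤n → subst (ℚ._≤ ε) (∣-∣-sym (seq x n) (seq y n)) (h n N≤n)

≃-trans : ∀ {x y z} → x ≃ y → y ≃ z → x ≃ z
≃-trans {x} {y} {z} d e ε with d (½ ℚ.* ε) {{half ε}} | e (½ ℚ.* ε) {{half ε}}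
... | M , g | N , h = M ℕ.⊔ N , λ n p → subst (ℚ.∣ seq x n ℚ.- seq z n ∣ ℚ.≤_) (halves ε)
  (∣-∣-triangle (seq x n) (seq y n) (seq z n) (g n (ℕ.m⊔n≤o⇒m≤o M N p)) (h n (ℕ.m⊔n≤o⇒n≤o M N p)))

-- Each exchange of representatives costs half of ε. Inequalities between reals can thus be proved
-- term by term on the most convenient sequences.
≤-from-seq : ∀ {x x′ y y′} M → x ≃ x′ → (∀ n → M ℕ.≤ n → seq x′ n ℚ.≤ seq y′ n) → y′ ≃ y → x ≤ y
≤-from-seq {x} {x′} {y} {y′} M d l e ε with d (½ ℚ.* ε) {{half ε}} | e (½ ℚ.* ε) {{half ε}}
... | N₁ , h₁ | N₂ , h₂ = M ℕ.⊔ (N₁ ℕ.⊔ N₂) , λ n p → begin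
    seq x n                                   ≤⟨ ∣-∣-upper (seq x n) (seq x′ n)
        (h₁ n (ℕ.m⊔n≤o⇒m≤o N₁ N₂ (ℕ.m⊔n≤o⇒n≤o M (N₁ ℕ.⊔ N₂) p))) ⟩
    seq x′ n ℚ.+ ½ ℚ.* ε                      ≤⟨ ℚ.+-monoˡ-≤ (½ ℚ.* ε) (l n (ℕ.m⊔n≤o⇒m≤o M (N₁ ℕ.⊔ N₂) p)) ⟩
    seq y′ n ℚ.+ ½ ℚ.* ε                      ≤⟨ ℚ.+-monoˡ-≤ (½ ℚ.* ε)
        (∣-∣-upper (seq y′ n) (seq y n) (h₂ n (ℕ.m⊔n≤o⇒n≤o N₁ N₂ (ℕ.m⊔n≤o⇒n≤o M (N₁ ℕ.⊔ N₂) p)))) ⟩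
    seq y n ℚ.+ ½ ℚ.* ε ℚ.+ ½ ℚ.* ε           ≡⟨ trans (ℚ.+-assoc (seq y n) (½ ℚ.* ε) (½ ℚ.* ε))
        (cong (seq y n ℚ.+_) (halves ε)) ⟩
    seq y n ℚ.+ ε                             ∎
  where open ℚ.≤-Reasoning

-- Interleaving, and congruence of the operations on ℝ

interleave : {A : Set} → (ℕ → A) → (ℕ → A) → ℕ → A
interleave x y zero    = x zero
interleave x y (suc n) = interleave y (λ k → x (suc k)) n

double : ℕ → ℕ
double zero    = zero
double (suc k) = suc (suc (double k))

interleave-even : ∀ {A : Set} (x y : ℕ → A) k → interleave x y (double k) ≡ x k
interleave-even x y zero    = refl
interleave-even x y (suc k) = interleave-even (λ k → x (suc k)) (λ k → y (suc k)) k

interleave-odd : ∀ {A : Set} (x y : ℕ → A) k → interleave x y (suc (double k)) ≡ y k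
interleave-odd x y zero    = refl
interleave-odd x y (suc k) = interleave-odd (λ k → x (suc k)) (λ k → y (suc k)) k

k≤double : ∀ k → k ℕ.≤ double k
k≤double zero    = z≤n
k≤double (suc k) = s≤s (ℕ.m≤n⇒m≤1+n (k≤double k))

parity : ∀ n → ∃[ k ] (n ≡ double k ⊎ n ≡ suc (double k))
parity zero    = 0 , inj₁ refl
parity (suc n) with parity n
... | k , inj₁ refl = k , inj₂ refl
... | k , inj₂ refl = suc k , inj₁ refl

double-mono⁻ : ∀ {m n} → double m ℕ.≤ suc (double n) → m ℕ.≤ n
double-mono⁻ {zero}          p             = z≤n
double-mono⁻ {suc m} {suc n} (s≤s (s≤s p)) = s≤s (double-mono⁻ p)

-- Sequences with the same limit interleave to a Cauchy sequence, so every operation that is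
-- defined pointwise and preserves IsCauchy respects _≃_.
merge : ∀ x y → x ≃ y → ℝ
merge x y e = mkℝ z z-cauchy
  where
  z : ℕ → ℚ
  z = interleave (seq x) (seq y)
  z-cauchy : IsCauchy z
  z-cauchy ε with cauchy x (½ ℚ.* ε) {{half ε}} | e (½ ℚ.* ε) {{half ε}} | cauchy y (½ ℚ.* ε) {{half ε}}
  ... | N₁ , h₁ | N₂ , h₂ | N₃ , h₃ = double N , close
    where
    N = N₁ ℕ.⊔ N₂ ℕ.⊔ N₃
    ≥₁ : ∀ {k} → N ℕ.≤ k → N₁ ℕ.≤ k
    ≥₁ p = ℕ.m⊔n≤o⇒m≤o N₁ N₂ (ℕ.m⊔n≤o⇒m≤o (N₁ ℕ.⊔ N₂) N₃ p)
    ≥₂ : ∀ {k} → N ℕ.≤ k → N₂ ℕ.≤ k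
    ≥₂ p = ℕ.m⊔n≤o⇒n≤o N₁ N₂ (ℕ.m⊔n≤o⇒m≤o (N₁ ℕ.⊔ N₂) N₃ p)
    ≥₃ : ∀ {k} → N ℕ.≤ k → N₃ ℕ.≤ k
    ≥₃ p = ℕ.m⊔n≤o⇒n≤o (N₁ ℕ.⊔ N₂) N₃ p
    weaken : ∀ {t} → t ℚ.≤ ½ ℚ.* ε → t ℚ.≤ ε
    weaken p = ℚ.≤-trans p (by (ℚ.<⇒≤ (ℚ.positive⁻¹ (½ ℚ.* ε) {{half ε}})) (lemma ε))
      where
      lemma = solve 1 (λ ε → ε :- con ½ :* ε := con ½ :* ε) refl
    mixed : ∀ k l → N ℕ.≤ k → N ℕ.≤ l → ℚ.∣ seq x k ℚ.- seq y l ∣ ℚ.≤ ε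
    mixed k l p q = subst (ℚ.∣ seq x k ℚ.- seq y l ∣ ℚ.≤_) (halves ε)
      (∣-∣-triangle (seq x k) (seq x l) (seq y l) (h₁ k l (≥₁ p) (≥₁ q)) (h₂ l (≥₂ q)))
    value : ∀ n → double N ℕ.≤ n → ∃[ k ] (N ℕ.≤ k × (z n ≡ seq x k ⊎ z n ≡ seq y k))
    value n p with parity n
    ... | k , inj₁ refl = k , double-mono⁻ (ℕ.m≤n⇒m≤1+n p) , inj₁ (interleave-even (seq x) (seq y) k)
    ... | k , inj₂ refl = k , double-mono⁻ p , inj₂ (interleave-odd (seq x) (seq y) k)
    close : ∀ m n → double N ℕ.≤ m → double N ℕ.≤ n → ℚ.∣ z m ℚ.- z n ∣ ℚ.≤ ε
    close m n p q with value m p | value n q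
    ... | k , N≤k , inj₁ a | l , N≤l , inj₁ b = subst₂ (λ s t → ℚ.∣ s ℚ.- t ∣ ℚ.≤ ε) (sym a) (sym b)
        (weaken (h₁ k l (≥₁ N≤k) (≥₁ N≤l)))
    ... | k , N≤k , inj₁ a | l , N≤l , inj₂ b = subst₂ (λ s t → ℚ.∣ s ℚ.- t ∣ ℚ.≤ ε) (sym a) (sym b) (mixed k l N≤k N≤l)
    ... | k , N≤k , inj₂ a | l , N≤l , inj₁ b = subst₂ (λ s t → ℚ.∣ s ℚ.- t ∣ ℚ.≤ ε) (sym a) (sym b)
      (subst (ℚ._≤ ε) (∣-∣-sym (seq x l) (seq y k)) (mixed l k N≤l N≤k))
    ... | k , N≤k , inj₂ a | l , N≤l , inj₂ b = subst₂ (λ s t → ℚ.∣ s ℚ.- t ∣ ℚ.≤ ε) (sym a) (sym b)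
        (weaken (h₃ k l (≥₃ N≤k) (≥₃ N≤l)))

pointwise-cong : ∀ (_∙_ : ℝ → ℝ → ℝ) (_∘_ : ℚ → ℚ → ℚ) → (∀ x y n → seq (x ∙ y) n ≡ seq x n ∘ seq y n) →
                 ∀ {x x′ y y′} → x ≃ x′ → y ≃ y′ → (x ∙ y) ≃ (x′ ∙ y′)
pointwise-cong _∙_ _∘_ pointwise {x} {x′} {y} {y′} d e ε = proj₁ close , λ n N≤n → subst₂ (λ s t → ℚ.∣ s ℚ.- t ∣ ℚ.≤ ε)
    -- Terms 2n and 2n + 1 of the operation on the interleaved sequences are the n-th terms of the
    -- two sides, so its Cauchy property is the equality sought.
    (trans (pointwise x″ y″ (double n))
      (trans (cong₂ _∘_ (interleave-even (seq x) (seq x′) n) (interleave-even (seq y) (seq y′) n)) (sym (pointwise x y n))))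
    (trans (pointwise x″ y″ (suc (double n)))
      (trans (cong₂ _∘_ (interleave-odd (seq x) (seq x′) n) (interleave-odd (seq y) (seq y′) n)) (sym (pointwise x′ y′ n))))
    (proj₂ close (double n) (suc (double n)) (ℕ.≤-trans N≤n (k≤double n)) (ℕ.≤-trans N≤n (ℕ.m≤n⇒m≤1+n (k≤double n))))
  where
  x″ y″ : ℝ
  x″ = merge x x′ d
  y″ = merge y y′ e
  close : ∃[ N ] ∀ m n → N ℕ.≤ m → N ℕ.≤ n → ℚ.∣ seq (x″ ∙ y″) m ℚ.- seq (x″ ∙ y″) n ∣ ℚ.≤ ε
  close = cauchy (x″ ∙ y″) ε

+-cong : ∀ {x x′ y y′} → x ≃ x′ → y ≃ y′ → (x + y) ≃ (x′ + y′)
+-cong {x} {x′} {y} {y′} = pointwise-cong _+_ ℚ._+_ (λ _ _ _ → refl) {x} {x′} {y} {y′}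

minus-cong : ∀ {x x′ y y′} → x ≃ x′ → y ≃ y′ → (x - y) ≃ (x′ - y′)
minus-cong {x} {x′} {y} {y′} = pointwise-cong _-_ ℚ._-_ (λ _ _ _ → refl) {x} {x′} {y} {y′}

*-cong : ∀ {x x′ y y′} → x ≃ x′ → y ≃ y′ → (x * y) ≃ (x′ * y′)
*-cong {x} {x′} {y} {y′} = pointwise-cong _*_ ℚ._*_ (λ _ _ _ → refl) {x} {x′} {y} {y′}

²-cong : ∀ {x y} → x ≃ y → (x ²) ≃ (y ²)
²-cong {x} {y} e = *-cong {x} {y} {x} {y} e e

dist-cong : ∀ {x y} → x ≃ y → dist x (0ℝ ∷ 1ℝ ∷ []) ≃ dist y (0ℝ ∷ 1ℝ ∷ [])
dist-cong {x} {y} e = pointwise-cong (λ x _ → dist x (0ℝ ∷ 1ℝ ∷ [])) (λ p _ → ℚ.∣ p ℚ.- 0ℚ ∣ ℚ.⊓ ℚ.∣ p ℚ.- 1ℚ ∣)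
    (λ _ _ _ → refl) {x} {y} {x} {y} e e

∑-cong : ∀ {A : Set} (xs : List A) {f g : A → ℝ} → (∀ x → f x ≃ g x) → ∑ xs f ≃ ∑ xs g
∑-cong []       e = ≃-refl {0ℝ}
∑-cong (x ∷ xs) {f} {g} e = +-cong {f x} {g x} {∑ xs f} {∑ xs g} (e x) (∑-cong xs {f} {g} e)

seq-∑ : ∀ {A : Set} (xs : List A) (f : A → ℝ) m → seq (∑ xs f) m ≡ sumOver xs (λ x → seq (f x) m)
seq-∑ []       f m = sym (sum-[] (λ x → seq (f x) m))
seq-∑ (x ∷ xs) f m = trans (cong (seq (f x) m ℚ.+_) (seq-∑ xs f m)) (sym (sum-∷ x xs (λ x → seq (f x) m)))

seq-⟦⟧ : ∀ b m → seq ⟦ b ⟧ m ≡ bit b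
seq-⟦⟧ true  m = refl
seq-⟦⟧ false m = refl

module _ {n ℓ : ℕ} {κ : Vec ℕ ℓ} where

  𝔼-cong : ∀ {f g : Multislice n κ → ℝ} → (∀ u → f u ≃ g u) → 𝔼 f ≃ 𝔼 g
  𝔼-cong {f} {g} e = *-cong {r} {r} {∑ (points n κ) f} {∑ (points n κ) g} (≃-refl {r}) (∑-cong (points n κ) {f} {g} e)
    where
    r : ℝ
    r = fromℚ (reciprocal (List.length (points n κ)))

  seq-𝔼 : ∀ (f : Multislice n κ → ℝ) m → seq (𝔼 f) m ≡ mean n κ (λ u → seq (f u) m)
  seq-𝔼 f m = cong (reciprocal (List.length (points n κ)) ℚ.*_) (seq-∑ (points n κ) f m)

uniformly-eventually : ∀ {A : Set} (P : A → ℕ → Set) (xs : List A) → (∀ x → ∃[ N ] ∀ n → N ℕ.≤ n → P x n) →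
                       ∃[ N ] ∀ n → N ℕ.≤ n → ∀ x → x ∈ xs → P x n
uniformly-eventually P []       h = 0 , λ _ _ _ ()
uniformly-eventually P (x ∷ xs) h with h x | uniformly-eventually P xs h
... | M , g | N , k = M ℕ.⊔ N , λ where
  n p _ (here refl) → g n (ℕ.m⊔n≤o⇒m≤o M N p)
  n p y (there y∈)  → k n (ℕ.m⊔n≤o⇒n≤o M N p) y y∈

-- Approximation by rationals

-- Turns the hypothesis on the letter counts, which as a real inequality holds up to every ε, into
-- an inequality of rationals.
≤-closed : ∀ {p q} → (∀ ε → .{{Positive ε}} → p ℚ.≤ q ℚ.+ ε) → p ℚ.≤ q
≤-closed {p} {q} h with p ℚ.≤? q
... | yes p≤q = p≤q
... | no  p≰q = contradiction (ℚ.<-≤-trans 0<ε (subst (ℚ._≤ 0ℚ) (lemma₂ ε) (ℚ.neg-antimono-≤ -ε≥0))) (ℚ.<-irrefl refl)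
  where
  ε : ℚ
  ε = ½ ℚ.* (p ℚ.- q)
  lemma₀ : ∀ q → q ℚ.- q ≡ 0ℚ
  lemma₀ = ℚ.+-inverseʳ
  0<ε : 0ℚ ℚ.< ε
  0<ε = ℚ.positive⁻¹ ½ ⊗⁺ subst (ℚ._< p ℚ.- q) (lemma₀ q) (ℚ.+-monoˡ-< (ℚ.- q) (ℚ.≰⇒> p≰q))
  lemma₁ = solve 2 (λ p q → (q :+ con ½ :* (p :- q)) :- p :=  :- (con ½ :* (p :- q))) refl
  lemma₂ = solve 1 (λ x → :- (:- x) := x) refl
  -ε≥0 : 0ℚ ℚ.≤ ℚ.- ε
  -ε≥0 = subst (0ℚ ℚ.≤_) (lemma₁ p q) (gap (h ε {{positive 0<ε}}))

module Approximate {ρ : ℚ} (constants : Robust ρ) {n ℓ : ℕ} {κ : Vec ℕ ℓ} (N≤n : Robust.N constants ℕ.≤ n)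
  (κ-lower : ∀ a → ρ ℚ.* # n ℚ.≤ # lookup κ a) (i : Fin n) (c : ℝ) (a : Fin n → Fin ℓ → ℝ) where

  open Robust constants using (K; 0≤K; m₀; 0<m₀; ε₁; 0<ε₁; robust)

  polynomial : Multislice n κ → ℝ
  polynomial u = c + ∑ (List.allFin n) λ j → ∑ (List.allFin ℓ) λ i → a j i * x[ j , i ] u

  private
    E : (Multislice n κ → ℚ) → ℚ
    E = mean n κ

    module E = PositiveLinear (mean-positiveLinear n κ)

    f : ℕ → Multislice n κ → ℚ
    f m u = seq (polynomial u) m

    φ : ℕ → Fin n → Fin ℓ → ℚ
    φ m j i = seq (a j i) m

  distance : ℕ → ℚ
  distance m = E (λ u → dist² (f m u))

  error : ℕ → Fin n → (Fin ℓ → Bool) → ℚ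
  error m j γ = E (λ u → (f m u ℚ.- bit (γ (lookup (word u) j))) ℚ.* (f m u ℚ.- bit (γ (lookup (word u) j))))

  f≡ : ∀ m u → f m u ≡ seq c m ℚ.+ Rational.∑ (λ j → φ m j (lookup (word u) j))
  f≡ m u = cong (seq c m ℚ.+_) (trans (seq-∑ (List.allFin n) (λ j → ∑ (List.allFin ℓ) (λ i → a j i * x[ j , i ] u)) m)
    (trans (sym (∑-allFin n (λ j → seq (∑ (List.allFin ℓ) (λ i → a j i * x[ j , i ] u)) m))) (Rational.∑.congr letter)))
    where
    letter : ∀ j → seq (∑ (List.allFin ℓ) (λ i → a j i * x[ j , i ] u)) m ≡ φ m j (lookup (word u) j)
    letter j = trans (seq-∑ (List.allFin ℓ) (λ i → a j i * x[ j , i ] u) m)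
      (trans (sym (∑-allFin ℓ (λ i → seq (a j i * x[ j , i ] u) m)))
      (trans (Rational.∑.congr (λ i → trans
          (cong (seq (a j i) m ℚ.*_) (trans (seq-⟦⟧ (does (lookup (word u) j Fin.≟ i)) m) (sym (δ-does (lookup (word u) j) i))))
               (ℚ.*-comm (φ m j i) (δ (lookup (word u) j) i))))
        (∑-δˡ (lookup (word u) j) (φ m j))))

  distanceℝ : ℝ
  distanceℝ = 𝔼 (λ u → dist (polynomial u) (0ℝ ∷ 1ℝ ∷ []) ²)

  seq-distance : ∀ m → seq distanceℝ m ≡ distance m
  seq-distance m = trans (seq-𝔼 (λ u → dist (polynomial u) (0ℝ ∷ 1ℝ ∷ []) ²) m) (E.congr (λ u → sym (dist²-def (f m u))))

  private
    -- A substitute for half the square root of `m₀`: as `w` is at most 1 and at most `m₀`, its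
    -- square is at most `m₀`.
    w δ₁ : ℚ
    w = m₀ ℚ.⊓ 1ℚ
    δ₁ = ½ ℚ.* w
    0<w : 0ℚ ℚ.< w
    0<w = ⊓-pos 0<m₀ (ℚ.positive⁻¹ 1ℚ)
    0<δ₁ : 0ℚ ℚ.< δ₁
    0<δ₁ = ℚ.positive⁻¹ ½ ⊗⁺ 0<w
    δ₁² : δ₁ ℚ.* δ₁ ℚ.≤ pos 1 ℚ./ 4 ℚ.* m₀
    δ₁² = by (ℚ.nonNegative⁻¹ (pos 1 ℚ./ 4) ⊗ (gap (ℚ.p⊓q≤p m₀ 1ℚ) ⊕ ℚ.<⇒≤ 0<w ⊗ gap (ℚ.p⊓q≤q m₀ 1ℚ))) (lemma m₀ w)
      where
      lemma = solve 2 (λ m w → con (pos 1 ℚ./ 4) :* m :- con ½ :* w :* (con ½ :* w) := con (pos 1 ℚ./ 4) :*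
          ((m :- w) :+ w :* (con 1ℚ :- w))) refl

    -- The modulus of convergence depends on the point, but there are finitely many points. All
    -- later `m` are included because the choice made at one index has to survive at all of them.
    settled : ∃[ M ] ∀ k → M ℕ.≤ k → ∀ u → u ∈ points n κ → ∀ m → k ℕ.≤ m → ℚ.∣ f m u ℚ.- f k u ∣ ℚ.≤ δ₁
    settled = uniformly-eventually (λ u k → ∀ m → k ℕ.≤ m → ℚ.∣ f m u ℚ.- f k u ∣ ℚ.≤ δ₁) (points n κ) λ u →
      let N , h = cauchy (polynomial u) δ₁ {{positive 0<δ₁}}
      in N , λ k N≤k m k≤m → h m k (ℕ.≤-trans N≤k k≤m) N≤k

  -- f is known only through rational approximations, so the dictator is read off one that is good enough.
  approximation : Σ[ j ∈ Fin n ] Σ[ γ ∈ (Fin ℓ → Bool) ] ∃[ M ] ∀ m → M ℕ.≤ m →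
                  error m j γ ℚ.≤ distance m ℚ.+ K ℚ.* (distance m ℚ.* distance m)
  approximation = cases (List.length (points n κ)) refl
    where
    Goal : Set
    Goal = Σ[ j ∈ Fin n ] Σ[ γ ∈ (Fin ℓ → Bool) ] ∃[ M ] ∀ m → M ℕ.≤ m →
           error m j γ ℚ.≤ distance m ℚ.+ K ℚ.* (distance m ℚ.* distance m)
    cases : ∀ k → List.length (points n κ) ≡ k → Goal
    -- On an empty multislice every mean is 0.
    cases zero empty = i , (λ _ → false) , 0 , λ m _ → ℚ.≤-trans (ℚ.≤-reflexive (mean-empty n κ empty _))
      (E.nonneg (λ u → dist²≥0 (f m u)) ⊕ 0≤K ⊗ sq (distance m))
    cases (suc k) nonempty = j , γ , M , λ m M≤m →
      subst₂ ℚ._≤_ (E.congr (λ u → cong (λ x → (x ℚ.- bit (γ (lookup (word u) j))) ℚ.* (x ℚ.- bit (γ (lookup (word u) j))))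
          (sym (f≡ m u))))
        (cong (λ x → x ℚ.+ K ℚ.* (x ℚ.* x)) (sym (distance≡ m)))
        (proj₂ (proj₂ chosen) (seq c m) (φ m) (close m M≤m) (subst₂ (λ x y → x ℚ.≤ y ℚ.+ ε₁) (distance≡ M) (distance≡ m)
            (near m M≤m)))
      where
      S = slice n κ nonempty
      module D m = Analysis.Degree1 S (seq c m) (φ m)
      -- From `M₁` on the values of `f` move by at most `δ₁`, from `M₂` on the distance moves by at
      -- most `ε₁`: the two kinds of closeness in `Robust`. The dictator is read off at index `M`.
      M₁ M₂ M : ℕ
      M₁ = proj₁ settled
      M₂ = proj₁ (cauchy distanceℝ ε₁ {{positive 0<ε₁}})
      M = M₁ ℕ.⊔ M₂
      chosen = robust S N≤n κ-lower (seq c M) (φ M)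
      j : Fin n
      j = proj₁ chosen
      γ : Fin ℓ → Bool
      γ = proj₁ (proj₂ chosen)
      distance≡ : ∀ m → distance m ≡ E (λ u → dist² (D.f m u))
      distance≡ m = E.congr (λ u → cong dist² (f≡ m u))
      near : ∀ m → M ℕ.≤ m → distance M ℚ.≤ distance m ℚ.+ ε₁
      near m M≤m = subst₂ (λ x y → x ℚ.≤ y ℚ.+ ε₁) (seq-distance M) (seq-distance m)
        (∣-∣-upper (seq distanceℝ M) (seq distanceℝ m)
          (proj₂ (cauchy distanceℝ ε₁ {{positive 0<ε₁}}) M m (ℕ.m≤n⊔m M₁ M₂) (ℕ.≤-trans (ℕ.m≤n⊔m M₁ M₂) M≤m)))
      close : ∀ m → M ℕ.≤ m → E (λ u → (D.f m u ℚ.- D.f M u) ℚ.* (D.f m u ℚ.- D.f M u)) ℚ.≤ pos 1 ℚ./ 4 ℚ.* m₀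
      close m M≤m = ℚ.≤-trans (E.mono pointwise) (ℚ.≤-trans (ℚ.≤-reflexive (Analysis.E-const S (δ₁ ℚ.* δ₁))) δ₁²)
        where
        pointwise : ∀ u → (D.f m u ℚ.- D.f M u) ℚ.* (D.f m u ℚ.- D.f M u) ℚ.≤ δ₁ ℚ.* δ₁
        pointwise u = subst (ℚ._≤ δ₁ ℚ.* δ₁) (∣x∣² (D.f m u ℚ.- D.f M u))
          (ℚ.≤-trans (scale (ℚ.0≤∣p∣ d) d≤) (ℚ.*-monoʳ-≤-nonNeg δ₁ {{ℚ.nonNegative (ℚ.<⇒≤ 0<δ₁)}} d≤))
          where
          d : ℚ
          d = D.f m u ℚ.- D.f M u
          d≤ : ℚ.∣ d ∣ ℚ.≤ δ₁
          d≤ = subst₂ (λ x y → ℚ.∣ x ℚ.- y ∣ ℚ.≤ δ₁) (f≡ m u) (f≡ M u)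
            (proj₂ settled M (ℕ.m≤m⊔n M₁ M₂) u (points-complete n κ u) m M≤m)

  -- The factor 2 is that of the triangle inequality for squares in `part₂`; `part₁` is stated with
  -- the same constant so that one K serves both.
  K₂ : ℝ
  K₂ = fromℚ (# 2 ℚ.* K)

  private
    j : Fin n
    j = proj₁ approximation
    γ : Fin ℓ → Bool
    γ = proj₁ (proj₂ approximation)
    M : ℕ
    M = proj₁ (proj₂ (proj₂ approximation))
    bound : ∀ m → M ℕ.≤ m → error m j γ ℚ.≤ distance m ℚ.+ K ℚ.* (distance m ℚ.* distance m)
    bound = proj₂ (proj₂ (proj₂ approximation))
    distance≥0 : ∀ m → 0ℚ ℚ.≤ distance m
    distance≥0 m = E.nonneg (λ u → dist²≥0 (f m u))

  dictator : Multislice n κ → Bool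
  dictator u = γ (lookup (word u) j)

  dictator-single : DependsOnSingleCoordinate dictator
  dictator-single = j , λ u v e → cong γ e

  part₁ : ∀ (g : Multislice n κ → ℝ) (ε : ℝ) → (∀ u → g u ≃ polynomial u) → 𝔼 (λ u → dist (g u) (0ℝ ∷ 1ℝ ∷ []) ²) ≃ ε →
          𝔼 (λ u → (g u - ⟦ dictator u ⟧) ²) ≤ ε + K₂ * ε ²
  part₁ g ε g≃ dist≃ε = ≤-from-seq {𝔼 (λ u → (g u - ⟦ dictator u ⟧) ²)} {𝔼 (λ u → (polynomial u - ⟦ dictator u ⟧) ²)}
      {ε + K₂ * ε ²} {distanceℝ + K₂ * distanceℝ ²} M
      (𝔼-cong {f = λ u → (g u - ⟦ dictator u ⟧) ²} {λ u → (polynomial u - ⟦ dictator u ⟧) ²}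
        (λ u → ²-cong {g u - ⟦ dictator u ⟧} {polynomial u - ⟦ dictator u ⟧}
            (minus-cong {g u} {polynomial u} {⟦ dictator u ⟧} {⟦ dictator u ⟧} (g≃ u) (≃-refl {⟦ dictator u ⟧}))))
      pointwise
      (+-cong {distanceℝ} {ε} {K₂ * distanceℝ ²} {K₂ * ε ²} distance≃ε
        (*-cong {K₂} {K₂} {distanceℝ ²} {ε ²} (≃-refl {K₂}) (²-cong {distanceℝ} {ε} distance≃ε)))
    where
    distance≃ε : distanceℝ ≃ ε
    distance≃ε = ≃-trans {distanceℝ} {𝔼 (λ u → dist (g u) (0ℝ ∷ 1ℝ ∷ []) ²)} {ε}
      (𝔼-cong {f = λ u → dist (polynomial u) (0ℝ ∷ 1ℝ ∷ []) ²} {λ u → dist (g u) (0ℝ ∷ 1ℝ ∷ []) ²}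
        (λ u → ²-cong {dist (polynomial u) (0ℝ ∷ 1ℝ ∷ [])} {dist (g u) (0ℝ ∷ 1ℝ ∷ [])}
          (dist-cong {polynomial u} {g u} (≃-sym {g u} {polynomial u} (g≃ u)))))
      dist≃ε
    lemma = solve 3 (λ d k e → (d :+ con (# 2) :* k :* (d :* d)) :- e := ((d :+ k :* (d :* d)) :- e) :+ k :* (d :* d)) refl
    pointwise : ∀ m → M ℕ.≤ m → seq (𝔼 (λ u → (polynomial u - ⟦ dictator u ⟧) ²)) m ℚ.≤ seq (distanceℝ + K₂ * distanceℝ ²) m
    pointwise m M≤m = subst₂ ℚ._≤_
      (sym (trans (seq-𝔼 (λ u → (polynomial u - ⟦ dictator u ⟧) ²) m)
        (E.congr (λ u → cong (λ b → (f m u ℚ.- b) ℚ.* (f m u ℚ.- b)) (seq-⟦⟧ (dictator u) m)))))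
      (cong (λ d → d ℚ.+ # 2 ℚ.* K ℚ.* (d ℚ.* d)) (sym (seq-distance m)))
      (by (gap (bound m M≤m) ⊕ 0≤K ⊗ sq (distance m)) (lemma (distance m) K (error m j γ)))

  -- As `F` is Boolean, `P` is at least as close to 0 or 1 as to `F`, so the dictator found for `P`
  -- has error at most ε + Kε². The probability of disagreement is the mean of (F - g)², at most 2ε
  -- + 2(ε + Kε²); this is where the 4 comes from.
  part₂ : ∀ (F : Multislice n κ → Bool) (P : Multislice n κ → ℝ) (ε : ℝ) → (∀ u → P u ≃ polynomial u) → ‖
      (λ u → ⟦ F u ⟧ - P u) ‖² ≃ ε →
          Pr (λ u → ¬? (F u ≟ dictator u)) ≤ fromℕ 4 * ε + K₂ * ε ²
  part₂ F P ε P≃ norm≃ε = ≤-from-seq {Pr (λ u → ¬? (F u ≟ dictator u))} {Pr (λ u → ¬? (F u ≟ dictator u))}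
      {fromℕ 4 * ε + K₂ * ε ²} {fromℕ 4 * norm + K₂ * norm ²} M
      (≃-refl {Pr (λ u → ¬? (F u ≟ dictator u))})
      pointwise
      (+-cong {fromℕ 4 * norm} {fromℕ 4 * ε} {K₂ * norm ²} {K₂ * ε ²}
        (*-cong {fromℕ 4} {fromℕ 4} {norm} {ε} (≃-refl {fromℕ 4}) norm≃)
        (*-cong {K₂} {K₂} {norm ²} {ε ²} (≃-refl {K₂}) (²-cong {norm} {ε} norm≃)))
    where
    norm : ℝ
    norm = ‖ (λ u → ⟦ F u ⟧ - polynomial u) ‖²
    norm≃ : norm ≃ ε
    norm≃ = ≃-trans {norm} {‖ (λ u → ⟦ F u ⟧ - P u) ‖²} {ε}
      (𝔼-cong {f = λ u → (⟦ F u ⟧ - polynomial u) ²} {λ u → (⟦ F u ⟧ - P u) ²}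
        (λ u → ²-cong {⟦ F u ⟧ - polynomial u} {⟦ F u ⟧ - P u}
          (minus-cong {⟦ F u ⟧} {⟦ F u ⟧} {polynomial u} {P u} (≃-refl {⟦ F u ⟧}) (≃-sym {P u} {polynomial u} (P≃ u)))))
      norm≃ε
    e : ℕ → ℚ
    e m = E (λ u → (bit (F u) ℚ.- f m u) ℚ.* (bit (F u) ℚ.- f m u))
    seq-norm : ∀ m → seq norm m ≡ e m
    seq-norm m = trans (seq-𝔼 (λ u → (⟦ F u ⟧ - polynomial u) ²) m)
      (E.congr (λ u → cong (λ b → (b ℚ.- f m u) ℚ.* (b ℚ.- f m u)) (seq-⟦⟧ (F u) m)))
    disagreement : ∀ b b′ → bit (does (¬? (b ≟ b′))) ≡ (bit b ℚ.- bit b′) ℚ.* (bit b ℚ.- bit b′)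
    disagreement true  true  = refl
    disagreement true  false = refl
    disagreement false true  = refl
    disagreement false false = refl
    distance≤e : ∀ m → distance m ℚ.≤ e m
    distance≤e m = E.mono (λ u → ℚ.≤-trans (dist²≤ (f m u) (F u)) (ℚ.≤-reflexive (lemma (f m u) (bit (F u)))))
      where
      lemma = solve 2 (λ x y → (x :- y) :* (x :- y) := (y :- x) :* (y :- x)) refl
    triangle : ∀ m → E (λ u → bit (does (¬? (F u ≟ dictator u)))) ℚ.≤ # 2 ℚ.* e m ℚ.+ # 2 ℚ.* error m j γ
    triangle m = ℚ.≤-trans
      (E.mono (λ u → ℚ.≤-trans (ℚ.≤-reflexive (disagreement (F u) (dictator u)))
        (by (sq ((bit (F u) ℚ.- f m u) ℚ.- (f m u ℚ.- bit (dictator u)))) (lemma (bit (F u)) (f m u) (bit (dictator u))))))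
      (ℚ.≤-reflexive (E.combine (# 2) (# 2) (λ u → (bit (F u) ℚ.- f m u) ℚ.* (bit (F u) ℚ.- f m u))
        (λ u → (f m u ℚ.- bit (dictator u)) ℚ.* (f m u ℚ.- bit (dictator u)))))
      where
      lemma = solve 3 (λ x y z → (con (# 2) :* ((x :- y) :* (x :- y)) :+ con (# 2) :* ((y :- z) :* (y :- z))) :- (x :- z) :*
          (x :- z)
        := ((x :- y) :- (y :- z)) :* ((x :- y) :- (y :- z))) refl
    lemma = solve 4 (λ e d k r → (con (# 4) :* e :+ con (# 2) :* k :* (e :* e)) :- (con (# 2) :* e :+ con (# 2) :* r)
      := con (# 2) :* ((d :+ k :* (d :* d)) :- r) :+
          (con (# 2) :* (e :- d) :+ con (# 2) :* k :* ((e :- d) :* ((e :- d) :+ con (# 2) :* d)))) refl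
    pointwise : ∀ m → M ℕ.≤ m → seq (Pr (λ u → ¬? (F u ≟ dictator u))) m ℚ.≤ seq (fromℕ 4 * norm + K₂ * norm ²) m
    pointwise m M≤m = subst₂ ℚ._≤_
      (sym (trans (seq-𝔼 (λ u → ⟦ does (¬? (F u ≟ dictator u)) ⟧) m) (E.congr (λ u → seq-⟦⟧ (does (¬? (F u ≟ dictator u))) m))))
      (cong (λ d → # 4 ℚ.* d ℚ.+ # 2 ℚ.* K ℚ.* (d ℚ.* d)) (sym (seq-norm m)))
      (ℚ.≤-trans (triangle m) (by
        ( #-nonneg 2 ⊗ gap (bound m M≤m)
        ⊕ (#-nonneg 2 ⊗ gap (distance≤e m) ⊕ #-nonneg 2 ⊗ 0≤K ⊗
            (gap (distance≤e m) ⊗ (gap (distance≤e m) ⊕ #-nonneg 2 ⊗ distance≥0 m))))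
        (lemma (e m) (distance m) K (error m j γ))))


-- The theorem over ℝ

theorem1p1 : (ℓ : ℕ) → 2 ℕ.≤ ℓ → (ρ : ℝ) → 0ℝ < ρ →
    Σ[ N ∈ ℕ ] Σ[ K ∈ ℝ ]
    ((n : ℕ) → N ℕ.≤ n →
    (κ : Vec ℕ ℓ) → ((i : Fin ℓ) → 1 ℕ.≤ lookup κ i) → sum κ ≡ n →
    ((i : Fin ℓ) → ρ * fromℕ n ≤ fromℕ (lookup κ i)) →
    ((f : Multislice n κ → ℝ) (ε : ℝ) →
    IsDegree1 f →
    𝔼 (λ u → dist (f u) (0ℝ ∷ 1ℝ ∷ []) ²) ≃ ε →
    Σ[ g ∈ (Multislice n κ → Bool) ]
    (DependsOnSingleCoordinate g ×
    𝔼 (λ u → (f u - ⟦ g u ⟧) ²) ≤ ε + K * ε ²))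
    ×
    ((F : Multislice n κ → Bool) (F≤1 : Multislice n κ → ℝ) (ε : ℝ) →
    IsDegree1Projection (λ u → ⟦ F u ⟧) F≤1 →
    ‖ (λ u → ⟦ F u ⟧ - F≤1 u) ‖² ≃ ε →
    Σ[ g ∈ (Multislice n κ → Bool) ]
    (DependsOnSingleCoordinate g ×
    Pr (λ u → ¬? (F u ≟ g u)) ≤ fromℕ 4 * ε + K * ε ²)))
-- `ρ₀` is the positive rational lower bound of `ρ` contained in the proof of `0ℝ < ρ`, and the
-- constants are those of `ρ₀`. With `suc N` in place of `N`, n is positive and a position `i`
-- exists.
theorem1p1 ℓ _ ρ (ρ₀ , ρ₀-pos , M , ρ-lower) = suc N , fromℚ (# 2 ℚ.* K) , λ n N<n κ _ _ κ-lower →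
  let i = fromℕ< (ℕ.≤-trans (ℕ.s≤s ℕ.z≤n) N<n)
      lower = λ a → rational-lower n (lookup κ a) (κ-lower a)
      module A (c : ℝ) a = Approximate constants {n} {ℓ} {κ} (ℕ.<⇒≤ N<n) lower i c a
  in (λ f ε (c , a , f≃) dist≃ε → A.dictator c a , A.dictator-single c a , A.part₁ c a f ε f≃ dist≃ε)
   , (λ F P ε ((c , a , P≃) , _) norm≃ε → A.dictator c a , A.dictator-single c a , A.part₂ c a F P ε P≃ norm≃ε)
  where
  0<ρ₀ : ℚ.0ℚ ℚ.< ρ₀
  0<ρ₀ = ℚ.positive⁻¹ ρ₀ {{ρ₀-pos}}
  constants : Robust ρ₀
  constants = stability ρ₀ 0<ρ₀
  open Robust constants using (N; K)
  rational-lower : ∀ n k → ρ * fromℕ n ≤ fromℕ k → ρ₀ ℚ.* # n ℚ.≤ # k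
  rational-lower n k ρn≤k = ≤-closed λ ε → bound ε (ρn≤k ε)
    where
    bound : ∀ ε → Σ[ M′ ∈ ℕ ] (∀ m → M′ ℕ.≤ m → seq ρ m ℚ.* # n ℚ.≤ # k ℚ.+ ε) → ρ₀ ℚ.* # n ℚ.≤ # k ℚ.+ ε
    bound ε (M′ , h) = ℚ.≤-trans
      (ℚ.*-monoʳ-≤-nonNeg (# n) {{ℚ.normalize-nonNeg n 1}}
        (subst (ℚ._≤ seq ρ (M ℕ.⊔ M′)) (ℚ.+-identityˡ ρ₀) (ρ-lower (M ℕ.⊔ M′) (ℕ.m≤m⊔n M M′))))
      (h (M ℕ.⊔ M′) (ℕ.m≤n⊔m M M′))
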